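{- Let $1\le m\le n$ and fix a hybridization $\beta\in\{\mathsf w,\mathsf e\}^m$; write $G_\pi=G^\beta_\pi$. Then: (a) if $\pi\in\mathfrak S_{m,n}$ is decreasing ($\pi(1)>\pi(2)>\dots>\pi(m)$), then \[G_\pi=\prod_{i=1}^m\Big((A+B)\prod_{j=1}^{\pi(i)-1}(A+x_i-y_j)\prod_{j=\pi(i)+1}^{n}(B-x_i+y_j)\Big);\] (b) for $\pi\in\mathfrak S_{m,n}$ and $1\le i<m$, letting $\pi'=\pi\circ r_i$ (i.e. $\pi$ with the values $\pi(i),\pi(i+1)$ exchanged), \[G_\pi=\frac{1}{x_i-x_{i+1}}\Big((A+B)\,G_{\pi'}-(A+B+x_i-x_{i+1})\,r_iG_{\pi'}\Big),\] where $r_i$ acts on polynomials by exchanging $x_i$ and $x_{i+1}$. Moreover, the family $(G_\pi)_{\pi\in\mathfrak S_{m,n}}$ is uniquely determined by (a) and (b).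
   Context: Fix $1\le m\le n$. $\mathfrak S_{m,n}$ is the set of injective maps $\{1,\dots,m\}\to\{1,\dots,n\}$; $r_i$ is the transposition $(i\ i+1)$. A hybridization is $\beta\in\{\mathsf w,\mathsf e\}^m$; row $i$ of an $m\times n$ grid has type $\beta_i$. A hybrid generic pipe dream of type $\beta$ is a filling of the grid with tiles (unit squares in which pipes join edge midpoints). Rows of type $\mathsf w$ allow: blank; straight tiles horizontal (West–East), vertical (South–North), cross; elbow tiles: West–North, South–East, and the double elbow (both). Rows of type $\mathsf e$ allow: blank; the same straight tiles; elbow tiles East–North, South–West, and the double elbow (both). Conditions: no pipe starts or ends inside the grid; each $\mathsf w$ row has a pipe entering through its West boundary edge and none exiting East; each $\mathsf e$ row has a pipe entering through its East boundary edge and none exiting West; no pipe crosses the South boundary; double crossings are allowed. Pipes are numbered counterclockwise from the northwest corner (West-entering pipes $1,\dots,k$ top to bottom, then East-entering pipes $k+1,\dots,m$ bottom to top); $\varphi(i)$ is the number of the pipe entering in row $i$; the connectivity is $\pi\in\mathfrak S_{m,n}$ with pipe $i$ exiting the North side in column $\pi(i)$. Tile weights: elbows $A+B$; if $\beta_i=\mathsf w$: blank at $(i,j)$ gives $B-x_{\varphi(i)}+y_j$, straight gives $A+x_{\varphi(i)}-y_j$; if $\beta_i=\mathsf e$: blank gives $A+x_{\varphi(i)}-y_j$, straight gives $B-x_{\varphi(i)}+y_j$. $G^\beta_\pi\in\mathbb Z[x_1,\dots,x_m,y_1,\dots,y_n,A,B]$ is the sum over pipe dreams of type $\beta$ with connectivity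 $\pi$ of the product of tile weights. -}

module Defs where

open import Data.Bool using (Bool; true; false; _∧_; if_then_else_; not)
open import Data.Nat as ℕ using (ℕ; zero; suc; _∸_)
import Data.Nat.Properties as ℕP
open import Data.Integer as ℤ using (ℤ; +_)
open import Data.Fin as Fin using (Fin; toℕ)
open import Data.Fin.Permutation.Components using (transpose; transpose-inverse)
open import Data.List as List using (List; []; _∷_; _++_; map; concatMap; filter; allFin; upTo; zip; foldr; reverse)
open import Data.Vec as Vec using (Vec)
import Data.Vec.Properties as VecP
open import Data.Maybe using (Maybe; just; nothing)
open import Data.Product using (Σ; _×_; _,_; proj₁; proj₂)
open import Function using (_∘_)
open import Function.Definitions using (Injective)
open import Relation.Binary.PropositionalEquality using (_≡_; refl; cong; trans; sym)
open import Relation.Nullary using (does)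

Inj : ℕ → ℕ → Set
Inj m n = Σ (Fin m → Fin n) (Injective _≡_ _≡_)

Decreasing : ∀ {m n} → Inj m n → Set
Decreasing {m} (π , _) = (i j : Fin m) → i Fin.< j → π j Fin.< π i

_∘r⟨_,_⟩ : ∀ {m n} → Inj m n → Fin m → Fin m → Inj m n
(π , inj) ∘r⟨ i , j ⟩ = (π ∘ transpose i j) , λ {a} {b} e →
  trans (sym (transpose-inverse j i {a}))
        (trans (cong (transpose j i) (inj e)) (transpose-inverse j i {b}))

-- The polynomial ring  ℤ[x_1..x_m, y_1..y_n, A, B]
-- A polynomial is a finite formal ℤ-linear combination of monomials;
-- two polynomials are equal iff all their coefficients agree.

record Mono (m n : ℕ) : Set where
  constructor mono
  field
    ex : Vec ℕ m
    ey : Vec ℕ n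
    eA : ℕ
    eB : ℕ
open Mono public

monoEq : ∀ {m n} → Mono m n → Mono m n → Bool
monoEq (mono a b c d) (mono a' b' c' d') =
  does (VecP.≡-dec ℕP._≟_ a a') ∧ does (VecP.≡-dec ℕP._≟_ b b')
  ∧ does (c ℕP.≟ c') ∧ does (d ℕP.≟ d')

mono1 : ∀ {m n} → Mono m n
mono1 = mono (Vec.replicate _ 0) (Vec.replicate _ 0) 0 0

monoMul : ∀ {m n} → Mono m n → Mono m n → Mono m n
monoMul (mono a b c d) (mono a' b' c' d') =
  mono (Vec.zipWith ℕ._+_ a a') (Vec.zipWith ℕ._+_ b b') (c ℕ.+ c') (d ℕ.+ d')

Poly : ℕ → ℕ → Set
Poly m n = List (ℤ × Mono m n)

coeff : ∀ {m n} → Poly m n → Mono m n → ℤ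
coeff [] e = + 0
coeff ((c , e') ∷ p) e = if monoEq e' e then c ℤ.+ coeff p e else coeff p e

infix 4 _≈P_
_≈P_ : ∀ {m n} → Poly m n → Poly m n → Set
p ≈P q = ∀ e → coeff p e ≡ coeff q e

infixl 6 _+P_ _-P_
infixl 7 _*P_

cst : ∀ {m n} → ℤ → Poly m n
cst c = (c , mono1) ∷ []

1P : ∀ {m n} → Poly m n
1P = cst (+ 1)

_+P_ : ∀ {m n} → Poly m n → Poly m n → Poly m n
p +P q = p ++ q

-P_ : ∀ {m n} → Poly m n → Poly m n
-P p = map (λ { (c , e) → (ℤ.- c , e) }) p

_-P_ : ∀ {m n} → Poly m n → Poly m n → Poly m n
p -P q = p +P (-P q)

_*P_ : ∀ {m n} → Poly m n → Poly m n → Poly m n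
p *P q = concatMap (λ { (c , e) → map (λ { (d , f) → (c ℤ.* d , monoMul e f) }) q }) p

sumP : ∀ {m n} → List (Poly m n) → Poly m n
sumP = foldr _+P_ []

prodP : ∀ {m n} → List (Poly m n) → Poly m n
prodP = foldr _*P_ 1P

X : ∀ {m n} → Fin m → Poly m n
X {m} i = (+ 1 , mono (Vec.updateAt (Vec.replicate m 0) i (λ _ → 1)) (Vec.replicate _ 0) 0 0) ∷ []

Y : ∀ {m n} → Fin n → Poly m n
Y {n = n} j = (+ 1 , mono (Vec.replicate _ 0) (Vec.updateAt (Vec.replicate n 0) j (λ _ → 1)) 0 0) ∷ []

A : ∀ {m n} → Poly m n
A = (+ 1 , mono (Vec.replicate _ 0) (Vec.replicate _ 0) 1 0) ∷ []

B : ∀ {m n} → Poly m n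
B = (+ 1 , mono (Vec.replicate _ 0) (Vec.replicate _ 0) 0 1) ∷ []

swapX : ∀ {m n} → Fin m → Fin m → Poly m n → Poly m n
swapX i j = map (λ { (c , mono a b u v) →
  (c , mono (Vec.tabulate (λ k → Vec.lookup a (transpose i j k))) b u v) })

data RowType : Set where
  w e : RowType

isW : RowType → Bool
isW w = true
isW e = false

isE : RowType → Bool
isE r = not (isW r)

data Side : Set where
  N S E W : Side

data Tile : Set where
  blank horiz vert cross : Tile
  elbWN elbSE dblW : Tile
  elbEN elbSW dblE : Tile

allTiles : List Tile
allTiles = blank ∷ horiz ∷ vert ∷ cross ∷ elbWN ∷ elbSE ∷ dblW ∷ elbEN ∷ elbSW ∷ dblE ∷ []

allowed : RowType → Tile → Bool
allowed w elbEN = false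
allowed w elbSW = false
allowed w dblE  = false
allowed e elbWN = false
allowed e elbSE = false
allowed e dblW  = false
allowed _ _     = true

isElbow : Tile → Bool
isElbow elbWN = true
isElbow elbSE = true
isElbow dblW  = true
isElbow elbEN = true
isElbow elbSW = true
isElbow dblE  = true
isElbow _     = false

isStraight : Tile → Bool
isStraight horiz = true
isStraight vert  = true
isStraight cross = true
isStraight _     = false

-- a pipe entering the tile through side s leaves through side (conn t s)
conn : Tile → Side → Maybe Side
conn horiz W = just E
conn horiz E = just W
conn vert  S = just N
conn vert  N = just S
conn cross W = just E
conn cross E = just W
conn cross S = just N
conn cross N = just S
conn elbWN W = just N
conn elbWN N = just W
conn elbSE S = just E
conn elbSE E = just S
conn dblW  W = just N
conn dblW  N = just W
conn dblW  S = just E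
conn dblW  E = just S
conn elbEN E = just N
conn elbEN N = just E
conn elbSW S = just W
conn elbSW W = just S
conn dblE  E = just N
conn dblE  N = just E
conn dblE  S = just W
conn dblE  W = just S
conn _     _ = nothing

has : Side → Tile → Bool
has s t with conn t s
... | just _  = true
... | nothing = false

Grid : ℕ → ℕ → Set
Grid m n = Vec (Vec Tile n) m    -- row 0 is the northmost row

nth : ∀ {a} {A : Set a} {k} → Vec A k → ℕ → Maybe A
nth Vec.[] _ = nothing
nth (x Vec.∷ _) zero = just x
nth (_ Vec.∷ xs) (suc i) = nth xs i

tileAt : ∀ {m n} → Grid m n → ℕ → ℕ → Maybe Tile
tileAt D i j with nth D i
... | nothing = nothing
... | just row = nth row j

allVecs : ∀ {a} {A : Set a} → List A → (k : ℕ) → List (Vec A k)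
allVecs xs zero = Vec.[] ∷ []
allVecs xs (suc k) = concatMap (λ x → map (x Vec.∷_) (allVecs xs k)) xs

allGrids : (m n : ℕ) → List (Grid m n)
allGrids m n = allVecs (allVecs allTiles n) m

eqB : Bool → Bool → Bool
eqB true b = b
eqB false b = not b

allB : ∀ {a} {A : Set a} → (A → Bool) → List A → Bool
allB p = foldr (λ x r → p x ∧ r) true

tilesAllowed : ∀ {m n} → Vec RowType m → Grid m n → Bool
tilesAllowed β D = allB (λ i → allB (allowed (Vec.lookup β i)) (Vec.toList (Vec.lookup D i))) (allFin _)

-- no pipe starts or ends inside the grid, boundary conditions:
-- W boundary of row i carries a pipe iff β_i = w, E boundary iff β_i = e,
-- no pipe crosses the S boundary (the N boundary is free).
consistentAt : ∀ {m n} → Vec RowType m → Grid m n → Fin m → ℕ → Tile → Bool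
consistentAt β D i j t =
  westOK ∧ eastOK ∧ southOK
  where
    r = Vec.lookup β i
    westAt : ℕ → Bool
    westAt zero = eqB (has W t) (isW r)
    westAt (suc _) = true      -- checked as the east side of the western neighbour
    westOK = westAt j
    eastAt : Maybe Tile → Bool
    eastAt nothing = eqB (has E t) (isE r)
    eastAt (just t') = eqB (has E t) (has W t')
    eastOK = eastAt (tileAt D (toℕ i) (suc j))
    southAt : Maybe Tile → Bool
    southAt nothing = eqB (has S t) false
    southAt (just t') = eqB (has S t) (has N t')
    southOK = southAt (tileAt D (suc (toℕ i)) j)

consistent : ∀ {m n} → Vec RowType m → Grid m n → Bool
consistent {m} {n} β D =
  allB (λ i → allB (λ j → consistentAt β D i (toℕ j) (Vec.lookup (Vec.lookup D i) j)) (allFin n)) (allFin m)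

-- follow a pipe that enters tile (i , j) (row, column, 0-based) through side s;
-- returns  just c  if it leaves the grid through the North side in column c.
-- A non-looping path visits each of the 4mn (tile, side) states at most once,
-- so fuel 4mn+1 suffices; running out of fuel means the path never exits.
trace : ∀ {m n} → ℕ → Grid m n → ℕ → ℕ → Side → Maybe ℕ
trace zero D i j s = nothing
trace (suc f) D i j s with tileAt D i j
... | nothing = nothing
... | just t with conn t s
...   | nothing = nothing
...   | just N with i
...     | zero = just j
...     | suc i' = trace f D i' j S
trace (suc f) D i j s | just t | just S = trace f D (suc i) j N
trace (suc f) D i j s | just t | just E = trace f D i (suc j) W
trace (suc f) D i j s | just t | just W with j
...     | zero = nothing
...     | suc j' = trace f D i j' E

tracePipe : ∀ {m n} → Vec RowType m → Grid m n → Fin m → Maybe ℕ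
tracePipe {m} {n} β D r with Vec.lookup β r
... | w = trace (suc (4 ℕ.* m ℕ.* n)) D (toℕ r) 0 W
... | e = trace (suc (4 ℕ.* m ℕ.* n)) D (toℕ r) (n ∸ 1) E

-- numbering of pipes: the w rows top to bottom, then the e rows bottom to top.
-- pipeRows β !! p  is the row in which pipe p (0-based) enters,
-- i.e. the list is the inverse of φ.
pipeRows : ∀ {m} → Vec RowType m → List (Fin m)
pipeRows β = filter (λ r → isW (Vec.lookup β r) Data.Bool.≟ true) (allFin _)
          ++ reverse (filter (λ r → isE (Vec.lookup β r) Data.Bool.≟ true) (allFin _))
  where import Data.Bool

pipes : ∀ {m} → Vec RowType m → List (Fin m × Fin m)
pipes β = zip (allFin _) (pipeRows β)

eqMaybe : Maybe ℕ → ℕ → Bool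
eqMaybe nothing _ = false
eqMaybe (just a) b = does (a ℕP.≟ b)

connectivityIs : ∀ {m n} → Vec RowType m → Inj m n → Grid m n → Bool
connectivityIs β (π , _) D =
  allB (λ { (p , r) → eqMaybe (tracePipe β D r) (toℕ (π p)) }) (pipes β)

isPipeDream : ∀ {m n} → Vec RowType m → Inj m n → Grid m n → Bool
isPipeDream β π D = tilesAllowed β D ∧ consistent β D ∧ connectivityIs β π D

-- weight of tile t at (row of type r, column j), carried by pipe p = φ(row)
tileWeight : ∀ {m n} → RowType → Fin m → Fin n → Tile → Poly m n
tileWeight r p j t =
  if isElbow t then A +P B
  else if isStraight t then straightW r
  else blankW r
  where
    straightW blankW : RowType → Poly _ _
    straightW w = A +P X p -P Y j
    straightW e = B -P X p +P Y j
    blankW w = B -P X p +P Y j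
    blankW e = A +P X p -P Y j

weight : ∀ {m n} → Vec RowType m → Grid m n → Poly m n
weight {m} {n} β D =
  prodP (map (λ { (p , r) →
     prodP (map (λ j → tileWeight (Vec.lookup β r) p j (Vec.lookup (Vec.lookup D r) j)) (allFin n)) })
   (pipes β))

G : ∀ {m n} → Vec RowType m → Inj m n → Poly m n
G {m} {n} β π = sumP (map (weight β) (filter (λ D → isPipeDream β π D Data.Bool.≟ true) (allGrids m n)))
  where import Data.Bool

decreasingFormula : ∀ {m n} → Inj m n → Poly m n
decreasingFormula {m} {n} (π , _) =
  prodP (map (λ i → (A +P B)
     *P prodP (map (λ j → A +P X i -P Y j) (filter (λ j → j Fin.<? π i) (allFin n)))
     *P prodP (map (λ j → B -P X i +P Y j) (filter (λ j → π i Fin.<? j) (allFin n))))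
   (allFin m))

-- (b) multiplied by (x_i - x_j):
--  (x_i - x_j) F_π = (A+B) F_π' - (A+B+x_i-x_j) r_i F_π'
DividedDifference : (m n : ℕ) → (Inj m n → Poly m n) → Set
DividedDifference m n F =
  (π : Inj m n) (i j : Fin m) → toℕ j ≡ suc (toℕ i) →
  (X i -P X j) *P F π
    ≈P (A +P B) *P F (π ∘r⟨ i , j ⟩)
       -P (A +P B +P X i -P X j) *P swapX i j (F (π ∘r⟨ i , j ⟩))

DecreasingRule : (m n : ℕ) → (Inj m n → Poly m n) → Set
DecreasingRule m n F = (π : Inj m n) → Decreasing π → F π ≈P decreasingFormula π

{-# OPTIONS --safe #-}
-- Colour every pipe by its exit column. A row then acts on words of colours as a product of vertices,
-- one for each column, whose weights satisfy the Yang-Baxter equation for w and e rows alike: with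
-- u the weight of a straight tile, u + blank = A + B throughout, and the equation only asks the
-- straight weights to be additive. Pulling a crossing through two adjacent rows shows that a w row and
-- an e row commute up to the factor A + B + x - x', which is not a zero divisor, and gives the exchange
-- relation between two w rows. A lone pipe sees the same weights in a bottom row of either type,
-- so every hybridization reduces to w...w. There (b) is the exchange relation, and in the
-- decreasing case each pipe is forced to turn exactly once. Finally (b) determines F at an ascent from
-- its value after the exchange, which lowers Σ i π(i), as x_i - x_{i+1} is not a zero divisor.

module Submission where

open import Defs
open import Algebra using (CommutativeRing)
open import Data.Bool as Bool using (Bool; true; false; _∧_; if_then_else_; not)
open import Data.Empty using (⊥)
open import Data.Fin as Fin using (Fin; zero; suc; toℕ)
open import Data.Fin.Permutation.Components using (transpose)
import Data.Fin.Properties as FinP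
open import Data.Integer as ℤ using (ℤ; +_) renaming (_+_ to _+ᶻ_; _*_ to _*ᶻ_)
import Data.Integer.Properties as ℤP
open import Data.List as List using (List; []; _∷_; _++_; map; concatMap; zip; filter; reverse; allFin; length; initLast; _∷ʳ′_)
import Data.List.Properties as ListP
import Data.List.Membership.DecPropositional as DecMembership
open import Data.List.Membership.Propositional using (_∈_; _∉_)
open import Data.List.Membership.Propositional.Properties using (∈-allFin; ∈-tabulate⁺; ∈-tabulate⁻; ∈-map⁺; ∈-map⁻)
open import Data.List.Relation.Binary.Permutation.Propositional as Perm using (_↭_; ↭-sym; ↭-trans; ↭-reflexive; prep)
open import Data.List.Relation.Binary.Permutation.Propositional.Properties using (∈-resp-↭; map⁺; ++-comm)
open import Data.List.Relation.Unary.All as All using (All; []; _∷_)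
open import Data.List.Relation.Unary.AllPairs using (AllPairs; []; _∷_)
import Data.List.Relation.Unary.AllPairs.Properties as AllPairsP
open import Data.List.Relation.Unary.Any using (here; there)
open import Data.List.Relation.Unary.Unique.Propositional using (Unique)
open import Data.List.Relation.Unary.Unique.Propositional.Properties using (allFin⁺)
open import Data.Maybe using (Maybe; just; nothing; is-just)
import Data.Maybe.Properties as MaybeP
import Data.Maybe.Relation.Unary.All as Maybe
open import Data.Nat as ℕ using (ℕ; zero; suc; _≤_; _<_; z≤n; s≤s)
import Data.Nat.Properties as ℕP
open import Data.Product using (∃; ∃₂; _×_; _,_; proj₁; proj₂)
open import Data.Sum using (_⊎_; inj₁; inj₂)
open import Data.Vec as Vec using (Vec; []; _∷_; _[_]≔_)
import Data.Vec.Properties as VecP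
open import Data.Vec.Relation.Unary.All as VecAll using ([]; _∷_)
import Data.Vec.Relation.Unary.All.Properties as VecAllP
open import Function using (_∘_; _$_; id)
open import Function.Definitions using (Injective)
open import Level using (0ℓ; _⊔_)
open import Relation.Binary.Definitions using (Tri; tri<; tri≈; tri>)
open import Relation.Binary.PropositionalEquality using (_≡_; _≢_; refl; sym; trans; cong; cong₂; subst; subst₂; module ≡-Reasoning)
open import Relation.Nullary using (Reflects; ofʸ; ofⁿ; proof; Dec; yes; no; does; contradiction; _×-dec_)
open import Relation.Nullary.Decidable using (map′; dec-true; dec-false)
open import Relation.Unary using (Pred; Decidable)

-- Polynomials

-- Connectivity is defined by following each pipe with bounded fuel, which no local move respects.
-- Naming a pipe by its exit column replaces this by one boundary condition: the northern word must
-- show colour j in every used column j and nothing elsewhere. This word depends only on the set of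
-- exit columns, so it is the same for π and π∘r_i, and exchanging two values merely redistributes
-- colours among the rows. Hence a relation between row operators, tested on a single word, is a
-- relation between the G's. That the word captures connectivity rests on conservation: every colour
-- enters once and none is lost. In the factor A + B + x - x' the column variable has cancelled
-- between a w tile and an e tile, so one and the same crossing can travel through all columns.
-- Polynomials are unreduced lists with possibly repeated monomials, equal when their coefficients
-- agree. With no normal form to compute in, the ring laws come from pairing with arbitrary
-- functions on monomials.

module PolynomialRing {m n : ℕ} where

  infix 8 ⟨_∣_⟩
  infix 4 _≋_

  monoEq-reflects : ∀ (u v : Mono m n) → Reflects (u ≡ v) (monoEq u v)
  monoEq-reflects (mono a b c d) (mono a' b' c' d') = proof
    (map′ (λ { (refl , refl , refl , refl) → refl }) (λ { refl → refl , refl , refl , refl })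
      (VecP.≡-dec ℕP._≟_ a a' ×-dec VecP.≡-dec ℕP._≟_ b b' ×-dec c ℕP.≟ c' ×-dec d ℕP.≟ d'))

  -- The linear extension of g to polynomials. Equality of coefficients amounts to equality
  -- under all such functionals, and a product pairs as an iterated sum.
  ⟨_∣_⟩ : Poly m n → (Mono m n → ℤ) → ℤ
  ⟨ [] ∣ g ⟩ = + 0
  ⟨ (c , f) ∷ p ∣ g ⟩ = c *ᶻ g f +ᶻ ⟨ p ∣ g ⟩

  ι : Mono m n → Mono m n → ℤ
  ι u f = if monoEq f u then + 1 else + 0

  ι-self : ∀ u → ι u u ≡ + 1
  ι-self u with monoEq u u | monoEq-reflects u u
  ... | true | ofʸ _ = refl
  ... | false | ofⁿ u≢u = contradiction refl u≢u

  ι-other : ∀ {u f} → f ≢ u → ι u f ≡ + 0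
  ι-other {u} {f} f≢u with monoEq f u | monoEq-reflects f u
  ... | true | ofʸ f≡u = contradiction f≡u f≢u
  ... | false | ofⁿ _ = refl

  coeff-pair : ∀ p u → coeff p u ≡ ⟨ p ∣ ι u ⟩
  coeff-pair [] u = refl
  coeff-pair ((c , f) ∷ p) u with monoEq f u | monoEq-reflects f u
  ... | true | ofʸ _ = cong₂ _+ᶻ_ (sym (ℤP.*-identityʳ c)) (coeff-pair p u)
  ... | false | ofⁿ _ = trans (coeff-pair p u)
                 (trans (sym (ℤP.+-identityˡ _)) (cong (_+ᶻ ⟨ p ∣ ι u ⟩) (sym (ℤP.*-zeroʳ c))))

  pair-++ : ∀ p q g → ⟨ p ++ q ∣ g ⟩ ≡ ⟨ p ∣ g ⟩ +ᶻ ⟨ q ∣ g ⟩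
  pair-++ [] q g = sym (ℤP.+-identityˡ _)
  pair-++ ((c , f) ∷ p) q g = trans (cong ((c *ᶻ g f) +ᶻ_) (pair-++ p q g)) (sym (ℤP.+-assoc (c *ᶻ g f) _ _))

  pair-neg : ∀ p g → ⟨ -P p ∣ g ⟩ ≡ ℤ.- ⟨ p ∣ g ⟩
  pair-neg [] g = refl
  pair-neg ((c , f) ∷ p) g = trans (cong₂ _+ᶻ_ (sym (ℤP.neg-distribˡ-* c (g f))) (pair-neg p g))
                                   (sym (ℤP.neg-distrib-+ (c *ᶻ g f) _))

  pair-cong : ∀ p {g h} → (∀ f → g f ≡ h f) → ⟨ p ∣ g ⟩ ≡ ⟨ p ∣ h ⟩
  pair-cong [] eq = refl
  pair-cong ((c , f) ∷ p) eq = cong₂ _+ᶻ_ (cong (c *ᶻ_) (eq f)) (pair-cong p eq)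

  pair-zero : ∀ p → ⟨ p ∣ (λ _ → + 0) ⟩ ≡ + 0
  pair-zero [] = refl
  pair-zero ((c , f) ∷ p) = cong₂ _+ᶻ_ (ℤP.*-zeroʳ c) (pair-zero p)

  private
    interchange : ∀ a b c d → (a +ᶻ b) +ᶻ (c +ᶻ d) ≡ (a +ᶻ c) +ᶻ (b +ᶻ d)
    interchange a b c d = trans (ℤP.+-assoc a b _) (trans (cong (a +ᶻ_)
      (trans (sym (ℤP.+-assoc b c d)) (trans (cong (_+ᶻ d) (ℤP.+-comm b c)) (ℤP.+-assoc c b d))))
      (sym (ℤP.+-assoc a c _)))

  pair-+ : ∀ p g h → ⟨ p ∣ (λ f → g f +ᶻ h f) ⟩ ≡ ⟨ p ∣ g ⟩ +ᶻ ⟨ p ∣ h ⟩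
  pair-+ [] g h = refl
  pair-+ ((c , f) ∷ p) g h =
    trans (cong₂ _+ᶻ_ (ℤP.*-distribˡ-+ c (g f) (h f)) (pair-+ p g h))
          (interchange (c *ᶻ g f) _ _ _)

  pair-* : ∀ p a g → ⟨ p ∣ (λ f → a *ᶻ g f) ⟩ ≡ a *ᶻ ⟨ p ∣ g ⟩
  pair-* [] a g = sym (ℤP.*-zeroʳ a)
  pair-* ((c , f) ∷ p) a g = trans (cong₂ _+ᶻ_ (swap c a (g f)) (pair-* p a g))
                                   (sym (ℤP.*-distribˡ-+ a (c *ᶻ g f) _))
    where
    swap : ∀ x y z → x *ᶻ (y *ᶻ z) ≡ y *ᶻ (x *ᶻ z)
    swap x y z = trans (sym (ℤP.*-assoc x y z)) (trans (cong (_*ᶻ z) (ℤP.*-comm x y)) (ℤP.*-assoc y x z))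

  pair-map : ∀ (h : ℤ × Mono m n → ℤ × Mono m n) c (φ : Mono m n → Mono m n) →
             (∀ d f → h (d , f) ≡ (c *ᶻ d , φ f)) →
             ∀ q g → ⟨ map h q ∣ g ⟩ ≡ c *ᶻ ⟨ q ∣ g ∘ φ ⟩
  pair-map h c φ eq [] g = sym (ℤP.*-zeroʳ c)
  pair-map h c φ eq ((d , f) ∷ q) g rewrite eq d f =
    trans (cong₂ _+ᶻ_ (ℤP.*-assoc c d _) (pair-map h c φ eq q g))
          (sym (ℤP.*-distribˡ-+ c (d *ᶻ g (φ f)) _))

  pair-map-++ : ∀ (h : ℤ × Mono m n → ℤ × Mono m n) c (φ : Mono m n → Mono m n) →
                (∀ d f → h (d , f) ≡ (c *ᶻ d , φ f)) →
                ∀ q r g → ⟨ map h q ++ r ∣ g ⟩ ≡ c *ᶻ ⟨ q ∣ g ∘ φ ⟩ +ᶻ ⟨ r ∣ g ⟩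
  pair-map-++ h c φ eq q r g =
    trans (pair-++ (map h q) r g) (cong (_+ᶻ ⟨ r ∣ g ⟩) (pair-map h c φ eq q g))

  pair-*P : ∀ p q g → ⟨ p *P q ∣ g ⟩ ≡ ⟨ p ∣ (λ u → ⟨ q ∣ (λ f → g (monoMul u f)) ⟩) ⟩
  pair-*P [] q g = refl
  pair-*P ((c , u) ∷ p) q g =
    trans (pair-map-++ _ c (monoMul u) (λ _ _ → refl) q (p *P q) g)
          (cong (c *ᶻ ⟨ q ∣ g ∘ monoMul u ⟩ +ᶻ_) (pair-*P p q g))

  -- This interchange of finite sums is the source of commutativity of the product.
  pair-fubini : ∀ p q (h : Mono m n → Mono m n → ℤ) →
                ⟨ p ∣ (λ u → ⟨ q ∣ h u ⟩) ⟩ ≡ ⟨ q ∣ (λ f → ⟨ p ∣ (λ u → h u f) ⟩) ⟩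
  pair-fubini [] q h = sym (pair-zero q)
  pair-fubini ((c , u) ∷ p) q h =
    trans (cong₂ _+ᶻ_ (sym (pair-* q c (h u))) (pair-fubini p q h)) (sym (pair-+ q _ _))

  -- A monomial may occur several times with cancelling coefficients. Deleting all its occurrences
  -- at once isolates its total coefficient and still shortens the list.
  without : Mono m n → Poly m n → Poly m n
  without u [] = []
  without u ((c , f) ∷ p) = if monoEq f u then without u p else (c , f) ∷ without u p

  length-without : ∀ u p → length (without u p) ≤ length p
  length-without u [] = z≤n
  length-without u ((c , f) ∷ p) with monoEq f u | monoEq-reflects f u
  ... | true | ofʸ _ = ℕP.m≤n⇒m≤1+n (length-without u p)
  ... | false | ofⁿ _ = s≤s (length-without u p)

  pair-without : ∀ u p g → ⟨ p ∣ g ⟩ ≡ coeff p u *ᶻ g u +ᶻ ⟨ without u p ∣ g ⟩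
  pair-without u [] g = refl
  pair-without u ((c , f) ∷ p) g with monoEq f u | monoEq-reflects f u
  ... | true | ofʸ refl = trans (cong ((c *ᶻ g f) +ᶻ_) (pair-without u p g))
        (trans (sym (ℤP.+-assoc (c *ᶻ g f) _ _)) (cong (_+ᶻ _) (sym (ℤP.*-distribʳ-+ (g f) c _))))
  ... | false | ofⁿ _ = trans (cong ((c *ᶻ g f) +ᶻ_) (pair-without u p g))
        (trans (sym (ℤP.+-assoc (c *ᶻ g f) _ _))
               (trans (cong (_+ᶻ _) (ℤP.+-comm (c *ᶻ g f) (coeff p u *ᶻ g u)))
                      (ℤP.+-assoc (coeff p u *ᶻ g u) _ _)))

  coeff-without-self : ∀ u p → coeff (without u p) u ≡ + 0
  coeff-without-self u [] = refl
  coeff-without-self u ((c , f) ∷ p) with monoEq f u in eq | monoEq-reflects f u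
  ... | true | ofʸ _ = coeff-without-self u p
  ... | false | ofⁿ f≢u rewrite eq = coeff-without-self u p

  coeff-without-other : ∀ u p {f} → f ≢ u → coeff (without u p) f ≡ coeff p f
  coeff-without-other u [] f≢u = refl
  coeff-without-other u ((c , f') ∷ p) {f} f≢u with monoEq f' u | monoEq-reflects f' u
  ... | true | ofʸ refl with monoEq f' f | monoEq-reflects f' f
  ...   | true | ofʸ refl = contradiction refl f≢u
  ...   | false | ofⁿ _ = coeff-without-other u p f≢u
  coeff-without-other u ((c , f') ∷ p) {f} f≢u | false | ofⁿ _ with monoEq f' f | monoEq-reflects f' f
  ...   | true | ofʸ _ = cong (c +ᶻ_) (coeff-without-other u p f≢u)
  ...   | false | ofⁿ _ = coeff-without-other u p f≢u

  -- Single entries of the list need not contribute zero, only all entries of a monomial together;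
  -- so the induction is on the length and removes the head monomial everywhere.
  pair-vanishes : ∀ p g → (∀ f → coeff p f ≡ + 0 ⊎ g f ≡ + 0) → ⟨ p ∣ g ⟩ ≡ + 0
  pair-vanishes p g = go (length p) p ℕP.≤-refl
    where
    go : ∀ k p → length p ≤ k → (∀ f → coeff p f ≡ + 0 ⊎ g f ≡ + 0) → ⟨ p ∣ g ⟩ ≡ + 0
    go k [] _ _ = refl
    go (suc k) p@((c , u) ∷ p') (s≤s l) z =
      trans (pair-without u p g)
        (cong₂ _+ᶻ_ (head (z u)) (go k (without u p) shorter z'))
      where
      head : coeff p u ≡ + 0 ⊎ g u ≡ + 0 → coeff p u *ᶻ g u ≡ + 0
      head (inj₁ eq) = cong (_*ᶻ g u) eq
      head (inj₂ eq) = trans (cong (coeff p u *ᶻ_) eq) (ℤP.*-zeroʳ (coeff p u))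
      shorter : length (without u p) ≤ k
      shorter with monoEq u u | monoEq-reflects u u
      ... | true | ofʸ _ = ℕP.≤-trans (length-without u p') l
      ... | false | ofⁿ u≢u = contradiction refl u≢u
      z' : ∀ f → coeff (without u p) f ≡ + 0 ⊎ g f ≡ + 0
      z' f with monoEq f u | monoEq-reflects f u
      ... | true | ofʸ refl = inj₁ (coeff-without-self f p)
      ... | false | ofⁿ f≢u with z f
      ...   | inj₁ eq = inj₁ (trans (coeff-without-other u p f≢u) eq)
      ...   | inj₂ eq = inj₂ eq

  coeff-- : ∀ p q u → coeff (p -P q) u ≡ coeff p u ℤ.- coeff q u
  coeff-- p q u rewrite coeff-pair (p -P q) u | coeff-pair p u | coeff-pair q u =
    trans (pair-++ p (-P q) (ι u)) (cong (⟨ p ∣ ι u ⟩ +ᶻ_) (pair-neg q (ι u)))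

  -- A record, so that unification recovers both polynomials from the type; `_≈P_` unfolds to a
  -- statement about `coeff`, from which they cannot be read off.
  record _≋_ (p q : Poly m n) : Set where
    constructor mk
    field coeffwise : p ≈P q
  open _≋_ public

  ≈⇒pair : ∀ {p q : Poly m n} → p ≋ q → ∀ g → ⟨ p ∣ g ⟩ ≡ ⟨ q ∣ g ⟩
  ≈⇒pair {p} {q} p≈q g = ℤP.i-j≡0⇒i≡j _ _
    (trans (sym (trans (pair-++ p (-P q) g) (cong (⟨ p ∣ g ⟩ +ᶻ_) (pair-neg q g))))
           (pair-vanishes (p -P q) g (λ f → inj₁ (trans (coeff-- p q f) (ℤP.i≡j⇒i-j≡0 (coeffwise p≈q f))))))

  pair⇒≈ : ∀ {p q : Poly m n} → (∀ g → ⟨ p ∣ g ⟩ ≡ ⟨ q ∣ g ⟩) → p ≋ q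
  pair⇒≈ {p} {q} eq .coeffwise u = trans (coeff-pair p u) (trans (eq (ι u)) (sym (coeff-pair q u)))

  monoMul-comm : ∀ (u v : Mono m n) → monoMul u v ≡ monoMul v u
  monoMul-comm (mono a b c d) (mono a' b' c' d')
    rewrite VecP.zipWith-comm {f = ℕ._+_} ℕP.+-comm a a' | VecP.zipWith-comm {f = ℕ._+_} ℕP.+-comm b b'
          | ℕP.+-comm c c' | ℕP.+-comm d d' = refl

  monoMul-assoc : ∀ (u v x : Mono m n) → monoMul (monoMul u v) x ≡ monoMul u (monoMul v x)
  monoMul-assoc (mono a b c d) (mono a' b' c' d') (mono a″ b″ c″ d″)
    rewrite VecP.zipWith-assoc {f = ℕ._+_} ℕP.+-assoc a a' a″ | VecP.zipWith-assoc {f = ℕ._+_} ℕP.+-assoc b b' b″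
          | ℕP.+-assoc c c' c″ | ℕP.+-assoc d d' d″ = refl

  monoMul-identityˡ : ∀ (u : Mono m n) → monoMul mono1 u ≡ u
  monoMul-identityˡ (mono a b c d)
    rewrite VecP.zipWith-identityˡ {f = ℕ._+_} ℕP.+-identityˡ a | VecP.zipWith-identityˡ {f = ℕ._+_} ℕP.+-identityˡ b = refl

  *P-cong : ∀ {p p' q q' : Poly m n} → p ≋ p' → q ≋ q' → p *P q ≋ p' *P q'
  *P-cong {p} {p'} {q} {q'} p≈p' q≈q' = pair⇒≈ λ g →
    trans (pair-*P p q g)
    (trans (pair-cong p (λ u → ≈⇒pair q≈q' _))
    (trans (≈⇒pair p≈p' _) (sym (pair-*P p' q' g))))

  *P-comm : ∀ (p q : Poly m n) → p *P q ≋ q *P p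
  *P-comm p q = pair⇒≈ λ g →
    trans (pair-*P p q g) (trans (pair-fubini p q _)
    (trans (pair-cong q (λ f → pair-cong p (λ u → cong g (monoMul-comm u f)))) (sym (pair-*P q p g))))

  *P-assoc : ∀ (p q r : Poly m n) → (p *P q) *P r ≋ p *P (q *P r)
  *P-assoc p q r = pair⇒≈ λ g →
    trans (pair-*P (p *P q) r g) (trans (pair-*P p q _)
    (trans (pair-cong p (λ u → trans
       (pair-cong q (λ v → pair-cong r (λ x → cong g (monoMul-assoc u v x))))
       (sym (pair-*P q r _))))
    (sym (pair-*P p (q *P r) g))))

  *P-identityˡ : ∀ (p : Poly m n) → 1P *P p ≋ p
  *P-identityˡ p = pair⇒≈ λ g →
    trans (pair-*P 1P p g) (trans (ℤP.+-identityʳ _) (trans (ℤP.*-identityˡ _)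
      (pair-cong p (λ f → cong g (monoMul-identityˡ f)))))

  *P-distribʳ : ∀ (p q r : Poly m n) → (q +P r) *P p ≋ q *P p +P r *P p
  *P-distribʳ p q r = pair⇒≈ λ g →
    trans (pair-*P (q +P r) p g) (trans (pair-++ q r _)
    (sym (trans (pair-++ (q *P p) (r *P p) g) (cong₂ _+ᶻ_ (pair-*P q p g) (pair-*P r p g)))))

  +P-cong : ∀ {p p' q q' : Poly m n} → p ≋ p' → q ≋ q' → p +P q ≋ p' +P q'
  +P-cong {p} {p'} {q} {q'} p≈p' q≈q' = pair⇒≈ λ g →
    trans (pair-++ p q g) (trans (cong₂ _+ᶻ_ (≈⇒pair p≈p' g) (≈⇒pair q≈q' g)) (sym (pair-++ p' q' g)))

  +P-assoc : ∀ (p q r : Poly m n) → (p +P q) +P r ≋ p +P (q +P r)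
  +P-assoc p q r = pair⇒≈ λ g →
    trans (pair-++ (p +P q) r g) (trans (cong (_+ᶻ _) (pair-++ p q g)) (trans (ℤP.+-assoc ⟨ p ∣ g ⟩ _ _)
      (sym (trans (pair-++ p (q +P r) g) (cong (⟨ p ∣ g ⟩ +ᶻ_) (pair-++ q r g))))))

  +P-comm : ∀ (p q : Poly m n) → p +P q ≋ q +P p
  +P-comm p q = pair⇒≈ λ g →
    trans (pair-++ p q g) (trans (ℤP.+-comm ⟨ p ∣ g ⟩ _) (sym (pair-++ q p g)))

  -P-inverseʳ : ∀ (p : Poly m n) → p +P (-P p) ≋ []
  -P-inverseʳ p = pair⇒≈ λ g →
    trans (pair-++ p (-P p) g) (trans (cong (⟨ p ∣ g ⟩ +ᶻ_) (pair-neg p g)) (ℤP.+-inverseʳ ⟨ p ∣ g ⟩))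

  -P-cong : ∀ {p q : Poly m n} → p ≋ q → -P p ≋ -P q
  -P-cong {p} {q} p≈q = pair⇒≈ λ g →
    trans (pair-neg p g) (trans (cong ℤ.-_ (≈⇒pair p≈q g)) (sym (pair-neg q g)))

  ≋-trans : ∀ {p q r : Poly m n} → p ≋ q → q ≋ r → p ≋ r
  ≋-trans pq qr .coeffwise u = trans (coeffwise pq u) (coeffwise qr u)

  polyRing : CommutativeRing 0ℓ 0ℓ
  polyRing = record
    { Carrier = Poly m n ; _≈_ = _≋_ ; _+_ = _+P_ ; _*_ = _*P_ ; -_ = -P_ ; 0# = [] ; 1# = 1P
    ; isCommutativeRing = record
      { isRing = record
        { +-isAbelianGroup = record
          { isGroup = record
            { isMonoid = record
              { isSemigroup = record
                { isMagma = record
                  { isEquivalence = record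
                    { refl = mk λ _ → refl
                    ; sym = λ pq → mk λ u → sym (coeffwise pq u)
                    ; trans = ≋-trans }
                  ; ∙-cong = +P-cong }
                ; assoc = +P-assoc }
              ; identity = (λ _ → mk λ _ → refl) , λ p → ≋-trans (+P-comm p []) (mk λ _ → refl) }
            ; inverse = (λ p → ≋-trans (+P-comm (-P p) p) (-P-inverseʳ p)) , -P-inverseʳ
            ; ⁻¹-cong = -P-cong }
          ; comm = +P-comm }
        ; *-cong = *P-cong
        ; *-assoc = *P-assoc
        ; *-identity = *P-identityˡ , λ p → ≋-trans (*P-comm p 1P) (*P-identityˡ p)
        ; distrib = (λ p q r → ≋-trans
                        (*P-comm p (q +P r))
                        (≋-trans (*P-distribʳ p q r)
                          (+P-cong (*P-comm q p) (*P-comm r p))))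
                  , *P-distribʳ }
      ; *-comm = *P-comm } }

  zipWith-cancel : ∀ {k} (xs ys zs : Vec ℕ k) →
                   Vec.zipWith ℕ._+_ xs ys ≡ Vec.zipWith ℕ._+_ xs zs → ys ≡ zs
  zipWith-cancel Vec.[] Vec.[] Vec.[] _ = refl
  zipWith-cancel (x Vec.∷ xs) (y Vec.∷ ys) (z Vec.∷ zs) eq =
    cong₂ Vec._∷_ (ℕP.+-cancelˡ-≡ x y z (VecP.∷-injectiveˡ eq)) (zipWith-cancel xs ys zs (VecP.∷-injectiveʳ eq))

  monoMul-cancelˡ : ∀ (u f g : Mono m n) → monoMul u f ≡ monoMul u g → f ≡ g
  monoMul-cancelˡ (mono a b c d) (mono a₁ b₁ c₁ d₁) (mono a₂ b₂ c₂ d₂) eq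
    with refl ← zipWith-cancel a a₁ a₂ (cong ex eq) | refl ← zipWith-cancel b b₁ b₂ (cong ey eq)
       | refl ← ℕP.+-cancelˡ-≡ c c₁ c₂ (cong eA eq) | refl ← ℕP.+-cancelˡ-≡ d d₁ d₂ (cong eB eq) = refl

  -- If v has degree 1 and the other monomials of a polynomial L have degree 0, then multiplication
  -- by L shifts the top-degree part of p injectively, so L is not a zero divisor.
  module _ (deg : Mono m n → ℕ) (deg-mul : ∀ u f → deg (monoMul u f) ≡ deg u ℕ.+ deg f)
           (v : Mono m n) (deg-v : deg v ≡ 1)
           (rest : Poly m n) (deg-rest : All (λ t → deg (proj₂ t) ≡ 0) rest) where

    private
      degBound : Poly m n → ℕ
      degBound [] = 0
      degBound ((_ , f) ∷ p) = deg f ℕ.+ degBound p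

      coeff-above : ∀ p u → degBound p < deg u → coeff p u ≡ + 0
      coeff-above [] u _ = refl
      coeff-above ((c , f) ∷ p) u lt with monoEq f u | monoEq-reflects f u
      ... | true | ofʸ refl = contradiction lt (ℕP.≤⇒≯ (ℕP.m≤m+n (deg f) (degBound p)))
      ... | false | _ = coeff-above p u (ℕP.≤-<-trans (ℕP.m≤n+m (degBound p) (deg f)) lt)

      pair-vanishes-on : ∀ {q : Poly m n} → All (λ t → deg (proj₂ t) ≡ 0) q → ∀ g →
                         (∀ u → deg u ≡ 0 → g u ≡ + 0) → ⟨ q ∣ g ⟩ ≡ + 0
      pair-vanishes-on [] g z = refl
      pair-vanishes-on {(c , u) ∷ q} (d ∷ ds) g z =
        cong₂ _+ᶻ_ (trans (cong (c *ᶻ_) (z u d)) (ℤP.*-zeroʳ c)) (pair-vanishes-on ds g z)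

    zero-divisor-free : ∀ p → ((+ 1 , v) ∷ rest) *P p ≋ [] → p ≋ []
    zero-divisor-free p Lp≋0 = mk λ u → descend (suc (degBound p)) u (ℕP.m≤n+m _ (deg u))
      where
      -- Descending induction on the degree of u. The coefficient of v u in the product is that of u
      -- in p, plus terms from monomials of p of degree one more than u, which vanish by induction.
      descend : ∀ k u → degBound p < deg u ℕ.+ k → coeff p u ≡ + 0
      descend zero u lt = coeff-above p u (subst (degBound p <_) (ℕP.+-identityʳ _) lt)
      descend (suc k) u lt = begin
          coeff p u                                                    ≡⟨ coeff-pair p u ⟩
          ⟨ p ∣ ι u ⟩                                                  ≡⟨ pair-cong p (λ f → ι-shift f) ⟩
          ⟨ p ∣ (λ f → ι vu (monoMul v f)) ⟩                           ≡⟨ sym (ℤP.*-identityˡ _) ⟩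
          + 1 *ᶻ ⟨ p ∣ (λ f → ι vu (monoMul v f)) ⟩                    ≡⟨ sym (ℤP.+-identityʳ _) ⟩
          + 1 *ᶻ ⟨ p ∣ (λ f → ι vu (monoMul v f)) ⟩ +ᶻ + 0             ≡⟨ cong (+ 1 *ᶻ ⟨ p ∣ (λ f → ι vu (monoMul v f)) ⟩ +ᶻ_) (sym (pair-vanishes-on deg-rest _ lower)) ⟩
          ⟨ (+ 1 , v) ∷ rest ∣ (λ x → ⟨ p ∣ (λ f → ι vu (monoMul x f)) ⟩) ⟩ ≡⟨ sym (pair-*P ((+ 1 , v) ∷ rest) p (ι vu)) ⟩
          ⟨ ((+ 1 , v) ∷ rest) *P p ∣ ι vu ⟩                           ≡⟨ ≈⇒pair Lp≋0 (ι vu) ⟩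
          + 0 ∎
        where
        open ≡-Reasoning
        vu : Mono m n
        vu = monoMul v u
        ι-shift : ∀ f → ι u f ≡ ι vu (monoMul v f)
        ι-shift f with monoEq f u | monoEq-reflects f u
        ... | true | ofʸ refl = sym (ι-self vu)
        ... | false | ofⁿ f≢u = sym (ι-other (λ eq → f≢u (monoMul-cancelˡ v f u eq)))
        lower : ∀ x → deg x ≡ 0 → ⟨ p ∣ (λ f → ι vu (monoMul x f)) ⟩ ≡ + 0
        lower x dx = pair-vanishes p _ λ f → case f
          where
          degree : ∀ f → monoMul x f ≡ vu → deg f ≡ suc (deg u)
          degree f eq = trans (cong (ℕ._+ deg f) (sym dx)) (trans (sym (deg-mul x f))
                        (trans (cong deg eq) (trans (deg-mul v u) (cong (ℕ._+ deg u) deg-v))))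
          case : ∀ f → coeff p f ≡ + 0 ⊎ ι vu (monoMul x f) ≡ + 0
          case f with monoEq (monoMul x f) vu | monoEq-reflects (monoMul x f) vu
          ... | false | _ = inj₂ refl
          ... | true | ofʸ eq = inj₁ (descend k f
                (subst (degBound p <_) (trans (ℕP.+-suc (deg u) k) (cong (ℕ._+ k) (sym (degree f eq)))) lt))

  open import Algebra.Properties.Ring (CommutativeRing.ring polyRing) using (-‿distribʳ-*)
  open import Algebra.Properties.Group (CommutativeRing.+-group polyRing) using (x∙y⁻¹≈ε⇒x≈y; x≈y⇒x∙y⁻¹≈ε)

  cancelˡ : ∀ (L : Poly m n) → (∀ p → L *P p ≋ [] → p ≋ []) → ∀ p q → L *P p ≋ L *P q → p ≋ q
  cancelˡ L nzd p q eq = x∙y⁻¹≈ε⇒x≈y p q (nzd (p -P q)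
    (≋-trans (CommutativeRing.distribˡ polyRing L p (-P q))
    (≋-trans (+P-cong (CommutativeRing.refl polyRing) (CommutativeRing.sym polyRing (-‿distribʳ-* L q)))
             (x≈y⇒x∙y⁻¹≈ε eq))))

  δˣ : Fin m → Mono m n
  δˣ i = mono (Vec.updateAt (Vec.replicate m 0) i (λ _ → 1)) (Vec.replicate n 0) 0 0

  -- Graded by the exponent of x_i, in which x_j has degree 0.
  X-X-cancel : ∀ (i j : Fin m) → i ≢ j → ∀ p q → (X i -P X j) *P p ≋ (X i -P X j) *P q → p ≋ q
  X-X-cancel i j i≢j = cancelˡ (X i -P X j) (zero-divisor-free (λ u → Vec.lookup (ex u) i)
    (λ u f → VecP.lookup-zipWith ℕ._+_ i (ex u) (ex f))
    (δˣ i) (VecP.lookup∘updateAt i (Vec.replicate m 0))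
    (-P X j) ((trans (VecP.lookup∘updateAt′ i j i≢j (Vec.replicate m 0)) (VecP.lookup-replicate i 0)) ∷ []))

  -- Graded by the exponent of A, so i and j may coincide.
  A+B+X-X-cancel : ∀ (i j : Fin m) p q →
    (A +P B +P (X i -P X j)) *P p ≋ (A +P B +P (X i -P X j)) *P q → p ≋ q
  A+B+X-X-cancel i j = cancelˡ (A +P B +P (X i -P X j)) (zero-divisor-free eA (λ _ _ → refl)
    (mono (Vec.replicate m 0) (Vec.replicate n 0) 1 0) refl (B +P (X i -P X j)) (refl ∷ refl ∷ refl ∷ []))

-- Exchanging two variables

transpose-matchˡ : ∀ {k} (i j : Fin k) → transpose i j i ≡ j
transpose-matchˡ i j with i FinP.≟ i
... | yes _ = refl
... | no i≢i = contradiction refl i≢i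

transpose-matchʳ : ∀ {k} (i j : Fin k) → transpose i j j ≡ i
transpose-matchʳ i j with j FinP.≟ i
... | yes j≡i = j≡i
... | no _ with j FinP.≟ j
...   | yes _ = refl
...   | no j≢j = contradiction refl j≢j

transpose-mismatch : ∀ {k} (i j : Fin k) {l} → l ≢ i → l ≢ j → transpose i j l ≡ l
transpose-mismatch i j {l} l≢i l≢j with l FinP.≟ i
... | yes l≡i = contradiction l≡i l≢i
... | no _ with l FinP.≟ j
...   | yes l≡j = contradiction l≡j l≢j
...   | no _ = refl

transpose-involutive : ∀ {k} (i j l : Fin k) → transpose i j (transpose i j l) ≡ l
transpose-involutive i j l with l FinP.≟ i
... | yes refl = transpose-matchʳ i j
... | no l≢i with l FinP.≟ j
...   | yes refl = transpose-matchˡ i j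
...   | no l≢j = transpose-mismatch i j l≢i l≢j

module SwapVariables {m n : ℕ} (i j : Fin m) where
  open PolynomialRing {m} {n}

  swapM : Mono m n → Mono m n
  swapM (mono a b c d) = mono (Vec.tabulate (λ k → Vec.lookup a (transpose i j k))) b c d

  -- Moving the substitution over to the functional reduces each homomorphism law of `swapX` to the
  -- matching law of the pairing.
  pair-swapX : ∀ p g → ⟨ swapX i j p ∣ g ⟩ ≡ ⟨ p ∣ (λ u → g (swapM u)) ⟩
  pair-swapX p g = trans (pair-map _ (+ 1) swapM (λ d f → cong (_, swapM f) (sym (ℤP.*-identityˡ d))) p g)
                         (ℤP.*-identityˡ _)

  swapM-mul : ∀ u f → swapM (monoMul u f) ≡ monoMul (swapM u) (swapM f)
  swapM-mul u@(mono a b c d) f@(mono a' b' c' d') = cong (λ x → mono x (Vec.zipWith ℕ._+_ b b') (c ℕ.+ c') (d ℕ.+ d'))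
    (trans (VecP.tabulate-cong pointwise) (VecP.tabulate∘lookup (Vec.zipWith ℕ._+_ (ex (swapM u)) (ex (swapM f)))))
    where
    pointwise : ∀ k → Vec.lookup (Vec.zipWith ℕ._+_ a a') (transpose i j k)
                    ≡ Vec.lookup (Vec.zipWith ℕ._+_ (ex (swapM u)) (ex (swapM f))) k
    pointwise k = trans (VecP.lookup-zipWith ℕ._+_ (transpose i j k) a a')
      (sym (trans (VecP.lookup-zipWith ℕ._+_ k (ex (swapM u)) (ex (swapM f)))
                  (cong₂ ℕ._+_ (VecP.lookup∘tabulate _ k) (VecP.lookup∘tabulate _ k))))

  swapX-cong : ∀ {p q} → p ≋ q → swapX i j p ≋ swapX i j q
  swapX-cong {p} {q} p≋q = pair⇒≈ λ g → trans (pair-swapX p g) (trans (≈⇒pair p≋q _) (sym (pair-swapX q g)))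

  swapX-+ : ∀ p q → swapX i j (p +P q) ≋ swapX i j p +P swapX i j q
  swapX-+ p q = pair⇒≈ λ g → trans (pair-swapX (p +P q) g) (trans (pair-++ p q _)
    (sym (trans (pair-++ (swapX i j p) (swapX i j q) g) (cong₂ _+ᶻ_ (pair-swapX p g) (pair-swapX q g)))))

  swapX-neg : ∀ p → swapX i j (-P p) ≋ -P swapX i j p
  swapX-neg p = pair⇒≈ λ g → trans (pair-swapX (-P p) g) (trans (pair-neg p _)
    (sym (trans (pair-neg (swapX i j p) g) (cong ℤ.-_ (pair-swapX p g)))))

  swapX-* : ∀ p q → swapX i j (p *P q) ≋ swapX i j p *P swapX i j q
  swapX-* p q = pair⇒≈ λ g → trans (pair-swapX (p *P q) g) (trans (pair-*P p q _)
    (sym (trans (pair-*P (swapX i j p) (swapX i j q) g) (trans (pair-swapX p _)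
      (pair-cong p λ u → trans (pair-swapX q _) (pair-cong q λ f → cong g (sym (swapM-mul u f))))))))

  private
    swap-zero : Vec.tabulate (λ k → Vec.lookup (Vec.replicate m 0) (transpose i j k)) ≡ Vec.replicate m 0
    swap-zero = trans (VecP.tabulate-cong (λ k → trans (VecP.lookup-replicate (transpose i j k) 0)
                        (sym (VecP.lookup-replicate k 0)))) (VecP.tabulate∘lookup _)

  swapX-1 : swapX i j 1P ≡ 1P
  swapX-1 = cong (λ x → (+ 1 , mono x (Vec.replicate n 0) 0 0) ∷ []) swap-zero

  swapX-A : swapX i j A ≡ A
  swapX-A = cong (λ x → (+ 1 , mono x (Vec.replicate n 0) 1 0) ∷ []) swap-zero

  swapX-B : swapX i j B ≡ B
  swapX-B = cong (λ x → (+ 1 , mono x (Vec.replicate n 0) 0 1) ∷ []) swap-zero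

  swapX-Y : ∀ k → swapX i j (Y k) ≡ Y k
  swapX-Y k = cong (λ x → (+ 1 , mono x (Vec.updateAt (Vec.replicate n 0) k (λ _ → 1)) 0 0) ∷ []) swap-zero

  swapX-X : ∀ k → swapX i j (X k) ≡ X (transpose i j k)
  swapX-X k = cong (λ x → (+ 1 , mono x (Vec.replicate n 0) 0 0) ∷ [])
    (trans (VecP.tabulate-cong moved) (VecP.tabulate∘lookup _))
    where
    δ : Fin m → Vec ℕ m
    δ l = Vec.updateAt (Vec.replicate m 0) l (λ _ → 1)
    moved : ∀ l → Vec.lookup (δ k) (transpose i j l) ≡ Vec.lookup (δ (transpose i j k)) l
    moved l with transpose i j l FinP.≟ k
    ... | yes refl = trans (VecP.lookup∘updateAt k (Vec.replicate m 0))
                       (sym (subst (λ t → Vec.lookup (δ t) l ≡ 1) (sym (transpose-involutive i j l))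
                              (VecP.lookup∘updateAt l (Vec.replicate m 0))))
    ... | no tl≢k = trans (trans (VecP.lookup∘updateAt′ _ k tl≢k (Vec.replicate m 0)) (VecP.lookup-replicate (transpose i j l) 0))
                      (sym (trans (VecP.lookup∘updateAt′ l (transpose i j k) l≢tk (Vec.replicate m 0)) (VecP.lookup-replicate l 0)))
      where
      l≢tk : l ≢ transpose i j k
      l≢tk refl = tl≢k (transpose-involutive i j k)

-- Transfer operators and the Yang-Baxter equation

-- Numbering β ps L: L lists the rows of type β together with the pipes entering there, when the pipes
-- ps are attached counterclockwise from the northwest corner.
data Numbering {P : Set} : List RowType → List P → List (RowType × P) → Set where
  []  : Numbering [] [] []
  w∷_ : ∀ {β ps L p} → Numbering β ps L → Numbering (w ∷ β) (p ∷ ps) ((w , p) ∷ L)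
  e∷_ : ∀ {β ps L p} → Numbering β ps L → Numbering (e ∷ β) (ps ++ p ∷ []) ((e , p) ∷ L)

module Transfer {ℓ₁ ℓ₂} (R : CommutativeRing ℓ₁ ℓ₂) (𝐀 𝐁 : CommutativeRing.Carrier R) (C : Set) where

  open CommutativeRing R renaming (refl to ≈-refl; sym to ≈-sym; trans to ≈-trans) hiding (zero)
  open import Relation.Binary.Reasoning.Setoid setoid
  open import Algebra.Solver.Ring.NaturalCoefficients.Default commutativeSemiring
    using (solve; _:=_; _:+_; _:*_)
  open import Algebra.Properties.CommutativeSemigroup +-commutativeSemigroup using () renaming (interchange to +-interchange)
  open import Algebra.Properties.CommutativeSemigroup *-commutativeSemigroup using () renaming (x∙yz≈y∙xz to *-leftSwap)
  open import Algebra.Properties.Group +-group using () renaming (∙-cancelˡ to +-cancelˡ)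

  Edge : Set
  Edge = Maybe C

  -- Operators act on continuations: the value of a vertex with incoming colours h and v is the
  -- weighted sum of k over its outgoing colours. In this form the Yang-Baxter equation is
  -- a semiring identity between finitely many values of k.
  vertex : (u b c : Carrier) → Edge → Edge → (Edge → Edge → Carrier) → Carrier
  vertex u b c nothing nothing k = b * k nothing nothing
  vertex u b c (just p) v k = u * k (just p) v + c * k v (just p)
  vertex u b c nothing (just q) k = u * k nothing (just q) + c * k (just q) nothing

  -- Continuations are compared pointwise up to ring equality, so `resp` stands in for function
  -- extensionality when rewriting under an operator.
  record Linear {I J : Set} (Φ : (I → J → Carrier) → Carrier) : Set (ℓ₁ ⊔ ℓ₂) where
    field
      resp  : ∀ {k k'} → (∀ s t → k s t ≈ k' s t) → Φ k ≈ Φ k'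
      add   : ∀ k k' → Φ (λ s t → k s t + k' s t) ≈ Φ k + Φ k'
      scale : ∀ a k → Φ (λ s t → a * k s t) ≈ a * Φ k
  open Linear

  private
    lin-+ : ∀ u c x x' y y' → u * (x + x') + c * (y + y') ≈ (u * x + c * y) + (u * x' + c * y')
    lin-+ u c x x' y y' = ≈-trans (+-cong (distribˡ u x x') (distribˡ c y y')) (+-interchange _ _ _ _)

    lin-* : ∀ a u c x y → u * (a * x) + c * (a * y) ≈ a * (u * x + c * y)
    lin-* a u c x y = ≈-trans (+-cong (*-leftSwap u a x) (*-leftSwap c a y)) (≈-sym (distribˡ a _ _))

  vertex-linear : ∀ u b c h v → Linear (vertex u b c h v)
  vertex-linear u b c nothing nothing = record
    { resp = λ eq → *-congˡ (eq _ _) ; add = λ k k' → distribˡ b _ _ ; scale = λ a k → *-leftSwap b a _ }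
  vertex-linear u b c (just p) v = record
    { resp = λ eq → +-cong (*-congˡ (eq _ _)) (*-congˡ (eq _ _))
    ; add = λ k k' → lin-+ u c _ _ _ _ ; scale = λ a k → lin-* a u c _ _ }
  vertex-linear u b c nothing (just q) = record
    { resp = λ eq → +-cong (*-congˡ (eq _ _)) (*-congˡ (eq _ _))
    ; add = λ k k' → lin-+ u c _ _ _ _ ; scale = λ a k → lin-* a u c _ _ }

  vertex-cong : ∀ {u b c} h v {k k'} → (∀ s t → k s t ≈ k' s t) → vertex u b c h v k ≈ vertex u b c h v k'
  vertex-cong h v = resp (vertex-linear _ _ _ h v)

  vertex-cong-weights : ∀ {u u' b b' c c'} → u ≈ u' → b ≈ b' → c ≈ c' → ∀ h v k →
                        vertex u b c h v k ≈ vertex u' b' c' h v k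
  vertex-cong-weights eu eb ec nothing nothing k = *-congʳ eb
  vertex-cong-weights eu eb ec (just p) v k = +-cong (*-congʳ eu) (*-congʳ ec)
  vertex-cong-weights eu eb ec nothing (just q) k = +-cong (*-congʳ eu) (*-congʳ ec)

  -- The weights are symmetric under reflection in the diagonal. This turns a tile of a w row into
  -- the orientation that the Yang-Baxter equation needs next to an e row.
  vertex-flip : ∀ u b c h v k → vertex u b c h v k ≈ vertex u b c v h (λ s t → k t s)
  vertex-flip u b c nothing nothing k = ≈-refl
  vertex-flip u b c nothing (just q) k = ≈-refl
  vertex-flip u b c (just p) nothing k = ≈-refl
  vertex-flip u b c (just p) (just q) k = ≈-refl

  -- A vertex is a finite weighted sum, so a linear operator on other edges passes through it. Rows
  -- are regrouped into columns by this.
  vertex-commute : ∀ {I J : Set} {Φ : (I → J → Carrier) → Carrier} → Linear Φ → ∀ u b c h v (k : I → J → Edge → Edge → Carrier) →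
    Φ (λ s t → vertex u b c h v (k s t)) ≈ vertex u b c h v (λ h' v' → Φ (λ s t → k s t h' v'))
  vertex-commute Φ u b c nothing nothing k = scale Φ b _
  vertex-commute Φ u b c (just p) v k = ≈-trans (add Φ _ _) (+-cong (scale Φ u _) (scale Φ c _))
  vertex-commute Φ u b c nothing (just q) k = ≈-trans (add Φ _ _) (+-cong (scale Φ u _) (scale Φ c _))

  module _ (s t b : Carrier) where
    private
      c = s + t + b
      V₁₂ V₁₃ V₂₃ : Edge → Edge → (Edge → Edge → Carrier) → Carrier
      V₁₂ = vertex s (t + b) c
      V₁₃ = vertex (s + t) b c
      V₂₃ = vertex t (s + b) c

      distinct : ∀ f₁₂₃ f₁₃₂ f₂₁₃ f₂₃₁ f₃₁₂ f₃₂₁ →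
        s * ((s + t) * (t * f₁₂₃ + c * f₁₃₂) + c * (t * f₃₂₁ + c * f₃₁₂))
          + c * ((s + t) * (t * f₂₁₃ + c * f₂₃₁) + c * (t * f₃₁₂ + c * f₃₂₁))
        ≈ t * ((s + t) * (s * f₁₂₃ + c * f₂₁₃) + c * (s * f₃₂₁ + c * f₂₃₁))
          + c * ((s + t) * (s * f₁₃₂ + c * f₃₁₂) + c * (s * f₂₃₁ + c * f₃₂₁))
      distinct = solve 9 (λ s t b f₁₂₃ f₁₃₂ f₂₁₃ f₂₃₁ f₃₁₂ f₃₂₁ → let c = s :+ t :+ b in
        s :* ((s :+ t) :* (t :* f₁₂₃ :+ c :* f₁₃₂) :+ c :* (t :* f₃₂₁ :+ c :* f₃₁₂))
          :+ c :* ((s :+ t) :* (t :* f₂₁₃ :+ c :* f₂₃₁) :+ c :* (t :* f₃₁₂ :+ c :* f₃₂₁))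
        := t :* ((s :+ t) :* (s :* f₁₂₃ :+ c :* f₂₁₃) :+ c :* (s :* f₃₂₁ :+ c :* f₂₃₁))
          :+ c :* ((s :+ t) :* (s :* f₁₃₂ :+ c :* f₃₁₂) :+ c :* (s :* f₂₃₁ :+ c :* f₃₂₁)))
        ≈-refl s t b

      single₁ : ∀ f₁ f₂ f₃ →
        s * ((s + t) * ((s + b) * f₁) + c * (t * f₃ + c * f₂)) + c * (b * (t * f₂ + c * f₃))
        ≈ (s + b) * ((s + t) * (s * f₁ + c * f₂) + c * ((t + b) * f₃))
      single₁ = solve 6 (λ s t b f₁ f₂ f₃ → let c = s :+ t :+ b in
        s :* ((s :+ t) :* ((s :+ b) :* f₁) :+ c :* (t :* f₃ :+ c :* f₂)) :+ c :* (b :* (t :* f₂ :+ c :* f₃))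
        := (s :+ b) :* ((s :+ t) :* (s :* f₁ :+ c :* f₂) :+ c :* ((t :+ b) :* f₃))) ≈-refl s t b

      single₂ : ∀ f₁ f₂ f₃ →
        s * (b * (t * f₂ + c * f₃)) + c * ((s + t) * ((s + b) * f₁) + c * (t * f₃ + c * f₂))
        ≈ t * (b * (s * f₂ + c * f₁)) + c * ((s + t) * ((t + b) * f₃) + c * (s * f₁ + c * f₂))
      single₂ = solve 6 (λ s t b f₁ f₂ f₃ → let c = s :+ t :+ b in
        s :* (b :* (t :* f₂ :+ c :* f₃)) :+ c :* ((s :+ t) :* ((s :+ b) :* f₁) :+ c :* (t :* f₃ :+ c :* f₂))
        := t :* (b :* (s :* f₂ :+ c :* f₁)) :+ c :* ((s :+ t) :* ((t :+ b) :* f₃) :+ c :* (s :* f₁ :+ c :* f₂)))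
        ≈-refl s t b

      single₃ : ∀ f₁ f₂ f₃ →
        (t + b) * ((s + t) * (t * f₃ + c * f₂) + c * ((s + b) * f₁))
        ≈ t * ((s + t) * ((t + b) * f₃) + c * (s * f₁ + c * f₂)) + c * (b * (s * f₂ + c * f₁))
      single₃ = solve 6 (λ s t b f₁ f₂ f₃ → let c = s :+ t :+ b in
        (t :+ b) :* ((s :+ t) :* (t :* f₃ :+ c :* f₂) :+ c :* ((s :+ b) :* f₁))
        := t :* ((s :+ t) :* ((t :+ b) :* f₃) :+ c :* (s :* f₁ :+ c :* f₂)) :+ c :* (b :* (s :* f₂ :+ c :* f₁)))
        ≈-refl s t b

      empty : ∀ f → (t + b) * (b * ((s + b) * f)) ≈ (s + b) * (b * ((t + b) * f))
      empty = solve 4 (λ s t b f → (t :+ b) :* (b :* ((s :+ b) :* f)) := (s :+ b) :* (b :* ((t :+ b) :* f))) ≈-refl s t b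

    -- Expressing everything by s, t and the blank weight b of the middle vertex removes all
    -- subtractions, so both sides can be expanded in a semiring. The blank weight enters only when
    -- two empty edges meet; hence a single empty edge behaves like a further colour and shares the
    -- identity `distinct`, and only two or three empty edges need identities of their own.
    yangBaxter-additive : ∀ x₁ x₂ x₃ (k : Edge → Edge → Edge → Carrier) →
      V₁₂ x₁ x₂ (λ x₁ x₂ → V₁₃ x₁ x₃ (λ x₁ x₃ → V₂₃ x₂ x₃ (λ x₂ x₃ → k x₁ x₂ x₃)))
      ≈ V₂₃ x₂ x₃ (λ x₂ x₃ → V₁₃ x₁ x₃ (λ x₁ x₃ → V₁₂ x₁ x₂ (λ x₁ x₂ → k x₁ x₂ x₃)))
    yangBaxter-additive (just _) (just _) (just _) k = distinct _ _ _ _ _ _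
    yangBaxter-additive nothing (just _) (just _) k = distinct _ _ _ _ _ _
    yangBaxter-additive (just _) nothing (just _) k = distinct _ _ _ _ _ _
    yangBaxter-additive (just _) (just _) nothing k = distinct _ _ _ _ _ _
    yangBaxter-additive (just _) nothing nothing k = single₁ _ _ _
    yangBaxter-additive nothing (just _) nothing k = single₂ _ _ _
    yangBaxter-additive nothing nothing (just _) k = single₃ _ _ _
    yangBaxter-additive nothing nothing nothing k = empty _

  𝐂 : Carrier
  𝐂 = 𝐀 + 𝐁

  straight : RowType → Carrier → Carrier → Carrier
  straight w x y = 𝐀 + x - y
  straight e x y = 𝐁 - x + y

  empty-weight : RowType → Carrier → Carrier → Carrier
  empty-weight w x y = 𝐁 - x + y
  empty-weight e x y = 𝐀 + x - y

  tile : RowType → Carrier → Carrier → Edge → Edge → (Edge → Edge → Carrier) → Carrier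
  tile r x y = vertex (straight r x y) (empty-weight r x y) 𝐂

  private
    cancel-inner : ∀ p q z → (p + z) + (q - z) ≈ p + q
    cancel-inner p q z = begin
      (p + z) + (q - z)      ≈⟨ +-congˡ (+-comm q (- z)) ⟩
      (p + z) + (- z + q)    ≈⟨ +-assoc p z _ ⟩
      p + (z + (- z + q))    ≈⟨ +-congˡ (≈-sym (+-assoc z (- z) q)) ⟩
      p + (z - z + q)        ≈⟨ +-congˡ (≈-trans (+-congʳ (-‿inverseʳ z)) (+-identityˡ q)) ⟩
      p + q ∎

    -- The column variable y cancels, so this sum can be the straight weight of a crossing that
    -- meets every column in turn.
    w+e : ∀ x x' y → (𝐀 + x - y) + (𝐁 - x' + y) ≈ 𝐂 + (x - x')
    w+e x x' y = begin
      (𝐀 + x - y) + (𝐁 - x' + y)   ≈⟨ +-comm _ _ ⟩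
      (𝐁 - x' + y) + (𝐀 + x - y)   ≈⟨ cancel-inner (𝐁 - x') (𝐀 + x) y ⟩
      (𝐁 - x') + (𝐀 + x)           ≈⟨ +-comm _ _ ⟩
      (𝐀 + x) + (𝐁 - x')           ≈⟨ +-interchange 𝐀 x 𝐁 (- x') ⟩
      𝐂 + (x - x') ∎

    w+e-same : ∀ x y → (𝐀 + x - y) + (𝐁 - x + y) ≈ 𝐂
    w+e-same x y = ≈-trans (w+e x x y) (≈-trans (+-congˡ (-‿inverseʳ x)) (+-identityʳ 𝐂))

  straight+empty : ∀ r x y → straight r x y + empty-weight r x y ≈ 𝐂
  straight+empty w x y = w+e-same x y
  straight+empty e x y = ≈-trans (+-comm _ _) (w+e-same x y)

  yangBaxter : ∀ {u₁₂ b₁₂ u₁₃ b₁₃ u₂₃ b₂₃} → u₁₃ ≈ u₁₂ + u₂₃ →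
    u₁₂ + b₁₂ ≈ 𝐂 → u₁₃ + b₁₃ ≈ 𝐂 → u₂₃ + b₂₃ ≈ 𝐂 →
    ∀ x₁ x₂ x₃ (k : Edge → Edge → Edge → Carrier) →
    vertex u₁₂ b₁₂ 𝐂 x₁ x₂ (λ x₁ x₂ → vertex u₁₃ b₁₃ 𝐂 x₁ x₃ (λ x₁ x₃ → vertex u₂₃ b₂₃ 𝐂 x₂ x₃ (λ x₂ x₃ → k x₁ x₂ x₃)))
    ≈ vertex u₂₃ b₂₃ 𝐂 x₂ x₃ (λ x₂ x₃ → vertex u₁₃ b₁₃ 𝐂 x₁ x₃ (λ x₁ x₃ → vertex u₁₂ b₁₂ 𝐂 x₁ x₂ (λ x₁ x₂ → k x₁ x₂ x₃)))
  yangBaxter {s} {b₁₂} {u₁₃} {b} {t} {b₂₃} additive c₁₂ c₁₃ c₂₃ x₁ x₂ x₃ k = begin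
    _ ≈⟨ w₁₂ x₁ x₂ _ ⟩
    _ ≈⟨ vertex-cong x₁ x₂ (λ x₁ x₂ → w₁₃ x₁ x₃ _) ⟩
    _ ≈⟨ vertex-cong x₁ x₂ (λ x₁ x₂ → vertex-cong x₁ x₃ (λ x₁ x₃ → w₂₃ x₂ x₃ _)) ⟩
    _ ≈⟨ yangBaxter-additive s t b x₁ x₂ x₃ k ⟩
    _ ≈⟨ vertex-cong x₂ x₃ (λ x₂ x₃ → vertex-cong x₁ x₃ (λ x₁ x₃ → ≈-sym (w₁₂ x₁ x₂ _))) ⟩
    _ ≈⟨ vertex-cong x₂ x₃ (λ x₂ x₃ → ≈-sym (w₁₃ x₁ x₃ _)) ⟩
    _ ≈⟨ ≈-sym (w₂₃ x₂ x₃ _) ⟩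
    _ ∎
    where
    total : 𝐂 ≈ s + t + b
    total = ≈-trans (≈-sym c₁₃) (+-congʳ additive)
    w₁₂ : ∀ h v k → vertex s b₁₂ 𝐂 h v k ≈ vertex s (t + b) (s + t + b) h v k
    w₁₂ = vertex-cong-weights ≈-refl (+-cancelˡ s _ _ (≈-trans c₁₂ (≈-trans total (+-assoc s t b)))) total
    w₁₃ : ∀ h v k → vertex u₁₃ b 𝐂 h v k ≈ vertex (s + t) b (s + t + b) h v k
    w₁₃ = vertex-cong-weights additive ≈-refl total
    w₂₃ : ∀ h v k → vertex t b₂₃ 𝐂 h v k ≈ vertex t (s + b) (s + t + b) h v k
    w₂₃ = vertex-cong-weights ≈-refl (+-cancelˡ t _ _ (≈-trans c₂₃ (≈-trans total
            (≈-trans (+-congʳ (+-comm s t)) (+-assoc t s b))))) total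

  -- Pipes enter a row of type w from the West and a row of type e from the East; the final
  -- horizontal colour is the one leaving through the opposite side.
  row : ∀ {n} → RowType → Carrier → Vec Carrier n → Edge → Vec Edge n → (Edge → Vec Edge n → Carrier) → Carrier
  row r x [] h [] k = k h []
  row w x (y ∷ ys) h (v ∷ vs) k =
    tile w x y h v (λ h v' → row w x ys h vs (λ h vs' → k h (v' ∷ vs')))
  row e x (y ∷ ys) h (v ∷ vs) k =
    row e x ys h vs (λ h vs' → tile e x y h v (λ h v' → k h (v' ∷ vs')))

  row-linear : ∀ {n} r x (ys : Vec Carrier n) h vs → Linear (row r x ys h vs)
  row-linear r x [] h [] = record { resp = λ eq → eq _ _ ; add = λ _ _ → ≈-refl ; scale = λ _ _ → ≈-refl }
  row-linear w x (y ∷ ys) h (v ∷ vs) = record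
    { resp  = λ eq → vertex-cong h v (λ h v' → resp (row-linear w x ys h vs) (λ h vs' → eq h (v' ∷ vs')))
    ; add   = λ k k' → ≈-trans (vertex-cong h v (λ h v' → add (row-linear w x ys h vs) _ _)) (add (vertex-linear _ _ _ h v) _ _)
    ; scale = λ a k → ≈-trans (vertex-cong h v (λ h v' → scale (row-linear w x ys h vs) a _)) (scale (vertex-linear _ _ _ h v) a _) }
  row-linear e x (y ∷ ys) h (v ∷ vs) = record
    { resp  = λ eq → resp (row-linear e x ys h vs) (λ h vs' → vertex-cong h v (λ h v' → eq h (v' ∷ vs')))
    ; add   = λ k k' → ≈-trans (resp (row-linear e x ys h vs) (λ h vs' → add (vertex-linear _ _ _ h v) _ _))
                             (add (row-linear e x ys h vs) _ _)
    ; scale = λ a k → ≈-trans (resp (row-linear e x ys h vs) (λ h vs' → scale (vertex-linear _ _ _ h v) a _))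
                            (scale (row-linear e x ys h vs) a _) }

  module _ (u b : Carrier) (u+b : u + b ≈ 𝐂) where
    private
      crossing : Edge → Edge → (Edge → Edge → Carrier) → Carrier
      crossing = vertex u b 𝐂

    -- In each column the straight weights of the two rows differ by u, whatever y is, so the same
    -- crossing passes from West to East one column at a time.
    zipper-ww : ∀ {n} {p q} → p ≈ u + q → ∀ (ys : Vec Carrier n) h h' vs (k : Edge → Edge → Vec Edge n → Carrier) →
      crossing h h' (λ h h' → row w p ys h vs (λ h vs → row w q ys h' vs (λ h' vs → k h h' vs)))
      ≈ row w q ys h' vs (λ h' vs → row w p ys h vs (λ h vs → crossing h h' (λ h h' → k h h' vs)))
    zipper-ww p≈u+q [] h h' [] k = ≈-refl
    zipper-ww {_} {p} {q} p≈u+q (y ∷ ys) h h' (v ∷ vs) k = begin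
      crossing h h' (λ h h' → tile w p y h v (λ h v → row w p ys h vs (λ h vs →
        tile w q y h' v (λ h' v → row w q ys h' vs (λ h' vs → k h h' (v ∷ vs))))))
        ≈⟨ vertex-cong h h' (λ h h' → vertex-cong h v (λ h v → vertex-commute (row-linear w p ys h vs) _ _ _ h' v _)) ⟩
      crossing h h' (λ h h' → tile w p y h v (λ h v → tile w q y h' v (λ h' v →
        row w p ys h vs (λ h vs → row w q ys h' vs (λ h' vs → k h h' (v ∷ vs))))))
        ≈⟨ yangBaxter additive u+b (straight+empty w p y) (straight+empty w q y) h h' v _ ⟩
      tile w q y h' v (λ h' v → tile w p y h v (λ h v → crossing h h' (λ h h' →
        row w p ys h vs (λ h vs → row w q ys h' vs (λ h' vs → k h h' (v ∷ vs))))))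
        ≈⟨ vertex-cong h' v (λ h' v → vertex-cong h v (λ h v → zipper-ww p≈u+q ys h h' vs _)) ⟩
      tile w q y h' v (λ h' v → tile w p y h v (λ h v → row w q ys h' vs (λ h' vs →
        row w p ys h vs (λ h vs → crossing h h' (λ h h' → k h h' (v ∷ vs))))))
        ≈⟨ vertex-cong h' v (λ h' v → ≈-sym (vertex-commute (row-linear w q ys h' vs) _ _ _ h v _)) ⟩
      tile w q y h' v (λ h' v → row w q ys h' vs (λ h' vs → tile w p y h v (λ h v →
        row w p ys h vs (λ h vs → crossing h h' (λ h h' → k h h' (v ∷ vs)))))) ∎
      where
      additive : 𝐀 + p - y ≈ u + (𝐀 + q - y)
      additive = begin
        𝐀 + p - y          ≈⟨ +-congʳ (+-congˡ p≈u+q) ⟩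
        𝐀 + (u + q) - y    ≈⟨ +-congʳ (≈-trans (≈-sym (+-assoc 𝐀 u q)) (≈-trans (+-congʳ (+-comm 𝐀 u)) (+-assoc u 𝐀 q))) ⟩
        u + (𝐀 + q) - y    ≈⟨ +-assoc u _ _ ⟩
        u + (𝐀 + q - y) ∎

    -- The e row is traversed westwards and the w row eastwards, so the crossing links them at the
    -- West end when the e row acts first, and at the East end when the w row acts first.
    zipper-we : ∀ {n} {p q} → u ≈ 𝐂 + (p - q) → ∀ (ys : Vec Carrier n) h g vs (k : Edge → Edge → Vec Edge n → Carrier) →
      row e q ys g vs (λ g vs → crossing g h (λ g h → row w p ys h vs (λ h vs → k g h vs)))
      ≈ row w p ys h vs (λ h vs → crossing g h (λ g h → row e q ys g vs (λ g vs → k g h vs)))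
    zipper-we u≈ [] h g [] k = ≈-refl
    zipper-we {_} {p} {q} u≈ (y ∷ ys) h g (v ∷ vs) k = begin
      row e q ys g vs (λ g vs → tile e q y g v (λ g v → crossing g h (λ g h →
        tile w p y h v (λ h v → row w p ys h vs (λ h vs → k g h (v ∷ vs))))))
        ≈⟨ resp (row-linear e q ys g vs) (λ g vs → exchange g h v _) ⟩
      row e q ys g vs (λ g vs → tile w p y h v (λ h v → crossing g h (λ g h →
        tile e q y g v (λ g v → row w p ys h vs (λ h vs → k g h (v ∷ vs))))))
        ≈⟨ vertex-commute (row-linear e q ys g vs) _ _ _ h v _ ⟩
      tile w p y h v (λ h v → row e q ys g vs (λ g vs → crossing g h (λ g h →
        tile e q y g v (λ g v → row w p ys h vs (λ h vs → k g h (v ∷ vs))))))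
        ≈⟨ vertex-cong h v (λ h v → resp (row-linear e q ys g vs) (λ g vs → vertex-cong g h (λ g h →
             ≈-sym (vertex-commute (row-linear w p ys h vs) _ _ _ g v _)))) ⟩
      tile w p y h v (λ h v → row e q ys g vs (λ g vs → crossing g h (λ g h →
        row w p ys h vs (λ h vs → tile e q y g v (λ g v → k g h (v ∷ vs))))))
        ≈⟨ vertex-cong h v (λ h v → zipper-we u≈ ys h g vs _) ⟩
      tile w p y h v (λ h v → row w p ys h vs (λ h vs → crossing g h (λ g h →
        row e q ys g vs (λ g vs → tile e q y g v (λ g v → k g h (v ∷ vs)))))) ∎
      where
      -- Here the vertical edge is the middle one of the three lines, so the crossing takes the
      -- place of the vertex whose straight weight is the sum of the other two.
      exchange : ∀ g h v (k : Edge → Edge → Edge → Carrier) →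
        tile e q y g v (λ g v → crossing g h (λ g h → tile w p y h v (λ h v → k g v h)))
        ≈ tile w p y h v (λ h v → crossing g h (λ g h → tile e q y g v (λ g v → k g v h)))
      exchange g h v k = begin
        tile e q y g v (λ g v → crossing g h (λ g h → tile w p y h v (λ h v → k g v h)))
          ≈⟨ vertex-cong g v (λ g v → vertex-cong g h (λ g h → vertex-flip _ _ _ h v _)) ⟩
        tile e q y g v (λ g v → crossing g h (λ g h → tile w p y v h (λ v h → k g v h)))
          ≈⟨ yangBaxter (≈-trans u≈ (≈-sym (≈-trans (+-comm _ _) (w+e p q y)))) (straight+empty e q y) u+b (straight+empty w p y) g v h k ⟩
        tile w p y v h (λ v h → crossing g h (λ g h → tile e q y g v (λ g v → k g v h)))
          ≈⟨ vertex-flip _ _ _ v h _ ⟩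
        tile w p y h v (λ h v → crossing g h (λ g h → tile e q y g v (λ g v → k g v h))) ∎

  linear-zero : ∀ {I J : Set} {Φ : (I → J → Carrier) → Carrier} → Linear Φ →
                ∀ {k} → (∀ s t → k s t ≈ 0#) → Φ k ≈ 0#
  linear-zero {Φ = Φ} lin {k} k≈0 = begin
    Φ k                     ≈⟨ resp lin (λ s t → ≈-trans (k≈0 s t) (≈-sym (zeroˡ _))) ⟩
    Φ (λ s t → 0# * k s t)  ≈⟨ scale lin 0# k ⟩
    0# * Φ k                ≈⟨ zeroˡ _ ⟩
    0# ∎

  sum-zero : ∀ u c {a b} → a ≈ 0# → b ≈ 0# → u * a + c * b ≈ 0#
  sum-zero u c a≈0 b≈0 = ≈-trans (+-cong (≈-trans (*-congˡ a≈0) (zeroʳ u)) (≈-trans (*-congˡ b≈0) (zeroʳ c))) (+-identityʳ 0#)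

  sum-left : ∀ u c {a b} → b ≈ 0# → u * a + c * b ≈ u * a
  sum-left u c b≈0 = ≈-trans (+-congˡ (≈-trans (*-congˡ b≈0) (zeroʳ c))) (+-identityʳ _)

  sum-right : ∀ u c {a b} → a ≈ 0# → u * a + c * b ≈ c * b
  sum-right u c a≈0 = ≈-trans (+-congʳ (≈-trans (*-congˡ a≈0) (zeroʳ u))) (+-identityˡ _)

  close : ∀ {n} → (Vec Edge n → Carrier) → Edge → Vec Edge n → Carrier
  close k nothing vs = k vs
  close k (just _) vs = 0#

  close-cong : ∀ {n} {k k' : Vec Edge n → Carrier} → (∀ vs → k vs ≈ k' vs) → ∀ h vs → close k h vs ≈ close k' h vs
  close-cong eq nothing vs = eq vs
  close-cong eq (just _) vs = ≈-refl

  close-scale : ∀ {n} a (k : Vec Edge n → Carrier) h vs → close (λ vs → a * k vs) h vs ≈ a * close k h vs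
  close-scale a k nothing vs = ≈-refl
  close-scale a k (just _) vs = ≈-sym (zeroʳ a)

  Row : Set ℓ₁
  Row = RowType × Carrier × C

  module _ {n} (ys : Vec Carrier n) where

    insert : Row → Vec Edge n → (Vec Edge n → Carrier) → Carrier
    insert (r , x , c) vs k = row r x ys (just c) vs (close k)

    -- Rows are listed from North to South, while the transfer operators act from South to North.
    Z : List Row → (Vec Edge n → Carrier) → Carrier
    Z [] k = k (Vec.replicate n nothing)
    Z (ρ ∷ L) k = Z L (λ vs → insert ρ vs k)

    insert-cong : ∀ ρ vs {k k'} → (∀ vs → k vs ≈ k' vs) → insert ρ vs k ≈ insert ρ vs k'
    insert-cong (r , x , c) vs eq = resp (row-linear r x ys (just c) vs) (close-cong eq)

    insert-scale : ∀ ρ vs a k → insert ρ vs (λ vs → a * k vs) ≈ a * insert ρ vs k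
    insert-scale (r , x , c) vs a k = ≈-trans
      (resp (row-linear r x ys (just c) vs) (close-scale a k)) (scale (row-linear r x ys (just c) vs) a _)

    Z-cong : ∀ L {k k'} → (∀ vs → k vs ≈ k' vs) → Z L k ≈ Z L k'
    Z-cong [] eq = eq _
    Z-cong (ρ ∷ L) eq = Z-cong L (λ vs → insert-cong ρ vs eq)

    Z-scale : ∀ L a k → Z L (λ vs → a * k vs) ≈ a * Z L k
    Z-scale [] a k = ≈-refl
    Z-scale (ρ ∷ L) a k = ≈-trans (Z-cong L (λ vs → insert-scale ρ vs a k)) (Z-scale L a _)

    Z-+ : ∀ L k k' → Z L (λ vs → k vs + k' vs) ≈ Z L k + Z L k'
    Z-+ [] k k' = ≈-refl
    Z-+ ((r , x , c) ∷ L) k k' = ≈-trans (Z-cong L (λ vs → ≈-trans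
        (resp (row-linear r x ys (just c) vs) close-+) (add (row-linear r x ys (just c) vs) _ _)))
      (Z-+ L _ _)
      where
      close-+ : ∀ h vs → close (λ vs → k vs + k' vs) h vs ≈ close k h vs + close k' h vs
      close-+ nothing vs = ≈-refl
      close-+ (just _) vs = ≈-sym (+-identityˡ 0#)

    private
      close₂ : (Vec Edge n → Carrier) → Edge → Edge → Vec Edge n → Carrier
      close₂ k g h vs = close (close k g) h vs

      close₂-zeroˡ : ∀ k p h vs → close₂ k (just p) h vs ≈ 0#
      close₂-zeroˡ k p nothing vs = ≈-refl
      close₂-zeroˡ k p (just _) vs = ≈-refl

      complement : ∀ u → u + (𝐂 - u) ≈ 𝐂
      complement u = ≈-trans (+-comm u _) (≈-trans (+-assoc 𝐂 (- u) u) (≈-trans (+-congˡ (-‿inverseˡ u)) (+-identityʳ 𝐂)))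

    -- At both ends of the two rows only one configuration of the crossing is compatible with the
    -- boundary conditions.
    insert-we : ∀ p α q β vs k →
      (𝐂 + (p - q)) * insert (e , q , β) vs (λ vs → insert (w , p , α) vs k)
      ≈ (𝐂 + (p - q)) * insert (w , p , α) vs (λ vs → insert (e , q , β) vs k)
    insert-we p α q β vs k = begin
      u * insert (e , q , β) vs (λ vs → insert (w , p , α) vs k)
        ≈⟨ ≈-sym (≈-trans (resp (row-linear e q ys (just β) vs) west) (scale (row-linear e q ys (just β) vs) u _)) ⟩
      row e q ys (just β) vs (λ g vs → vertex u (𝐂 - u) 𝐂 g (just α) (λ g h → row w p ys h vs (λ h vs → close₂ k g h vs)))
        ≈⟨ zipper-we u (𝐂 - u) (complement u) ≈-refl ys (just α) (just β) vs (close₂ k) ⟩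
      row w p ys (just α) vs (λ h vs → vertex u (𝐂 - u) 𝐂 (just β) h (λ g h → row e q ys g vs (λ g vs → close₂ k g h vs)))
        ≈⟨ ≈-trans (resp (row-linear w p ys (just α) vs) east) (scale (row-linear w p ys (just α) vs) u _) ⟩
      u * insert (w , p , α) vs (λ vs → insert (e , q , β) vs k) ∎
      where
      u = 𝐂 + (p - q)
      west : ∀ g vs → vertex u (𝐂 - u) 𝐂 g (just α) (λ g h → row w p ys h vs (λ h vs → close₂ k g h vs))
                    ≈ u * close (λ vs → insert (w , p , α) vs k) g vs
      west nothing vs = sum-left u 𝐂 (linear-zero (row-linear w p ys nothing vs) (close₂-zeroˡ k α))
      west (just γ) vs = ≈-trans (sum-zero u 𝐂
        (linear-zero (row-linear w p ys (just α) vs) (close₂-zeroˡ k γ))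
        (linear-zero (row-linear w p ys (just γ) vs) (close₂-zeroˡ k α))) (≈-sym (zeroʳ u))
      east : ∀ h vs → vertex u (𝐂 - u) 𝐂 (just β) h (λ g h → row e q ys g vs (λ g vs → close₂ k g h vs))
                    ≈ u * close (λ vs → insert (e , q , β) vs k) h vs
      east nothing vs = sum-left u 𝐂 (linear-zero (row-linear e q ys nothing vs) (λ _ _ → ≈-refl))
      east (just γ) vs = ≈-trans (sum-zero u 𝐂
        (linear-zero (row-linear e q ys (just β) vs) (λ _ _ → ≈-refl))
        (linear-zero (row-linear e q ys (just γ) vs) (λ _ _ → ≈-refl))) (≈-sym (zeroʳ u))

    -- At the West end both edges of the crossing carry pipes, and its two outcomes give the two
    -- terms on the right. At the East end both edges must end up empty, which leaves only the blank
    -- weight 𝐂 - (p - q).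
    insert-ww : ∀ p α q β vs k →
      (𝐂 - (p - q)) * insert (w , q , β) vs (λ vs → insert (w , p , α) vs k)
      ≈ (p - q) * insert (w , p , α) vs (λ vs → insert (w , q , β) vs k)
        + 𝐂 * insert (w , p , β) vs (λ vs → insert (w , q , α) vs k)
    insert-ww p α q β vs k = begin
      (𝐂 - u) * insert (w , q , β) vs (λ vs → insert (w , p , α) vs k)
        ≈⟨ ≈-sym (≈-trans (resp (row-linear w q ys (just β) vs) (λ h' vs → inner h' vs)) (scale (row-linear w q ys (just β) vs) (𝐂 - u) _)) ⟩
      row w q ys (just β) vs (λ h' vs → row w p ys (just α) vs (λ h vs → vertex u (𝐂 - u) 𝐂 h h' (λ h h' → close₂ k h' h vs)))
        ≈⟨ ≈-sym (zipper-ww u (𝐂 - u) (complement u) p≈u+q ys (just α) (just β) vs (λ h h' → close₂ k h' h)) ⟩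
      u * row w p ys (just α) vs (λ h vs → row w q ys (just β) vs (λ h' vs → close₂ k h' h vs))
        + 𝐂 * row w p ys (just β) vs (λ h vs → row w q ys (just α) vs (λ h' vs → close₂ k h' h vs))
        ≈⟨ +-cong (*-congˡ (resp (row-linear w p ys (just α) vs) (outer β))) (*-congˡ (resp (row-linear w p ys (just β) vs) (outer α))) ⟩
      u * insert (w , p , α) vs (λ vs → insert (w , q , β) vs k)
        + 𝐂 * insert (w , p , β) vs (λ vs → insert (w , q , α) vs k) ∎
      where
      u = p - q
      p≈u+q : p ≈ u + q
      p≈u+q = ≈-sym (≈-trans (+-assoc p (- q) q) (≈-trans (+-congˡ (-‿inverseˡ q)) (+-identityʳ p)))
      outer : ∀ γ h vs → row w q ys (just γ) vs (λ h' vs → close₂ k h' h vs) ≈ close (λ vs → insert (w , q , γ) vs k) h vs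
      outer γ nothing vs = ≈-refl
      outer γ (just _) vs = linear-zero (row-linear w q ys (just γ) vs) (λ _ _ → ≈-refl)
      corner : ∀ h h' vs → vertex u (𝐂 - u) 𝐂 h h' (λ h h' → close₂ k h' h vs) ≈ (𝐂 - u) * close₂ k h' h vs
      corner nothing nothing vs = ≈-refl
      corner nothing (just _) vs = ≈-trans (sum-zero u 𝐂 ≈-refl ≈-refl) (≈-sym (zeroʳ _))
      corner (just _) nothing vs = ≈-trans (sum-zero u 𝐂 ≈-refl ≈-refl) (≈-sym (zeroʳ _))
      corner (just _) (just _) vs = ≈-trans (sum-zero u 𝐂 ≈-refl ≈-refl) (≈-sym (zeroʳ _))
      inner : ∀ h' vs → row w p ys (just α) vs (λ h vs → vertex u (𝐂 - u) 𝐂 h h' (λ h h' → close₂ k h' h vs))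
                      ≈ (𝐂 - u) * close (λ vs → insert (w , p , α) vs k) h' vs
      inner nothing vs = ≈-trans (resp (row-linear w p ys (just α) vs) (λ h vs → corner h nothing vs))
                               (scale (row-linear w p ys (just α) vs) (𝐂 - u) _)
      inner (just γ) vs = ≈-trans (linear-zero (row-linear w p ys (just α) vs)
        (λ h vs → ≈-trans (corner h (just γ) vs) (≈-trans (*-congˡ (close₂-zeroˡ k γ h vs)) (zeroʳ _)))) (≈-sym (zeroʳ _))

  empty-weights : ∀ {n} → Carrier → Vec Carrier n → Carrier
  empty-weights x [] = 1#
  empty-weights x (y ∷ ys) = empty-weight w x y * empty-weights x ys

  row-w-empty : ∀ {n} x (ys : Vec Carrier n) k →
    row w x ys nothing (Vec.replicate n nothing) k ≈ empty-weights x ys * k nothing (Vec.replicate n nothing)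
  row-w-empty x [] k = ≈-sym (*-identityˡ _)
  row-w-empty x (y ∷ ys) k = ≈-trans (*-congˡ (row-w-empty x ys _)) (≈-sym (*-assoc _ _ _))

  -- A pipe meeting no other pipe turns North once or runs through the whole row; exchanging the
  -- roles of blank and straight tiles, the former also describes a row of type w.
  row-e-first : ∀ {n} x (ys : Vec Carrier n) c k → let none = Vec.replicate n nothing in
    row e x ys (just c) none k
    ≈ empty-weights x ys * k (just c) none + row w x ys (just c) none (close (k nothing))
  row-e-first x [] c k = ≈-sym (≈-trans (+-identityʳ _) (*-identityˡ _))
  row-e-first {suc n} x (y ∷ ys) c k = begin
    row e x ys (just c) none (λ h vs → tile e x y h nothing (λ h v → k h (v ∷ vs)))
      ≈⟨ row-e-first x ys c _ ⟩
    E' * (b * k (just c) (nothing ∷ none) + 𝐂 * k nothing (just c ∷ none))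
      + row w x ys (just c) none (close (λ vs → u * k nothing (nothing ∷ vs)))
      ≈⟨ +-congˡ (≈-trans (resp (row-linear w x ys (just c) none) (close-scale u _)) (scale (row-linear w x ys (just c) none) u _)) ⟩
    E' * (b * k (just c) (nothing ∷ none) + 𝐂 * k nothing (just c ∷ none))
      + u * row w x ys (just c) none (close (λ vs → k nothing (nothing ∷ vs)))
      ≈⟨ solve 6 (λ E' b p q c r → E' :* (b :* p :+ c :* q) :+ r := b :* E' :* p :+ (r :+ c :* (E' :* q)))
           ≈-refl E' b (k (just c) (nothing ∷ none)) (k nothing (just c ∷ none)) 𝐂 _ ⟩
    b * E' * k (just c) (nothing ∷ none)
      + (u * row w x ys (just c) none (close (λ vs → k nothing (nothing ∷ vs))) + 𝐂 * (E' * k nothing (just c ∷ none)))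
      ≈⟨ +-congˡ (+-cong (*-congˡ (resp (row-linear w x ys (just c) none) same)) (*-congˡ (≈-sym (row-w-empty x ys _)))) ⟩
    b * E' * k (just c) (nothing ∷ none) + row w x (y ∷ ys) (just c) (nothing ∷ none) (close (k nothing)) ∎
    where
    none = Vec.replicate n nothing
    E' = empty-weights x ys
    b = empty-weight w x y
    u = straight w x y
    same : ∀ h vs → close (λ vs → k nothing (nothing ∷ vs)) h vs ≈ close (k nothing) h (nothing ∷ vs)
    same nothing vs = ≈-refl
    same (just _) vs = ≈-refl

  module _ {n} (ys : Vec Carrier n) where

    -- Closing the row kills the term of `row-e-first` in which the pipe runs through. This is where
    -- the type of a row actually changes: an e row that has reached the bottom may be reflected.
    flip-first : ∀ x c k → Z ys ((e , x , c) ∷ []) k ≈ Z ys ((w , x , c) ∷ []) k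
    flip-first x c k = ≈-trans (row-e-first x ys c (close k)) (≈-trans (+-cong (zeroʳ _) (resp (row-linear w x ys _ _) same)) (+-identityˡ _))
      where
      same : ∀ h vs → close (close k nothing) h vs ≈ close k h vs
      same nothing vs = ≈-refl
      same (just _) vs = ≈-refl

    module _ {P : Set} (x : P → Carrier) (colour : P → C)
             (regular : ∀ p q a b → (𝐂 + (x p - x q)) * a ≈ (𝐂 + (x p - x q)) * b → a ≈ b) where

      toRow : RowType × P → Row
      toRow (r , p) = r , x p , colour p

      Z-swap-we : ∀ p q L k → Z ys (toRow (e , q) ∷ toRow (w , p) ∷ L) k ≈ Z ys (toRow (w , p) ∷ toRow (e , q) ∷ L) k
      Z-swap-we p q L k = regular p q _ _ (begin
        _ ≈⟨ ≈-sym (Z-scale ys L _ _) ⟩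
        _ ≈⟨ Z-cong ys L (λ vs → ≈-sym (insert-we ys (x p) (colour p) (x q) (colour q) vs k)) ⟩
        _ ≈⟨ Z-scale ys L _ _ ⟩
        _ ∎)

      -- The e row sinks through the w rows below it and is reflected at the bottom. Its pipe
      -- thereby comes after all of theirs, which is exactly the counterclockwise numbering.
      Z-bubble : ∀ q ps k → Z ys (map toRow ((e , q) ∷ map (w ,_) ps)) k ≈ Z ys (map toRow (map (w ,_) (ps ++ q ∷ []))) k
      Z-bubble q [] k = flip-first (x q) (colour q) k
      Z-bubble q (p ∷ ps) k = ≈-trans (Z-swap-we p q (map toRow (map (w ,_) ps)) k) (Z-bubble q ps _)

      Z-hybrid : ∀ {β ps L} → Numbering β ps L → ∀ k → Z ys (map toRow L) k ≈ Z ys (map toRow (map (w ,_) ps)) k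
      Z-hybrid [] k = ≈-refl
      Z-hybrid (w∷ num) k = Z-hybrid num _
      Z-hybrid (e∷_ {ps = ps} {p = q} num) k = ≈-trans (Z-hybrid num _) (Z-bubble q ps k)

-- Words of exit columns and the decreasing case

module TransferHom {ℓ₁ ℓ₂} (R : CommutativeRing ℓ₁ ℓ₂) (𝐀 𝐁 : CommutativeRing.Carrier R) (C : Set)
  (θ : CommutativeRing.Carrier R → CommutativeRing.Carrier R) where

  open CommutativeRing R renaming (refl to ≈-refl; sym to ≈-sym; trans to ≈-trans) hiding (zero)
  open Transfer R 𝐀 𝐁 C
  open Linear

  mapRow : Row → Row
  mapRow (r , x , c) = r , θ x , c

  module _ (θ-cong : ∀ {a b} → a ≈ b → θ a ≈ θ b) (θ-+ : ∀ a b → θ (a + b) ≈ θ a + θ b)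
           (θ-* : ∀ a b → θ (a * b) ≈ θ a * θ b) (θ-neg : ∀ a → θ (- a) ≈ - θ a)
           (θ-0 : θ 0# ≈ 0#) (θ-𝐀 : θ 𝐀 ≈ 𝐀) (θ-𝐁 : θ 𝐁 ≈ 𝐁) where

    vertex-hom : ∀ {u b c u' b' c'} → θ u ≈ u' → θ b ≈ b' → θ c ≈ c' → ∀ h v k →
                 θ (vertex u b c h v k) ≈ vertex u' b' c' h v (λ h v → θ (k h v))
    vertex-hom eu eb ec nothing nothing k = ≈-trans (θ-* _ _) (*-congʳ eb)
    vertex-hom eu eb ec (just _) v k =
      ≈-trans (θ-+ _ _) (+-cong (≈-trans (θ-* _ _) (*-congʳ eu)) (≈-trans (θ-* _ _) (*-congʳ ec)))
    vertex-hom eu eb ec nothing (just _) k =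
      ≈-trans (θ-+ _ _) (+-cong (≈-trans (θ-* _ _) (*-congʳ eu)) (≈-trans (θ-* _ _) (*-congʳ ec)))

    private
      θ-up : ∀ {a x y} → θ a ≈ a → θ y ≈ y → θ (a + x - y) ≈ a + θ x - y
      θ-up θa θy = ≈-trans (θ-+ _ _) (+-cong (≈-trans (θ-+ _ _) (+-congʳ θa)) (≈-trans (θ-neg _) (-‿cong θy)))
      θ-down : ∀ {a x y} → θ a ≈ a → θ y ≈ y → θ (a - x + y) ≈ a - θ x + y
      θ-down θa θy = ≈-trans (θ-+ _ _) (+-cong (≈-trans (θ-+ _ _) (+-cong θa (θ-neg _))) θy)
      θ-𝐂 : θ 𝐂 ≈ 𝐂
      θ-𝐂 = ≈-trans (θ-+ _ _) (+-cong θ-𝐀 θ-𝐁)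

    tile-hom : ∀ r x {y} → θ y ≈ y → ∀ h v k → θ (tile r x y h v k) ≈ tile r (θ x) y h v (λ h v → θ (k h v))
    tile-hom w x θy = vertex-hom (θ-up {x = x} θ-𝐀 θy) (θ-down {x = x} θ-𝐁 θy) θ-𝐂
    tile-hom e x θy = vertex-hom (θ-down {x = x} θ-𝐁 θy) (θ-up {x = x} θ-𝐀 θy) θ-𝐂

    row-hom : ∀ {n} r x {ys : Vec Carrier n} → VecAll.All (λ y → θ y ≈ y) ys → ∀ h vs k →
              θ (row r x ys h vs k) ≈ row r (θ x) ys h vs (λ h vs → θ (k h vs))
    row-hom r x [] h [] k = ≈-refl
    row-hom w x (θy ∷ θys) h (v ∷ vs) k =
      ≈-trans (tile-hom w x θy h v _) (vertex-cong h v (λ h v → row-hom w x θys h vs _))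
    row-hom e x {y ∷ ys} (θy ∷ θys) h (v ∷ vs) k =
      ≈-trans (row-hom e x {ys} θys h vs _) (resp (row-linear e (θ x) ys h vs) (λ h vs → tile-hom e x θy h v _))

    -- Applied to θ = r_i: the row parameters are exchanged while the colours stay in their rows.
    Z-hom : ∀ {n} {ys : Vec Carrier n} → VecAll.All (λ y → θ y ≈ y) ys → ∀ L k →
            θ (Z ys L k) ≈ Z ys (map mapRow L) (λ vs → θ (k vs))
    Z-hom θys [] k = ≈-refl
    Z-hom {ys = ys} θys ((r , x , c) ∷ L) k = ≈-trans (Z-hom θys L _)
      (Z-cong ys (map mapRow L) (λ vs → ≈-trans (row-hom r x θys (just c) vs (close k))
        (resp (row-linear r (θ x) ys (just c) vs) close-hom)))
      where
      close-hom : ∀ h vs → θ (close k h vs) ≈ close (λ vs → θ (k vs)) h vs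
      close-hom nothing vs = ≈-refl
      close-hom (just _) vs = θ-0

module ExitWords (n : ℕ) where

  open DecMembership (FinP._≟_ {n}) using (_∈?_)

  _≟E_ : (a b : Maybe (Fin n)) → Dec (a ≡ b)
  _≟E_ = MaybeP.≡-dec FinP._≟_

  -- The northern boundary demanded by a connectivity: a used column carries its own index as
  -- colour. Only membership in the list matters, so reordering the pipes does not change it.
  word : List (Fin n) → Vec (Maybe (Fin n)) n
  word cs = Vec.tabulate (λ j → if does (j ∈? cs) then just j else nothing)

  lookup-word-∈ : ∀ cs {j} → j ∈ cs → Vec.lookup (word cs) j ≡ just j
  lookup-word-∈ cs {j} j∈cs = trans (VecP.lookup∘tabulate _ j)
    (cong (if_then just j else nothing) (dec-true (j ∈? cs) j∈cs))

  lookup-word-∉ : ∀ cs {j} → j ∉ cs → Vec.lookup (word cs) j ≡ nothing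
  lookup-word-∉ cs {j} j∉cs = trans (VecP.lookup∘tabulate _ j)
    (cong (if_then just j else nothing) (dec-false (j ∈? cs) j∉cs))

  lookup-word-just : ∀ {cs j a} → Vec.lookup (word cs) j ≡ just a → j ≡ a
  lookup-word-just {cs} {j} eq with j ∈? cs
  ... | yes j∈cs = MaybeP.just-injective (trans (sym (lookup-word-∈ cs j∈cs)) eq)
  ... | no j∉cs with () ← trans (sym (lookup-word-∉ cs j∉cs)) eq

  lookup-ext : ∀ {k} {us vs : Vec (Maybe (Fin n)) k} → (∀ j → Vec.lookup us j ≡ Vec.lookup vs j) → us ≡ vs
  lookup-ext {us = us} {vs} eq = trans (sym (VecP.tabulate∘lookup us))
    (trans (VecP.tabulate-cong eq) (VecP.tabulate∘lookup vs))

  word-cong : ∀ {cs ds} → (∀ {j} → j ∈ cs → j ∈ ds) → (∀ {j} → j ∈ ds → j ∈ cs) → word cs ≡ word ds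
  word-cong {cs} {ds} to from = lookup-ext same
    where
    same : ∀ j → Vec.lookup (word cs) j ≡ Vec.lookup (word ds) j
    same j with j ∈? cs
    ... | yes j∈cs = trans (lookup-word-∈ cs j∈cs) (sym (lookup-word-∈ ds (to j∈cs)))
    ... | no j∉cs = trans (lookup-word-∉ cs j∉cs) (sym (lookup-word-∉ ds (j∉cs ∘ from)))

  word-remove : ∀ c cs → c ∉ cs → word (c ∷ cs) [ c ]≔ nothing ≡ word cs
  word-remove c cs c∉cs = lookup-ext same
    where
    same : ∀ j → Vec.lookup (word (c ∷ cs) [ c ]≔ nothing) j ≡ Vec.lookup (word cs) j
    same j with j FinP.≟ c
    ... | yes refl = trans (VecP.lookup∘updateAt j (word (c ∷ cs))) (sym (lookup-word-∉ cs c∉cs))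
    ... | no j≢c = trans (VecP.lookup∘updateAt′ j c j≢c (word (c ∷ cs))) unchanged
      where
      unchanged : Vec.lookup (word (c ∷ cs)) j ≡ Vec.lookup (word cs) j
      unchanged with j ∈? cs
      ... | yes j∈cs = trans (lookup-word-∈ (c ∷ cs) (there j∈cs)) (sym (lookup-word-∈ cs j∈cs))
      ... | no j∉cs = trans (lookup-word-∉ (c ∷ cs) λ { (here j≡c) → j≢c j≡c ; (there j∈cs) → j∉cs j∈cs })
                              (sym (lookup-word-∉ cs j∉cs))

  word-[] : word [] ≡ Vec.replicate n nothing
  word-[] = lookup-ext (λ j → trans (lookup-word-∉ [] (λ ())) (sym (VecP.lookup-replicate j nothing)))

module Words {ℓ₁ ℓ₂} (R : CommutativeRing ℓ₁ ℓ₂) (𝐀 𝐁 : CommutativeRing.Carrier R) (n : ℕ) where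

  open CommutativeRing R renaming (refl to ≈-refl; sym to ≈-sym; trans to ≈-trans) hiding (zero)
  open import Relation.Binary.Reasoning.Setoid setoid
  open Transfer R 𝐀 𝐁 (Fin n)
  open Linear
  open import Algebra.Properties.CommutativeSemigroup *-commutativeSemigroup using () renaming (x∙yz≈y∙xz to *-leftSwap)
  open ExitWords n

  indicator : ∀ {p} {P : Set p} → Dec P → Carrier
  indicator d = if does d then 1# else 0#

  target : ∀ {k} → Vec Edge k → Vec Edge k → Carrier
  target ws vs = indicator (VecP.≡-dec _≟E_ ws vs)

  private
    close-target-hit : ∀ {k} (v : Edge) (ws vs : Vec Edge k) h → close (target (v ∷ ws)) h (v ∷ vs) ≈ close (target ws) h vs
    close-target-hit v ws vs (just _) = ≈-refl
    close-target-hit v ws vs nothing with v ≟E v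
    ... | yes _ = ≈-refl
    ... | no v≢v = contradiction refl v≢v

    close-target-miss : ∀ {k} {v u : Edge} → u ≢ v → ∀ (ws vs : Vec Edge k) h → close (target (u ∷ ws)) h (v ∷ vs) ≈ 0#
    close-target-miss u≢v ws vs (just _) = ≈-refl
    close-target-miss {v = v} {u} u≢v ws vs nothing with u ≟E v
    ... | yes u≡v = contradiction u≡v u≢v
    ... | no _ = ≈-refl

    hit : ∀ {k} x (ys : Vec Carrier k) h v ws vs →
          row w x ys h vs (λ h vs → close (target (v ∷ ws)) h (v ∷ vs)) ≈ row w x ys h vs (close (target ws))
    hit x ys h v ws vs = resp (row-linear w x ys h vs) (λ h vs → close-target-hit v ws vs h)

    miss : ∀ {k} x (ys : Vec Carrier k) h {v u} ws vs → u ≢ v →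
           row w x ys h vs (λ h vs → close (target (u ∷ ws)) h (v ∷ vs)) ≈ 0#
    miss x ys h ws vs u≢v = linear-zero (row-linear w x ys h vs) (λ h vs → close-target-miss u≢v ws vs h)

    target-miss : ∀ {k} {v u : Edge} (ws vs : Vec Edge k) → u ≢ v → target (u ∷ ws) (v ∷ vs) ≈ 0#
    target-miss ws vs u≢v = close-target-miss u≢v ws vs nothing

    target-hit : ∀ {k} (v : Edge) (ws vs : Vec Edge k) → target (v ∷ ws) (v ∷ vs) ≈ target ws vs
    target-hit v ws vs = close-target-hit v ws vs nothing

    none : ∀ {k} → Vec Edge k
    none = Vec.replicate _ nothing

    -- Pipes are conserved: one that enters must leave through the North or the East, and both are
    -- required to be empty.
    row-none-just : ∀ {k} x (ys : Vec Carrier k) q vs → row w x ys (just q) vs (close (target none)) ≈ 0#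
    row-none-just x [] q [] = ≈-refl
    row-none-just x (y ∷ ys) q (nothing ∷ vs) = sum-zero _ _
      (≈-trans (hit x ys (just q) nothing none vs) (row-none-just x ys q vs))
      (miss x ys nothing none vs (λ ()))
    row-none-just x (y ∷ ys) q (just p ∷ vs) = sum-zero _ _
      (miss x ys (just q) none vs (λ ())) (miss x ys (just p) none vs (λ ()))

    row-none : ∀ {k} x (ys : Vec Carrier k) vs →
      row w x ys nothing vs (close (target none)) ≈ empty-weights x ys * target none vs
    row-none x [] [] = ≈-sym (*-identityˡ _)
    row-none x (y ∷ ys) (nothing ∷ vs) = begin
      b * row w x ys nothing vs (λ h vs → close (target none) h (nothing ∷ vs)) ≈⟨ *-congˡ (hit x ys nothing nothing none vs) ⟩
      b * row w x ys nothing vs (close (target none))      ≈⟨ *-congˡ (row-none x ys vs) ⟩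
      b * (empty-weights x ys * target none vs)            ≈⟨ ≈-sym (*-assoc b _ _) ⟩
      b * empty-weights x ys * target none vs              ≈⟨ *-congˡ (≈-sym (target-hit nothing none vs)) ⟩
      b * empty-weights x ys * target none (nothing ∷ vs) ∎
      where b = empty-weight w x y
    row-none x (y ∷ ys) (just p ∷ vs) = ≈-trans
      (sum-zero _ _ (miss x ys nothing none vs (λ ())) (≈-trans (hit x ys (just p) nothing none vs) (row-none-just x ys p vs)))
      (≈-sym (≈-trans (*-congˡ (target-miss {v = just p} {nothing} none vs (λ ()))) (zeroʳ _)))

  pathWeight : ∀ {k} → Carrier → Vec Carrier k → Fin k → Carrier
  pathWeight x (y ∷ ys) zero = 𝐂 * empty-weights x ys
  pathWeight x (y ∷ ys) (suc c) = straight w x y * pathWeight x ys c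

  -- A colour that does not occur below the row can turn North only in the column where it is last
  -- seen above the row.
  row-fresh : ∀ {k} x (ys : Vec Carrier k) a (c : Fin k) ws vs → VecAll.All (_≢ just a) vs →
    Vec.lookup ws c ≡ just a → (∀ j → j Fin.< c → Vec.lookup ws j ≢ just a) → (∀ j → c Fin.< j → Vec.lookup ws j ≡ nothing) →
    row w x ys (just a) vs (close (target ws)) ≈ pathWeight x ys c * target (ws [ c ]≔ nothing) vs
  row-fresh x (y ∷ ys) a zero (_ ∷ ws) (v ∷ vs) (v≢a ∷ _) refl before after
    with refl ← lookup-ext {us = ws} {none} (λ j → trans (after (suc j) (s≤s z≤n)) (sym (VecP.lookup-replicate j nothing))) = begin
      u * row w x ys (just a) vs (λ h vs → close (target (just a ∷ none)) h (v ∷ vs))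
        + 𝐂 * row w x ys v vs (λ h vs → close (target (just a ∷ none)) h (just a ∷ vs))
        -- If the pipe went straight on, v would appear above its column instead of a, and v differs
        -- from a by freshness.
        ≈⟨ sum-right u 𝐂 (miss x ys (just a) none vs (v≢a ∘ sym)) ⟩
      𝐂 * row w x ys v vs (λ h vs → close (target (just a ∷ none)) h (just a ∷ vs))
        ≈⟨ *-congˡ (≈-trans (hit x ys v (just a) none vs) (rest v)) ⟩
      𝐂 * (empty-weights x ys * target none (v ∷ vs))   ≈⟨ ≈-sym (*-assoc 𝐂 _ _) ⟩
      𝐂 * empty-weights x ys * target none (v ∷ vs) ∎
    where
    u = straight w x y
    rest : ∀ v → row w x ys v vs (close (target none)) ≈ empty-weights x ys * target none (v ∷ vs)
    rest nothing = ≈-trans (row-none x ys vs) (*-congˡ (≈-sym (target-hit nothing none vs)))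
    rest (just p) = ≈-trans (row-none-just x ys p vs) (≈-sym (≈-trans (*-congˡ (target-miss {v = just p} {nothing} none vs (λ ()))) (zeroʳ _)))
  row-fresh x (y ∷ ys) a (suc c) (u ∷ ws) (v ∷ vs) (v≢a ∷ fresh) at-c before after =
    ≈-trans (sum-left _ _ (miss x ys v ws vs (before zero (s≤s z≤n)))) (step (u ≟E v))
    where
    step : Dec (u ≡ v) → straight w x y * row w x ys (just a) vs (λ h vs → close (target (u ∷ ws)) h (v ∷ vs))
                       ≈ straight w x y * pathWeight x ys c * target (u ∷ (ws [ c ]≔ nothing)) (v ∷ vs)
    step (yes refl) = begin
      _ ≈⟨ *-congˡ (hit x ys (just a) u ws vs) ⟩
      _ ≈⟨ *-congˡ (row-fresh x ys a c ws vs fresh at-c (λ j j<c → before (suc j) (s≤s j<c)) (λ j c<j → after (suc j) (s≤s c<j))) ⟩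
      _ ≈⟨ ≈-sym (*-assoc _ _ _) ⟩
      _ ≈⟨ *-congˡ (≈-sym (target-hit u (ws [ c ]≔ nothing) vs)) ⟩
      _ ∎
    step (no u≢v) = ≈-trans (≈-trans (*-congˡ (miss x ys (just a) ws vs u≢v)) (zeroʳ _))
                          (≈-sym (≈-trans (*-congˡ (target-miss (ws [ c ]≔ nothing) vs u≢v)) (zeroʳ _)))

  module _ {Q : Fin n → Set} where
    vertex-cong-on : ∀ {u b c} {h v} → Maybe.All Q h → Maybe.All Q v → ∀ {k k'} →
      (∀ h v → Maybe.All Q h → Maybe.All Q v → k h v ≈ k' h v) → vertex u b c h v k ≈ vertex u b c h v k'
    vertex-cong-on Maybe.nothing Maybe.nothing eq = *-congˡ (eq _ _ Maybe.nothing Maybe.nothing)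
    vertex-cong-on (Maybe.just qh) qv eq =
      +-cong (*-congˡ (eq _ _ (Maybe.just qh) qv)) (*-congˡ (eq _ _ qv (Maybe.just qh)))
    vertex-cong-on Maybe.nothing (Maybe.just qv) eq =
      +-cong (*-congˡ (eq _ _ Maybe.nothing (Maybe.just qv))) (*-congˡ (eq _ _ (Maybe.just qv) Maybe.nothing))

    row-cong-on : ∀ {k} r x (ys : Vec Carrier k) {h vs} → Maybe.All Q h → VecAll.All (Maybe.All Q) vs → ∀ {κ κ'} →
      (∀ h vs → VecAll.All (Maybe.All Q) vs → κ h vs ≈ κ' h vs) → row r x ys h vs κ ≈ row r x ys h vs κ'
    row-cong-on r x [] qh [] eq = eq _ [] []
    row-cong-on w x (y ∷ ys) qh (qv ∷ qvs) eq =
      vertex-cong-on qh qv (λ h v qh qv → row-cong-on w x ys qh qvs (λ h vs qvs → eq h (v ∷ vs) (qv ∷ qvs)))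
    row-cong-on e x (y ∷ ys) {h} {v ∷ vs} qh (qv ∷ qvs) eq = east x ys qh qvs
      (λ h vs qh qvs → vertex-cong-on qh qv (λ h v qh qv → eq h (v ∷ vs) (qv ∷ qvs)))
      where
      -- In an e row the westernmost tile acts last, so the predicate must also be known for the
      -- horizontal edge handed to it.
      east : ∀ {k} x (ys : Vec Carrier k) {h vs} → Maybe.All Q h → VecAll.All (Maybe.All Q) vs → ∀ {κ κ'} →
        (∀ h vs → Maybe.All Q h → VecAll.All (Maybe.All Q) vs → κ h vs ≈ κ' h vs) → row e x ys h vs κ ≈ row e x ys h vs κ'
      east x [] qh [] eq = eq _ [] qh []
      east x (y ∷ ys) qh (qv ∷ qvs) eq = east x ys qh qvs
        (λ h vs qh qvs → vertex-cong-on qh qv (λ h v qh qv → eq h (v ∷ vs) qh (qv ∷ qvs)))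

    -- Vertices only move colours around, so the words that reach the continuation contain no
    -- colours but those of the rows in L. This supplies the freshness needed in `row-fresh`.
    Z-cong-on : ∀ (ys : Vec Carrier n) L → All (λ ρ → Q (proj₂ (proj₂ ρ))) L → ∀ {k k'} →
      (∀ vs → VecAll.All (Maybe.All Q) vs → k vs ≈ k' vs) → Z ys L k ≈ Z ys L k'
    Z-cong-on ys [] [] eq = eq _ (replicate⁺ n)
      where
      replicate⁺ : ∀ k → VecAll.All (Maybe.All Q) (Vec.replicate k nothing)
      replicate⁺ 0 = []
      replicate⁺ (suc k) = Maybe.nothing ∷ replicate⁺ k
    Z-cong-on ys ((r , x , c) ∷ L) (qc ∷ qL) eq = Z-cong-on ys L qL
      (λ vs qvs → row-cong-on r x ys (Maybe.just qc) qvs (close-on eq))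
      where
      close-on : ∀ {k k'} → (∀ vs → VecAll.All (Maybe.All Q) vs → k vs ≈ k' vs) →
                 ∀ h vs → VecAll.All (Maybe.All Q) vs → close k h vs ≈ close k' h vs
      close-on eq nothing vs qvs = eq vs qvs
      close-on eq (just _) vs qvs = ≈-refl

  pathProduct : Vec Carrier n → List (Carrier × Fin n) → Carrier
  pathProduct ys [] = 1#
  pathProduct ys ((x , c) ∷ xcs) = pathWeight x ys c * pathProduct ys xcs

  -- The northmost row carries the largest exit column. Its colour is new there and nothing exits
  -- further East, so by `row-fresh` the row contributes one path weight and leaves the same problem
  -- without that column.
  Z-decreasing : ∀ ys xcs → AllPairs (λ s t → proj₂ t Fin.< proj₂ s) xcs →
    Z ys (map (w ,_) xcs) (target (word (map proj₂ xcs))) ≈ pathProduct ys xcs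
  Z-decreasing ys [] [] = reflexive (cong (if_then 1# else 0#) (dec-true (VecP.≡-dec _≟E_ (word []) none) word-[]))
  Z-decreasing ys ((x , c) ∷ xcs) (below ∷ decr) = begin
    Z ys L (λ vs → insert ys (w , x , c) vs (target (word (c ∷ cs))))
      ≈⟨ Z-cong-on ys L (fromBelow below) (λ vs qvs → ≈-trans
           (row-fresh x ys c c (word (c ∷ cs)) vs (VecAll.map avoid qvs) (lookup-word-∈ (c ∷ cs) (here refl)) before after)
           (*-congˡ (reflexive (cong (λ ws → target ws vs) (word-remove c cs c∉cs))))) ⟩
    Z ys L (λ vs → pathWeight x ys c * target (word cs) vs)
      ≈⟨ Z-scale ys L _ _ ⟩
    pathWeight x ys c * Z ys L (target (word cs))
      ≈⟨ *-congˡ (Z-decreasing ys xcs decr) ⟩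
    pathWeight x ys c * pathProduct ys xcs ∎
    where
    L = map (w ,_) xcs
    cs = map proj₂ xcs
    fromBelow : ∀ {xcs} → All (λ t → proj₂ t Fin.< c) xcs → All (λ ρ → proj₂ (proj₂ ρ) Fin.< c) (map (w ,_) xcs)
    fromBelow [] = []
    fromBelow (lt ∷ lts) = lt ∷ fromBelow lts
    below-∈ : ∀ {xcs j} → All (λ t → proj₂ t Fin.< c) xcs → j ∈ map proj₂ xcs → j Fin.< c
    below-∈ {_ ∷ _} (lt ∷ _) (here refl) = lt
    below-∈ {_ ∷ _} (_ ∷ lts) (there j∈) = below-∈ lts j∈
    c∉cs : c ∉ cs
    c∉cs c∈cs = FinP.<-irrefl refl (below-∈ {xcs} below c∈cs)
    avoid : ∀ {v} → Maybe.All (Fin._< c) v → v ≢ just c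
    avoid (Maybe.just lt) refl = FinP.<-irrefl refl lt
    before : ∀ j → j Fin.< c → Vec.lookup (word (c ∷ cs)) j ≢ just c
    before j j<c eq = FinP.<⇒≢ j<c (lookup-word-just {c ∷ cs} eq)
    after : ∀ j → c Fin.< j → Vec.lookup (word (c ∷ cs)) j ≡ nothing
    after j c<j = lookup-word-∉ (c ∷ cs) λ { (here j≡c) → FinP.<⇒≢ c<j (sym j≡c)
                                  ; (there j∈cs) → FinP.<-asym c<j (below-∈ {xcs} below j∈cs) }

  prodIf : ∀ {k} → (Fin k → Bool) → (Fin k → Carrier) → Carrier
  prodIf {zero} p f = 1#
  prodIf {suc k} p f = (if p zero then f zero else 1#) * prodIf (p ∘ suc) (f ∘ suc)

  prodIf-false : ∀ {k} (f : Fin k → Carrier) → prodIf (λ _ → false) f ≈ 1#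
  prodIf-false {zero} f = ≈-refl
  prodIf-false {suc k} f = ≈-trans (*-identityˡ _) (prodIf-false (f ∘ suc))

  empty-prodIf : ∀ {k} x (y : Fin k → Carrier) → empty-weights x (Vec.tabulate y) ≈ prodIf (λ _ → true) (λ j → 𝐁 - x + y j)
  empty-prodIf {zero} x y = ≈-refl
  empty-prodIf {suc k} x y = *-congˡ (empty-prodIf x (y ∘ suc))

  pathWeight-prodIf : ∀ {k} x (y : Fin k → Carrier) (c : Fin k) → pathWeight x (Vec.tabulate y) c ≈
    𝐂 * prodIf (λ j → does (j Fin.<? c)) (λ j → 𝐀 + x - y j) * prodIf (λ j → does (c Fin.<? j)) (λ j → 𝐁 - x + y j)
  pathWeight-prodIf x y zero = *-cong
    (≈-sym (≈-trans (*-congˡ (≈-trans (*-identityˡ _) (prodIf-false (λ j → 𝐀 + x - y (suc j))))) (*-identityʳ 𝐂)))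
    (≈-trans (empty-prodIf x (y ∘ suc)) (≈-sym (*-identityˡ _)))
  pathWeight-prodIf x y (suc c) = begin
    u * pathWeight x (Vec.tabulate (y ∘ suc)) c    ≈⟨ *-congˡ (pathWeight-prodIf x (y ∘ suc) c) ⟩
    u * (𝐂 * p * q)                          ≈⟨ ≈-sym (*-assoc u _ q) ⟩
    u * (𝐂 * p) * q                          ≈⟨ *-cong (*-leftSwap u 𝐂 p) (≈-sym (*-identityˡ q)) ⟩
    𝐂 * (u * p) * (1# * q) ∎
    where
    u = 𝐀 + x - y zero
    p = prodIf (λ j → does (j Fin.<? c)) (λ j → 𝐀 + x - y (suc j))
    q = prodIf (λ j → does (c Fin.<? j)) (λ j → 𝐁 - x + y (suc j))

-- Colourings of fillings

eqB-sound : ∀ a b → eqB a b ≡ true → a ≡ b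
eqB-sound true true _ = refl
eqB-sound false false _ = refl

eqB-refl : ∀ a → eqB a a ≡ true
eqB-refl true = refl
eqB-refl false = refl

∧-split : ∀ a {b} → a ∧ b ≡ true → a ≡ true × b ≡ true
∧-split true eq = refl , eq

∧-join : ∀ {a b} → a ≡ true → b ≡ true → a ∧ b ≡ true
∧-join refl eq = eq

allB-sound : ∀ {I : Set} (p : I → Bool) xs → allB p xs ≡ true → ∀ {x} → x ∈ xs → p x ≡ true
allB-sound p (x ∷ xs) eq (here refl) = proj₁ (∧-split (p x) eq)
allB-sound p (x ∷ xs) eq (there x∈) = allB-sound p xs (proj₂ (∧-split (p x) eq)) x∈

allB-complete : ∀ {I : Set} (p : I → Bool) xs → (∀ {x} → x ∈ xs → p x ≡ true) → allB p xs ≡ true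
allB-complete p [] all = refl
allB-complete p (x ∷ xs) all = ∧-join (all (here refl)) (allB-complete p xs (λ x∈ → all (there x∈)))

nth-lookup : ∀ {I : Set} {k} (xs : Vec I k) i → nth xs (toℕ i) ≡ just (Vec.lookup xs i)
nth-lookup (x ∷ xs) zero = refl
nth-lookup (x ∷ xs) (suc i) = nth-lookup xs i

nth-< : ∀ {I : Set} {k} (xs : Vec I k) i {x} → nth xs i ≡ just x → i < k
nth-< (x ∷ xs) zero eq = s≤s z≤n
nth-< (x ∷ xs) (suc i) eq = s≤s (nth-< xs i eq)

<-nth : ∀ {I : Set} {k} (xs : Vec I k) {i} → i < k → ∃ λ x → nth xs i ≡ just x
<-nth (x ∷ xs) {zero} _ = x , refl
<-nth (x ∷ xs) {suc i} (s≤s lt) = <-nth xs lt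

nth-nothing : ∀ {I : Set} {k} (xs : Vec I k) i → nth xs i ≡ nothing → k ≤ i
nth-nothing [] i _ = z≤n
nth-nothing (x ∷ xs) (suc i) eq = s≤s (nth-nothing xs i eq)

tileAt-nth : ∀ {m n} (D : Grid m n) {i ts} j → nth D i ≡ just ts → tileAt D i j ≡ nth ts j
tileAt-nth D {i} j eq with nth D i
tileAt-nth D {i} j refl | just ts = refl

tileAt-suc : ∀ {m n} ts (D : Grid m n) i j → tileAt (ts ∷ D) (suc i) j ≡ tileAt D i j
tileAt-suc ts D i j with nth D i
... | nothing = refl
... | just _ = refl

tileAt-lookup : ∀ {m n} (D : Grid m n) i j → tileAt D (toℕ i) (toℕ j) ≡ just (Vec.lookup (Vec.lookup D i) j)
tileAt-lookup D i j = trans (tileAt-nth D (toℕ j) (nth-lookup D i)) (nth-lookup (Vec.lookup D i) j)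

tileAt-< : ∀ {m n} (D : Grid m n) i j {t} → tileAt D i j ≡ just t → i < m × j < n
tileAt-< D i j eq with nth D i in eq′
... | just ts = nth-< D i eq′ , nth-< ts j eq

<-tileAt : ∀ {m n} (D : Grid m n) {i j} → i < m → j < n → ∃ λ t → tileAt D i j ≡ just t
<-tileAt D {i} {j} i<m j<n with <-nth D i<m
... | ts , eq with <-nth ts j<n
...   | t , eq′ = t , trans (tileAt-nth D j eq) eq′

tileAt-lastColumn : ∀ {m n} (D : Grid m n) i j {t} → tileAt D i j ≡ just t → tileAt D i (suc j) ≡ nothing → suc j ≡ n
tileAt-lastColumn D i j eq eq′ with nth D i
... | just ts = ℕP.≤-antisym (nth-< ts j eq) (nth-nothing ts (suc j) eq′)

tileAt-lastRow : ∀ {m n} (D : Grid m n) i j {t} → tileAt D i j ≡ just t → tileAt D (suc i) j ≡ nothing → suc i ≡ m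
tileAt-lastRow {m} D i j eq eq′ with tileAt-< D i j eq | suc i ℕ.<? m
... | i<m , j<n | yes lt with () ← trans (sym eq′) (proj₂ (<-tileAt D lt j<n))
... | i<m , j<n | no ≮ = ℕP.≤-antisym i<m (ℕP.≮⇒≥ ≮)

module Colours (C : Set) where

  Edge : Set
  Edge = Maybe C

  at : ∀ {k} → Vec Edge k → ℕ → Edge
  at [] _ = nothing
  at (v ∷ vs) zero = v
  at (v ∷ vs) (suc j) = at vs j

  at-lookup : ∀ {k} (vs : Vec Edge k) j → at vs (toℕ j) ≡ Vec.lookup vs j
  at-lookup (v ∷ vs) zero = refl
  at-lookup (v ∷ vs) (suc j) = at-lookup vs j

  at-just : ∀ {k} (vs : Vec Edge k) j {a} → at vs j ≡ just a → ∃ λ (i : Fin k) → toℕ i ≡ j × Vec.lookup vs i ≡ just a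
  at-just (v ∷ vs) zero eq = zero , refl , eq
  at-just (v ∷ vs) (suc j) eq with at-just vs j eq
  ... | i , eq₁ , eq₂ = suc i , cong suc eq₁ , eq₂

  -- Only elbows interchange the horizontal and the vertical colour.
  flow : Tile → Edge → Edge → Edge × Edge
  flow t h v = if isElbow t then (v , h) else (h , v)

  inSide outSide : RowType → Side
  inSide w = W
  inSide e = E
  outSide w = E
  outSide e = W

  fits : RowType → Tile → Edge → Edge → Bool
  fits r t h v = allowed r t ∧ eqB (has (inSide r) t) (is-just h) ∧ eqB (has S t) (is-just v)

  fits-intro : ∀ r t h v → allowed r t ≡ true → has (inSide r) t ≡ is-just h → has S t ≡ is-just v → fits r t h v ≡ true
  fits-intro r t h v al hIn hS rewrite al | hIn | hS = ∧-join (eqB-refl (is-just h)) (eqB-refl (is-just v))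

  outs : ∀ r t {h v} → allowed r t ≡ true → has (inSide r) t ≡ is-just h → has S t ≡ is-just v →
         has (outSide r) t ≡ is-just (proj₁ (flow t h v)) × has N t ≡ is-just (proj₂ (flow t h v))
  outs w blank _ hIn hS = hIn , hS
  outs w horiz _ hIn hS = hIn , hS
  outs w vert _ hIn hS = hIn , hS
  outs w cross _ hIn hS = hIn , hS
  outs w elbWN _ hIn hS = hS , hIn
  outs w elbSE _ hIn hS = hS , hIn
  outs w dblW _ hIn hS = hS , hIn
  outs e blank _ hIn hS = hIn , hS
  outs e horiz _ hIn hS = hIn , hS
  outs e vert _ hIn hS = hIn , hS
  outs e cross _ hIn hS = hIn , hS
  outs e elbEN _ hIn hS = hS , hIn
  outs e elbSW _ hIn hS = hS , hIn
  outs e dblE _ hIn hS = hS , hIn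

  record Sides (r : RowType) (t : Tile) (h v : Edge) : Set where
    field
      isAllowed : allowed r t ≡ true
      hasIn  : has (inSide r) t ≡ is-just h
      hasS   : has S t ≡ is-just v
      hasOut : has (outSide r) t ≡ is-just (proj₁ (flow t h v))
      hasN   : has N t ≡ is-just (proj₂ (flow t h v))
  open Sides public

  sides : ∀ r t h v → fits r t h v ≡ true → Sides r t h v
  sides r t h v ok = record { isAllowed = al ; hasIn = hIn ; hasS = hS
                            ; hasOut = proj₁ (outs r t al hIn hS) ; hasN = proj₂ (outs r t al hIn hS) }
    where
    al = proj₁ (∧-split (allowed r t) ok)
    ok′ = ∧-split (eqB (has (inSide r) t) (is-just h)) (proj₂ (∧-split (allowed r t) ok))
    hIn = eqB-sound (has (inSide r) t) (is-just h) (proj₁ ok′)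
    hS = eqB-sound (has S t) (is-just v) (proj₂ ok′)

  -- The geometric rule `conn` and the colour rule `flow` agree. Within a row a pipe only moves
  -- North or onwards, never back or South, which is why tracing terminates.
  turn-horizontal : ∀ r t {a v} → allowed r t ≡ true → has (inSide r) t ≡ true →
    (conn t (inSide r) ≡ just N × proj₂ (flow t (just a) v) ≡ just a) ⊎
    (conn t (inSide r) ≡ just (outSide r) × proj₁ (flow t (just a) v) ≡ just a)
  turn-horizontal w horiz _ _ = inj₂ (refl , refl)
  turn-horizontal w cross _ _ = inj₂ (refl , refl)
  turn-horizontal w elbWN _ _ = inj₁ (refl , refl)
  turn-horizontal w dblW _ _ = inj₁ (refl , refl)
  turn-horizontal e horiz _ _ = inj₂ (refl , refl)
  turn-horizontal e cross _ _ = inj₂ (refl , refl)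
  turn-horizontal e elbEN _ _ = inj₁ (refl , refl)
  turn-horizontal e dblE _ _ = inj₁ (refl , refl)

  turn-vertical : ∀ r t {h a} → allowed r t ≡ true → has S t ≡ true →
    (conn t S ≡ just N × proj₂ (flow t h (just a)) ≡ just a) ⊎
    (conn t S ≡ just (outSide r) × proj₁ (flow t h (just a)) ≡ just a)
  turn-vertical w vert _ _ = inj₁ (refl , refl)
  turn-vertical w cross _ _ = inj₁ (refl , refl)
  turn-vertical w elbSE _ _ = inj₂ (refl , refl)
  turn-vertical w dblW _ _ = inj₂ (refl , refl)
  turn-vertical e vert _ _ = inj₁ (refl , refl)
  turn-vertical e cross _ _ = inj₁ (refl , refl)
  turn-vertical e elbSW _ _ = inj₂ (refl , refl)
  turn-vertical e dblE _ _ = inj₂ (refl , refl)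

  horizontalIn horizontalOut : RowType → (west east : Edge) → Edge
  horizontalIn w hW hE = hW
  horizontalIn e hW hE = hE
  horizontalOut w hW hE = hE
  horizontalOut e hW hE = hW

  TileOK : RowType → Tile → (west east south north : Edge) → Set
  TileOK r t hW hE vS vN =
    fits r t (horizontalIn r hW hE) vS ≡ true × flow t (horizontalIn r hW hE) vS ≡ (horizontalOut r hW hE , vN)

  rowFlow : ∀ {n} → RowType → Vec Tile n → Edge → Vec Edge n → Edge × Vec Edge n
  rowFlow r [] h [] = h , []
  rowFlow w (t ∷ ts) h (v ∷ vs) =
    let h₁ , v₁ = flow t h v ; h₂ , vs₂ = rowFlow w ts h₁ vs in h₂ , v₁ ∷ vs₂
  rowFlow e (t ∷ ts) h (v ∷ vs) =
    let h₁ , vs₁ = rowFlow e ts h vs ; h₂ , v₂ = flow t h₁ v in h₂ , v₂ ∷ vs₁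

  rowFits : ∀ {n} → RowType → Vec Tile n → Edge → Vec Edge n → Bool
  rowFits r [] h [] = true
  rowFits w (t ∷ ts) h (v ∷ vs) = fits w t h v ∧ rowFits w ts (proj₁ (flow t h v)) vs
  rowFits e (t ∷ ts) h (v ∷ vs) = fits e t (proj₁ (rowFlow e ts h vs)) v ∧ rowFits e ts h vs

  -- Edges are numbered from West to East for both types: j is the West side of column j and n the
  -- East boundary, although an e row is traversed the other way.
  rowEdges : ∀ {n} → RowType → Vec Tile n → Edge → Vec Edge n → ℕ → Edge
  rowEdges r [] h [] _ = h
  rowEdges w (t ∷ ts) h (v ∷ vs) zero = h
  rowEdges w (t ∷ ts) h (v ∷ vs) (suc j) = rowEdges w ts (proj₁ (flow t h v)) vs j
  rowEdges e (t ∷ ts) h (v ∷ vs) zero = proj₁ (flow t (proj₁ (rowFlow e ts h vs)) v)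
  rowEdges e (t ∷ ts) h (v ∷ vs) (suc j) = rowEdges e ts h vs j

  rowEdges-w-west : ∀ {n} (ts : Vec Tile n) h vs → rowEdges w ts h vs 0 ≡ h
  rowEdges-w-west [] h [] = refl
  rowEdges-w-west (t ∷ ts) h (v ∷ vs) = refl

  rowEdges-w-east : ∀ {n} (ts : Vec Tile n) h vs → rowEdges w ts h vs n ≡ proj₁ (rowFlow w ts h vs)
  rowEdges-w-east [] h [] = refl
  rowEdges-w-east (t ∷ ts) h (v ∷ vs) = rowEdges-w-east ts _ vs

  rowEdges-e-west : ∀ {n} (ts : Vec Tile n) h vs → rowEdges e ts h vs 0 ≡ proj₁ (rowFlow e ts h vs)
  rowEdges-e-west [] h [] = refl
  rowEdges-e-west (t ∷ ts) h (v ∷ vs) = refl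

  rowEdges-e-east : ∀ {n} (ts : Vec Tile n) h vs → rowEdges e ts h vs n ≡ h
  rowEdges-e-east [] h [] = refl
  rowEdges-e-east (t ∷ ts) h (v ∷ vs) = rowEdges-e-east ts h vs

  row-tileOK : ∀ {n} r (ts : Vec Tile n) h vs → rowFits r ts h vs ≡ true → ∀ j {t} → nth ts j ≡ just t →
    TileOK r t (rowEdges r ts h vs j) (rowEdges r ts h vs (suc j)) (at vs j) (at (proj₂ (rowFlow r ts h vs)) j)
  row-tileOK w (t ∷ ts) h (v ∷ vs) ok zero refl =
    proj₁ (∧-split (fits w t h v) ok) , cong (_, proj₂ (flow t h v)) (sym (rowEdges-w-west ts _ vs))
  row-tileOK w (t ∷ ts) h (v ∷ vs) ok (suc j) eq =
    row-tileOK w ts _ vs (proj₂ (∧-split (fits w t h v) ok)) j eq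
  row-tileOK e (t ∷ ts) h (v ∷ vs) ok zero refl
    rewrite rowEdges-e-west ts h vs = proj₁ (∧-split (fits e t (proj₁ (rowFlow e ts h vs)) v) ok) , refl
  row-tileOK e (t ∷ ts) h (v ∷ vs) ok (suc j) eq =
    row-tileOK e ts h vs (proj₂ (∧-split (fits e t (proj₁ (rowFlow e ts h vs)) v) ok)) j eq

  isNothing : Edge → Bool
  isNothing h = not (is-just h)

  isNothing-sound : ∀ h → isNothing h ≡ true → h ≡ nothing
  isNothing-sound nothing _ = refl

  gridFlow : ∀ {m n} → Vec RowType m → Vec C m → Grid m n → Vec Edge n
  gridFlow [] [] [] = Vec.replicate _ nothing
  gridFlow (r ∷ β) (c ∷ cs) (ts ∷ D) = proj₂ (rowFlow r ts (just c) (gridFlow β cs D))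

  gridFits : ∀ {m n} → Vec RowType m → Vec C m → Grid m n → Bool
  gridFits [] [] [] = true
  gridFits (r ∷ β) (c ∷ cs) (ts ∷ D) =
    gridFits β cs D ∧ rowFits r ts (just c) (gridFlow β cs D) ∧ isNothing (proj₁ (rowFlow r ts (just c) (gridFlow β cs D)))

  -- The first index of `vertical` names the row whose North side is meant, so m stands for the
  -- South boundary.
  horizontal vertical : ∀ {m n} → Vec RowType m → Vec C m → Grid m n → ℕ → ℕ → Edge
  horizontal [] [] [] _ _ = nothing
  horizontal (r ∷ β) (c ∷ cs) (ts ∷ D) zero = rowEdges r ts (just c) (gridFlow β cs D)
  horizontal (r ∷ β) (c ∷ cs) (ts ∷ D) (suc i) = horizontal β cs D i
  vertical β cs D zero = at (gridFlow β cs D)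
  vertical [] [] [] (suc _) _ = nothing
  vertical (r ∷ β) (c ∷ cs) (ts ∷ D) (suc i) = vertical β cs D i

  grid-tileOK : ∀ {m n} (β : Vec RowType m) cs (D : Grid m n) → gridFits β cs D ≡ true →
    ∀ i j {r t} → nth β i ≡ just r → tileAt D i j ≡ just t →
    TileOK r t (horizontal β cs D i j) (horizontal β cs D i (suc j)) (vertical β cs D (suc i) j) (vertical β cs D i j)
  grid-tileOK (r ∷ β) (c ∷ cs) (ts ∷ D) ok zero j refl eq =
    row-tileOK r ts (just c) (gridFlow β cs D)
      (proj₁ (∧-split (rowFits r ts (just c) (gridFlow β cs D)) (proj₂ (∧-split (gridFits β cs D) ok)))) j eq
  grid-tileOK (r ∷ β) (c ∷ cs) (ts ∷ D) ok (suc i) j eq eq′ =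
    grid-tileOK β cs D (proj₁ (∧-split (gridFits β cs D) ok)) i j eq (trans (sym (tileAt-suc ts D i j)) eq′)

  horizontal-entry : ∀ {m n} (β : Vec RowType m) cs (D : Grid m n) i {r c} → nth β i ≡ just r → nth cs i ≡ just c →
    horizontalIn r (horizontal β cs D i 0) (horizontal β cs D i n) ≡ just c
  horizontal-entry (w ∷ β) (c ∷ cs) (ts ∷ D) zero refl refl = rowEdges-w-west ts (just c) _
  horizontal-entry (e ∷ β) (c ∷ cs) (ts ∷ D) zero refl refl = rowEdges-e-east ts (just c) _
  horizontal-entry (r ∷ β) (c ∷ cs) (ts ∷ D) (suc i) eq eq′ = horizontal-entry β cs D i eq eq′

  horizontal-exit : ∀ {m n} (β : Vec RowType m) cs (D : Grid m n) → gridFits β cs D ≡ true →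
    ∀ i {r} → nth β i ≡ just r → horizontalOut r (horizontal β cs D i 0) (horizontal β cs D i n) ≡ nothing
  horizontal-exit (r ∷ β) (c ∷ cs) (ts ∷ D) ok zero refl = exit r ts _
      (isNothing-sound _ (proj₂ (∧-split (rowFits r ts (just c) (gridFlow β cs D)) (proj₂ (∧-split (gridFits β cs D) ok)))))
    where
    exit : ∀ {n} r (ts : Vec Tile n) vs → proj₁ (rowFlow r ts (just c) vs) ≡ nothing →
           horizontalOut r (rowEdges r ts (just c) vs 0) (rowEdges r ts (just c) vs n) ≡ nothing
    exit w ts vs eq = trans (rowEdges-w-east ts (just c) vs) eq
    exit e ts vs eq = trans (rowEdges-e-west ts (just c) vs) eq
  horizontal-exit (r ∷ β) (c ∷ cs) (ts ∷ D) ok (suc i) eq = horizontal-exit β cs D (proj₁ (∧-split (gridFits β cs D) ok)) i eq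

  at-none : ∀ k j → at (Vec.replicate k nothing) j ≡ nothing
  at-none zero j = refl
  at-none (suc k) zero = refl
  at-none (suc k) (suc j) = at-none k j

  vertical-bottom : ∀ {m n} (β : Vec RowType m) cs (D : Grid m n) j → vertical β cs D m j ≡ nothing
  vertical-bottom {n = n} [] [] [] j = at-none n j
  vertical-bottom (r ∷ β) (c ∷ cs) (ts ∷ D) j = vertical-bottom β cs D j

  trace-N-zero : ∀ {m n} f (D : Grid m n) j s {t} → tileAt D 0 j ≡ just t → conn t s ≡ just N → trace (suc f) D 0 j s ≡ just j
  trace-N-zero f D j s eq eq′ rewrite eq | eq′ = refl

  trace-N-suc : ∀ {m n} f (D : Grid m n) i j s {t} → tileAt D (suc i) j ≡ just t → conn t s ≡ just N →
                trace (suc f) D (suc i) j s ≡ trace f D i j S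
  trace-N-suc f D i j s eq eq′ rewrite eq | eq′ = refl

  trace-E : ∀ {m n} f (D : Grid m n) i j s {t} → tileAt D i j ≡ just t → conn t s ≡ just E →
            trace (suc f) D i j s ≡ trace f D i (suc j) W
  trace-E f D i j s eq eq′ rewrite eq | eq′ = refl

  trace-W : ∀ {m n} f (D : Grid m n) i j s {t} → tileAt D i (suc j) ≡ just t → conn t s ≡ just W →
            trace (suc f) D i (suc j) s ≡ trace f D i j E
  trace-W f D i j s eq eq′ rewrite eq | eq′ = refl

  module Tracing {m n} (β : Vec RowType m) (cs : Vec C m) (D : Grid m n) (ok : gridFits β cs D ≡ true) where
    private
      H V : ℕ → ℕ → Edge
      H = horizontal β cs D
      V = vertical β cs D

    data Entering (r : RowType) (i j : ℕ) (a : C) : Side → Set where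
      horizontally : horizontalIn r (H i j) (H i (suc j)) ≡ just a → Entering r i j a (inSide r)
      vertically   : V (suc i) j ≡ just a → Entering r i j a S

    -- ρ is the number of tiles from column j on that the pipe can still visit in its row.
    Remaining : RowType → ℕ → ℕ → Set
    Remaining w j ρ = j ℕ.+ ρ ≡ n
    Remaining e j ρ = ρ ≡ suc j

    remaining : ∀ r j → j < n → ∃ λ ρ → Remaining r j ρ × ρ ≤ n
    remaining w j j<n = n ℕ.∸ j , ℕP.m+[n∸m]≡n (ℕP.<⇒≤ j<n) , ℕP.m∸n≤m n j
    remaining e j j<n = suc j , refl , j<n

    turn : ∀ {i j r t s a} → nth β i ≡ just r → tileAt D i j ≡ just t → Entering r i j a s →
           (conn t s ≡ just N × V i j ≡ just a) ⊎
           (conn t s ≡ just (outSide r) × horizontalOut r (H i j) (H i (suc j)) ≡ just a)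
    turn {i} {j} {r} {t} rᵢ tᵢⱼ entering with grid-tileOK β cs D ok i j rᵢ tᵢⱼ
    turn {i} {j} {r} {t} {a = a} rᵢ tᵢⱼ (horizontally hIn) | okT , flows with sides r t _ _ okT
    ... | sd rewrite hIn with turn-horizontal r t {a} {V (suc i) j} (isAllowed sd) (hasIn sd)
    ...   | inj₁ (c , eq) = inj₁ (c , trans (sym (cong proj₂ flows)) eq)
    ...   | inj₂ (c , eq) = inj₂ (c , trans (sym (cong proj₁ flows)) eq)
    turn {i} {j} {r} {t} {a = a} rᵢ tᵢⱼ (vertically vS) | okT , flows with sides r t _ _ okT
    ... | sd rewrite vS with turn-vertical r t {horizontalIn r (H i j) (H i (suc j))} {a} (isAllowed sd) (hasS sd)
    ...   | inj₁ (c , eq) = inj₁ (c , trans (sym (cong proj₂ flows)) eq)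
    ...   | inj₂ (c , eq) = inj₂ (c , trans (sym (cong proj₁ flows)) eq)

    -- The colour is constant along the pipe, so it is found again where the pipe leaves through the
    -- North. Here ρ does not count the present tile. The measure `i * n + ρ` drops at every move:
    -- within a row ρ decreases, and going North resets ρ to less than n while i decreases.
    follow : ∀ f i j {r t s a} ρ → nth β i ≡ just r → tileAt D i j ≡ just t → Entering r i j a s →
             Remaining r j (suc ρ) → i ℕ.* n ℕ.+ ρ < f → ∃ λ c → V 0 c ≡ just a × trace f D i j s ≡ just c
    follow (suc f) i j {r} {t} {s} {a} ρ rᵢ tᵢⱼ entering rem (s≤s fuel) with turn rᵢ tᵢⱼ entering
    follow (suc f) zero j {s = s} ρ rᵢ tᵢⱼ entering rem (s≤s fuel) | inj₁ (north , vN) =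
      j , vN , trace-N-zero f D j s tᵢⱼ north
    follow (suc f) (suc i) j {s = s} ρ rᵢ tᵢⱼ entering rem (s≤s fuel) | inj₁ (north , vN)
      with tileAt-< D (suc i) j tᵢⱼ
    ... | i<m , j<n with <-nth β (ℕP.<⇒≤ i<m) | <-tileAt D (ℕP.<⇒≤ i<m) j<n
    ...   | r′ , r′ᵢ | t′ , t′ᵢⱼ with remaining r′ j j<n
    ...     | zero , rem′ , _ = contradiction rem′ (impossible r′ j j<n)
      where
      impossible : ∀ r j → j < n → Remaining r j zero → ⊥
      impossible w j j<n eq = ℕP.<⇒≢ j<n (trans (sym (ℕP.+-identityʳ j)) eq)
      impossible e j j<n ()
    ...     | suc ρ′ , rem′ , ρ′<n with follow f i j ρ′ r′ᵢ t′ᵢⱼ (vertically vN) rem′ fuel′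
      where
      fuel′ : i ℕ.* n ℕ.+ ρ′ < f
      fuel′ = ℕP.<-≤-trans (ℕP.+-monoʳ-< (i ℕ.* n) ρ′<n)
        (ℕP.≤-trans (ℕP.≤-reflexive (ℕP.+-comm (i ℕ.* n) n)) (ℕP.≤-trans (ℕP.m≤m+n _ ρ) fuel))
    ...       | c , at-c , eq = c , at-c , trans (trace-N-suc f D i j s tᵢⱼ north) eq
    follow (suc f) i j {w} {s = s} {a} ρ rᵢ tᵢⱼ entering rem (s≤s fuel) | inj₂ (out , hE)
      with tileAt D i (suc j) in next
    -- Beyond the last column the colour would sit on the East boundary, which a w row leaves empty.
    ... | nothing with () ← trans (sym (horizontal-exit β cs D ok i rᵢ))
                              (subst (λ k → H i k ≡ just a) (tileAt-lastColumn D i j tᵢⱼ next) hE)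
    ... | just t′ with ρ
    ...   | zero = contradiction (trans (ℕP.+-comm 1 j) rem) (ℕP.<⇒≢ (proj₂ (tileAt-< D i (suc j) next)))
    ...   | suc ρ′ with follow f i (suc j) ρ′ rᵢ next (horizontally hE) (trans (sym (ℕP.+-suc j (suc ρ′))) rem)
                       (ℕP.≤-trans (ℕP.≤-reflexive (sym (ℕP.+-suc (i ℕ.* n) ρ′))) fuel)
    ...     | c , at-c , eq = c , at-c , trans (trace-E f D i j s tᵢⱼ out) eq
    follow (suc f) i zero {e} ρ rᵢ tᵢⱼ entering rem (s≤s fuel) | inj₂ (out , hW)
      with () ← trans (sym (horizontal-exit β cs D ok i rᵢ)) hW
    follow (suc f) i (suc j) {e} {s = s} .(suc j) rᵢ tᵢⱼ entering refl (s≤s fuel) | inj₂ (out , hW)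
      with tileAt-< D i (suc j) tᵢⱼ
    ... | i<m , j<n with <-tileAt D i<m (ℕP.<⇒≤ j<n)
    ...   | t′ , t′ᵢⱼ with follow f i j j rᵢ t′ᵢⱼ (horizontally hW) refl
                         (ℕP.≤-trans (ℕP.≤-reflexive (sym (ℕP.+-suc (i ℕ.* n) j))) fuel)
    ...     | c , at-c , eq = c , at-c , trans (trace-W f D i j s tᵢⱼ out) eq

-- Local conditions on a filling against the existence of a colouring

eastSpec : RowType → Tile → Maybe Tile → Bool
eastSpec r t nothing = eqB (has E t) (isE r)
eastSpec r t (just t′) = eqB (has E t) (has W t′)

southSpec : Tile → Maybe Tile → Bool
southSpec t nothing = eqB (has S t) false
southSpec t (just t′) = eqB (has S t) (has N t′)

westSpec : RowType → Tile → ℕ → Bool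
westSpec r t zero = eqB (has W t) (isW r)
westSpec r t (suc _) = true

consistentAt-spec : ∀ {m n} (β : Vec RowType m) (D : Grid m n) i j t → consistentAt β D i j t ≡
  westSpec (Vec.lookup β i) t j ∧ eastSpec (Vec.lookup β i) t (tileAt D (toℕ i) (suc j)) ∧ southSpec t (tileAt D (suc (toℕ i)) j)
consistentAt-spec β D i j t with tileAt D (toℕ i) (suc j) | tileAt D (suc (toℕ i)) j
consistentAt-spec β D i zero t | nothing | nothing = refl
consistentAt-spec β D i zero t | nothing | just _ = refl
consistentAt-spec β D i zero t | just _ | nothing = refl
consistentAt-spec β D i zero t | just _ | just _ = refl
consistentAt-spec β D i (suc j) t | nothing | nothing = refl
consistentAt-spec β D i (suc j) t | nothing | just _ = refl
consistentAt-spec β D i (suc j) t | just _ | nothing = refl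
consistentAt-spec β D i (suc j) t | just _ | just _ = refl

-- The local conditions on a filling, indexed by natural numbers so that they pass to subgrids.
LocallyOK : ∀ {m n} → Vec RowType m → Grid m n → Set
LocallyOK β D = ∀ i j {r t} → nth β i ≡ just r → tileAt D i j ≡ just t →
  allowed r t ∧ westSpec r t j ∧ eastSpec r t (tileAt D i (suc j)) ∧ southSpec t (tileAt D (suc i) j) ≡ true

nth-toList : ∀ {I : Set} {k} (xs : Vec I k) {x} → x ∈ Vec.toList xs → ∃ λ i → Vec.lookup xs i ≡ x
nth-toList (x ∷ xs) (here refl) = zero , refl
nth-toList (x ∷ xs) (there x∈) with nth-toList xs x∈
... | i , eq = suc i , eq

lookup-∈-toList : ∀ {I : Set} {k} (xs : Vec I k) i → Vec.lookup xs i ∈ Vec.toList xs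
lookup-∈-toList (x ∷ xs) zero = here refl
lookup-∈-toList (x ∷ xs) (suc i) = there (lookup-∈-toList xs i)

nth-fin : ∀ {I : Set} {k} (xs : Vec I k) i {x} → nth xs i ≡ just x → ∃ λ j → toℕ j ≡ i × Vec.lookup xs j ≡ x
nth-fin (x ∷ xs) zero refl = zero , refl , refl
nth-fin (x ∷ xs) (suc i) eq with nth-fin xs i eq
... | j , eq₁ , eq₂ = suc j , cong suc eq₁ , eq₂

locallyOK⇒consistent : ∀ {m n} (β : Vec RowType m) (D : Grid m n) → LocallyOK β D →
                       tilesAllowed β D ≡ true × consistent β D ≡ true
locallyOK⇒consistent {m} {n} β D ok =
  allB-complete _ (List.allFin m) (λ {i} _ → allB-complete _ (Vec.toList (Vec.lookup D i)) (λ t∈ → al i (nth-toList _ t∈))) ,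
  allB-complete _ (List.allFin m) (λ {i} _ → allB-complete _ (List.allFin n) (λ {j} _ →
    trans (consistentAt-spec β D i (toℕ j) _) (proj₂ (local i j))))
  where
  local : ∀ i j → allowed (Vec.lookup β i) (Vec.lookup (Vec.lookup D i) j) ≡ true × _
  local i j = ∧-split (allowed (Vec.lookup β i) (Vec.lookup (Vec.lookup D i) j))
                      (ok (toℕ i) (toℕ j) (nth-lookup β i) (tileAt-lookup D i j))
  al : ∀ i {t} → (∃ λ j → Vec.lookup (Vec.lookup D i) j ≡ t) → allowed (Vec.lookup β i) t ≡ true
  al i (j , refl) = proj₁ (local i j)

consistent⇒locallyOK : ∀ {m n} (β : Vec RowType m) (D : Grid m n) →
                       tilesAllowed β D ≡ true → consistent β D ≡ true → LocallyOK β D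
consistent⇒locallyOK {m} {n} β D al con i j rᵢ tᵢⱼ with nth-fin β i rᵢ
... | i , refl , refl with nth-fin (Vec.lookup D i) j (trans (sym (tileAt-nth D j (nth-lookup D i))) tᵢⱼ)
...   | j , refl , refl = ∧-join
  (allB-sound _ _ (allB-sound _ (List.allFin m) al (∈-allFin i)) (lookup-∈-toList (Vec.lookup D i) j))
  (trans (sym (consistentAt-spec β D i (toℕ j) _))
         (allB-sound _ (List.allFin n) (allB-sound _ (List.allFin m) con (∈-allFin i)) (∈-allFin j)))

module Consistency (C : Set) where
  open Colours C

  hasWest : ∀ {r t hW hE vS vN} → TileOK r t hW hE vS vN → has W t ≡ is-just hW
  hasWest {w} (ok , _) = hasIn (sides w _ _ _ ok)
  hasWest {e} (ok , flows) = trans (hasOut (sides e _ _ _ ok)) (cong (λ p → is-just (proj₁ p)) flows)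

  hasEast : ∀ {r t hW hE vS vN} → TileOK r t hW hE vS vN → has E t ≡ is-just hE
  hasEast {e} (ok , _) = hasIn (sides e _ _ _ ok)
  hasEast {w} (ok , flows) = trans (hasOut (sides w _ _ _ ok)) (cong (λ p → is-just (proj₁ p)) flows)

  hasSouth : ∀ {r t hW hE vS vN} → TileOK r t hW hE vS vN → has S t ≡ is-just vS
  hasSouth {r} (ok , _) = hasS (sides r _ _ _ ok)

  hasNorth : ∀ {r t hW hE vS vN} → TileOK r t hW hE vS vN → has N t ≡ is-just vN
  hasNorth {r} (ok , flows) = trans (hasN (sides r _ _ _ ok)) (cong (λ p → is-just (proj₂ p)) flows)

  -- Two tiles sharing an edge match because each carries a pipe there exactly when that edge is
  -- coloured; at the boundary the colouring is prescribed.
  gridFits⇒locallyOK : ∀ {m n} (β : Vec RowType m) cs (D : Grid m n) → gridFits β cs D ≡ true → LocallyOK β D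
  gridFits⇒locallyOK {m} {n} β cs D ok i j {r} {t} rᵢ tᵢⱼ =
    ∧-join (isAllowed (sides r t _ _ (proj₁ here-ok))) (∧-join (west j tᵢⱼ) (∧-join (east (tileAt D i (suc j)) refl) (south (tileAt D (suc i) j) refl)))
    where
    tileOK : ∀ i j {r t} → nth β i ≡ just r → tileAt D i j ≡ just t → TileOK r t _ _ _ _
    tileOK = grid-tileOK β cs D ok
    here-ok = tileOK i j rᵢ tᵢⱼ
    equal : ∀ {a b} → a ≡ b → eqB a b ≡ true
    equal {a} refl = eqB-refl a
    entry = horizontal-entry β cs D i rᵢ (proj₂ (<-nth cs (nth-< β i rᵢ)))
    exit = horizontal-exit β cs D ok i rᵢ
    westBoundary : ∀ r {c hW hE} → horizontalIn r hW hE ≡ just c → horizontalOut r hW hE ≡ nothing → is-just hW ≡ isW r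
    westBoundary w refl _ = refl
    westBoundary e _ refl = refl
    eastBoundary : ∀ r {c hW hE} → horizontalIn r hW hE ≡ just c → horizontalOut r hW hE ≡ nothing → is-just hE ≡ isE r
    eastBoundary w _ refl = refl
    eastBoundary e refl _ = refl
    west : ∀ j → tileAt D i j ≡ just t → westSpec r t j ≡ true
    west zero eq = equal (trans (hasWest {r} (tileOK i 0 rᵢ eq)) (westBoundary r entry exit))
    west (suc j) _ = refl
    east : ∀ next → tileAt D i (suc j) ≡ next → eastSpec r t next ≡ true
    east nothing eq = equal (trans (hasEast {r} here-ok)
      (trans (cong (λ k → is-just (horizontal β cs D i k)) (tileAt-lastColumn D i j tᵢⱼ eq)) (eastBoundary r entry exit)))
    east (just t′) eq = equal (trans (hasEast {r} here-ok) (sym (hasWest {r} (tileOK i (suc j) rᵢ eq))))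
    south : ∀ below → tileAt D (suc i) j ≡ below → southSpec t below ≡ true
    south nothing eq = equal (trans (hasSouth {r} here-ok)
      (trans (cong (λ k → is-just (vertical β cs D k j)) (tileAt-lastRow D i j tᵢⱼ eq)) (cong is-just (vertical-bottom β cs D j))))
    south (just t′) eq with <-nth β (proj₁ (tileAt-< D (suc i) j eq))
    ... | r′ , r′ᵢ = equal (trans (hasSouth {r} here-ok) (sym (hasNorth {r′} (tileOK (suc i) j r′ᵢ eq))))

  -- The flag b records whether a pipe crosses the West edge. It is variable because the tail of a
  -- row no longer begins at the boundary.
  RowOK : ∀ {n} → RowType → Bool → Vec Tile n → Set
  RowOK r b ts = ∀ j {t} → nth ts j ≡ just t →
    allowed r t ≡ true × (j ≡ 0 → has W t ≡ b) × eastSpec r t (nth ts (suc j)) ≡ true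

  rowOK-tail : ∀ {n} r b t (ts : Vec Tile n) → RowOK r b (t ∷ ts) → RowOK r (has E t) ts
  rowOK-tail r b t ts ok j {t′} eq with ok (suc j) eq
  ... | al , _ , ea = al , (λ { refl → sym (eqB-sound (has E t) (has W t′) (subst (λ x → eastSpec r t x ≡ true) eq (proj₂ (proj₂ (ok 0 refl))))) }) , ea

  eastEnd : ∀ {n} → Bool → Vec Tile n → Bool
  eastEnd b [] = b
  eastEnd b (t ∷ ts) = eastEnd (has E t) ts

  westEnd : ∀ {n} → Bool → Vec Tile n → Bool
  westEnd b [] = b
  westEnd b (t ∷ ts) = has W t

  eastEnd-rowOK : ∀ {n} r b (ts : Vec Tile (suc n)) → RowOK r b ts → eastEnd b ts ≡ isE r
  eastEnd-rowOK r b (t ∷ []) ok = eqB-sound (has E t) (isE r) (proj₂ (proj₂ (ok 0 refl)))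
  eastEnd-rowOK r b (t ∷ ts@(_ ∷ _)) ok = eastEnd-rowOK r (has E t) ts (rowOK-tail r b t ts ok)

  Souths Norths : ∀ {n} → Vec Tile n → Vec Edge n → Set
  Souths ts vs = ∀ j {t} → nth ts j ≡ just t → has S t ≡ is-just (at vs j)
  Norths ts vs = ∀ j {t} → nth ts j ≡ just t → has N t ≡ is-just (at vs j)

  rowOK-fits-w : ∀ {n} b (ts : Vec Tile n) h vs → RowOK w b ts → is-just h ≡ b → Souths ts vs →
    rowFits w ts h vs ≡ true × is-just (proj₁ (rowFlow w ts h vs)) ≡ eastEnd b ts × Norths ts (proj₂ (rowFlow w ts h vs))
  rowOK-fits-w b [] h [] ok eq so = refl , eq , λ _ ()
  rowOK-fits-w b (t ∷ ts) h (v ∷ vs) ok eq so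
    with ok 0 refl | fits-intro w t h v (proj₁ (ok 0 refl)) (trans (proj₁ (proj₂ (ok 0 refl)) refl) (sym eq)) (so 0 refl)
  ... | al , _ , ea | fit
    with rowOK-fits-w (has E t) ts _ vs (rowOK-tail w b t ts ok) (sym (hasOut (sides w t h v fit))) (λ j → so (suc j))
  ...   | fs , end , north = ∧-join fit fs , end , λ { zero refl → hasN (sides w t h v fit) ; (suc j) eq → north j eq }

  -- The colour entering a tile is known only after the columns East of it, so the induction also
  -- reports whether the West end of the tail is occupied. For an empty tail this is the East
  -- boundary, hence the default `true`.
  rowOK-fits-e : ∀ {n} b (ts : Vec Tile n) h vs → RowOK e b ts → is-just h ≡ true → Souths ts vs →
    rowFits e ts h vs ≡ true × is-just (proj₁ (rowFlow e ts h vs)) ≡ westEnd true ts × Norths ts (proj₂ (rowFlow e ts h vs))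
  rowOK-fits-e b [] h [] ok eq so = refl , eq , λ _ ()
  rowOK-fits-e b (t ∷ ts) h (v ∷ vs) ok eq so
    with rowOK-fits-e (has E t) ts h vs (rowOK-tail e b t ts ok) eq (λ j → so (suc j))
  ... | fs , end , north
    with fits-intro e t (proj₁ (rowFlow e ts h vs)) v (proj₁ (ok 0 refl)) (trans (link ts (proj₂ (proj₂ (ok 0 refl)))) (sym end)) (so 0 refl)
    where
    link : ∀ {n} (ts : Vec Tile n) → eastSpec e t (nth ts 0) ≡ true → has E t ≡ westEnd true ts
    link [] ea = eqB-sound (has E t) true ea
    link (t′ ∷ _) ea = eqB-sound (has E t) (has W t′) ea
  ...   | fit = ∧-join fit fs , sym (hasOut (sides e t _ v fit)) ,
                λ { zero refl → hasN (sides e t _ v fit) ; (suc j) eq → north j eq }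

  rowOK-fits : ∀ {n} r (ts : Vec Tile (suc n)) c vs → RowOK r (isW r) ts → Souths ts vs →
    rowFits r ts (just c) vs ≡ true × is-just (proj₁ (rowFlow r ts (just c) vs)) ≡ false × Norths ts (proj₂ (rowFlow r ts (just c) vs))
  rowOK-fits w ts c vs ok so with rowOK-fits-w true ts (just c) vs ok refl so
  ... | fs , end , north = fs , trans end (eastEnd-rowOK w true ts ok) , north
  rowOK-fits e ts@(t ∷ _) c vs ok so with rowOK-fits-e false ts (just c) vs ok refl so
  ... | fs , end , north = fs , trans end (proj₁ (proj₂ (ok 0 refl)) refl) , north

  -- Colours propagate upwards from the empty South boundary; the second component says that
  -- occupied northern edges are the coloured ones, which the next row needs. Any colours will do,
  -- but the width must be positive: a row without tiles cannot record its boundary conditions.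
  locallyOK⇒gridFits : ∀ {m n} (β : Vec RowType m) cs (D : Grid m (suc n)) → LocallyOK β D →
    gridFits β cs D ≡ true × (∀ j {t} → tileAt D 0 j ≡ just t → has N t ≡ is-just (at (gridFlow β cs D) j))
  locallyOK⇒gridFits [] [] [] ok = refl , λ _ ()
  locallyOK⇒gridFits {n = n} (r ∷ β) (c ∷ cs) (ts ∷ D) ok with locallyOK⇒gridFits β cs D
    (λ i j {r′} {t} rᵢ tᵢⱼ → subst₂ (λ x y → allowed r′ t ∧ westSpec r′ t j ∧ eastSpec r′ t x ∧ southSpec t y ≡ true)
       (tileAt-suc ts D i (suc j)) (tileAt-suc ts D (suc i) j) (ok (suc i) j rᵢ (trans (tileAt-suc ts D i j) tᵢⱼ)))
  ... | gf , north with rowOK-fits r ts c (gridFlow β cs D) rowOK souths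
    where
    parts : ∀ j {t} → nth ts j ≡ just t → allowed r t ≡ true × westSpec r t j ≡ true × eastSpec r t (nth ts (suc j)) ≡ true × southSpec t (tileAt (ts ∷ D) 1 j) ≡ true
    parts j {t} eq with ∧-split (allowed r t) (ok 0 j refl eq)
    ... | al , p with ∧-split (westSpec r t j) p
    ...   | we , q with ∧-split (eastSpec r t (nth ts (suc j))) q
    ...     | ea , so = al , we , ea , so
    rowOK : RowOK r (isW r) ts
    rowOK j {t} eq with parts j eq
    ... | al , we , ea , so = al , (λ { refl → eqB-sound (has W t) (isW r) we }) , ea
    souths : Souths ts (gridFlow β cs D)
    souths j {t} eq with tileAt D 0 j in below
    ... | just t′ = trans (eqB-sound (has S t) (has N t′) (subst (λ x → southSpec t x ≡ true) (trans (tileAt-suc ts D 0 j) below) (proj₂ (proj₂ (proj₂ (parts j eq)))))) (north j below)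
    ... | nothing = trans (eqB-sound (has S t) false (subst (λ x → southSpec t x ≡ true) (trans (tileAt-suc ts D 0 j) below) (proj₂ (proj₂ (proj₂ (parts j eq))))))
                          (sym (cong is-just (bottom β cs D below)))
      where
      bottom : ∀ {m} (β : Vec RowType m) cs (D : Grid m _) → tileAt D 0 j ≡ nothing → at (gridFlow β cs D) j ≡ nothing
      bottom [] [] [] _ = at-none (suc n) j
      bottom (_ ∷ _) (_ ∷ _) (ts′ ∷ _) eq′ with () ← trans (sym eq′) (proj₂ (<-nth ts′ (nth-< ts j eq)))
  ...   | fs , end , no′ = ∧-join gf (∧-join fs (cong not end)) , no′

bool-ext : ∀ {a b} → (a ≡ true → b ≡ true) → (b ≡ true → a ≡ true) → a ≡ b
bool-ext {true} {true} _ _ = refl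
bool-ext {false} {false} _ _ = refl
bool-ext {true} {false} f _ = sym (f refl)
bool-ext {false} {true} _ g = g refl

does-sound : ∀ {p} {P : Set p} (d : Dec P) → does d ≡ true → P
does-sound (yes p) _ = p

-- Conservation of colours

module Occurrences (n : ℕ) where
  open Colours (Fin n)
  open ExitWords n
  open DecMembership (FinP._≟_ {n}) using (_∈?_)

  module _ (b : Fin n) where
    occ : Edge → ℕ
    occ v = if does (v ≟E just b) then 1 else 0

    occs : ∀ {k} → Vec Edge k → ℕ
    occs [] = 0
    occs (v ∷ vs) = occ v ℕ.+ occs vs

    flow-occ : ∀ t h v → occ (proj₁ (flow t h v)) ℕ.+ occ (proj₂ (flow t h v)) ≡ occ h ℕ.+ occ v
    flow-occ t h v with isElbow t
    ... | true = ℕP.+-comm (occ v) (occ h)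
    ... | false = refl

    row-occ : ∀ {k} r (ts : Vec Tile k) h vs →
      occ (proj₁ (rowFlow r ts h vs)) ℕ.+ occs (proj₂ (rowFlow r ts h vs)) ≡ occ h ℕ.+ occs vs
    row-occ r [] h [] = refl
    row-occ w (t ∷ ts) h (v ∷ vs) = begin
      occ h₂ ℕ.+ (occ v₁ ℕ.+ occs vs₂)  ≡⟨ x∙yz≈y∙xz (occ h₂) (occ v₁) (occs vs₂) ⟩
      occ v₁ ℕ.+ (occ h₂ ℕ.+ occs vs₂)  ≡⟨ cong (occ v₁ ℕ.+_) (row-occ w ts h₁ vs) ⟩
      occ v₁ ℕ.+ (occ h₁ ℕ.+ occs vs)   ≡⟨ sym (ℕP.+-assoc (occ v₁) (occ h₁) (occs vs)) ⟩
      occ v₁ ℕ.+ occ h₁ ℕ.+ occs vs     ≡⟨ cong (ℕ._+ occs vs) (trans (ℕP.+-comm (occ v₁) (occ h₁)) (flow-occ t h v)) ⟩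
      occ h ℕ.+ occ v ℕ.+ occs vs       ≡⟨ ℕP.+-assoc (occ h) (occ v) (occs vs) ⟩
      occ h ℕ.+ (occ v ℕ.+ occs vs)     ∎
      where
      open ≡-Reasoning
      open import Algebra.Properties.CommutativeSemigroup ℕP.+-commutativeSemigroup using (x∙yz≈y∙xz)
      h₁ = proj₁ (flow t h v)
      v₁ = proj₂ (flow t h v)
      h₂ = proj₁ (rowFlow w ts h₁ vs)
      vs₂ = proj₂ (rowFlow w ts h₁ vs)
    row-occ e (t ∷ ts) h (v ∷ vs) = begin
      occ h₂ ℕ.+ (occ v₂ ℕ.+ occs vs₁)  ≡⟨ sym (ℕP.+-assoc (occ h₂) (occ v₂) (occs vs₁)) ⟩
      occ h₂ ℕ.+ occ v₂ ℕ.+ occs vs₁    ≡⟨ cong (ℕ._+ occs vs₁) (trans (flow-occ t h₁ v) (ℕP.+-comm (occ h₁) (occ v))) ⟩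
      occ v ℕ.+ occ h₁ ℕ.+ occs vs₁     ≡⟨ ℕP.+-assoc (occ v) (occ h₁) (occs vs₁) ⟩
      occ v ℕ.+ (occ h₁ ℕ.+ occs vs₁)   ≡⟨ cong (occ v ℕ.+_) (row-occ e ts h vs) ⟩
      occ v ℕ.+ (occ h ℕ.+ occs vs)     ≡⟨ x∙yz≈y∙xz (occ v) (occ h) (occs vs) ⟩
      occ h ℕ.+ (occ v ℕ.+ occs vs)     ∎
      where
      open ≡-Reasoning
      open import Algebra.Properties.CommutativeSemigroup ℕP.+-commutativeSemigroup using (x∙yz≈y∙xz)
      h₁ = proj₁ (rowFlow e ts h vs)
      vs₁ = proj₂ (rowFlow e ts h vs)
      h₂ = proj₁ (flow t h₁ v)
      v₂ = proj₂ (flow t h₁ v)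

    occs-none : ∀ k → occs (Vec.replicate k nothing) ≡ 0
    occs-none zero = refl
    occs-none (suc k) = occs-none k

    -- Each row brings in its own colour, and since its far end is empty, all colours continue to
    -- the North.
    grid-occ : ∀ {m k} (β : Vec RowType m) cs (D : Grid m k) → gridFits β cs D ≡ true →
               occs (gridFlow β cs D) ≡ occs (Vec.map just cs)
    grid-occ {k = k} [] [] [] ok = occs-none k
    grid-occ (r ∷ β) (c ∷ cs) (ts ∷ D) ok with ∧-split (gridFits β cs D) ok
    ... | okD , ok′ = begin
      occs (proj₂ out)                          ≡⟨ sym (cong (λ h → occ h ℕ.+ occs (proj₂ out)) exits) ⟩
      occ (proj₁ out) ℕ.+ occs (proj₂ out)      ≡⟨ row-occ r ts (just c) (gridFlow β cs D) ⟩
      occ (just c) ℕ.+ occs (gridFlow β cs D)   ≡⟨ cong (occ (just c) ℕ.+_) (grid-occ β cs D okD) ⟩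
      occ (just c) ℕ.+ occs (Vec.map just cs)   ∎
      where
      open ≡-Reasoning
      out = rowFlow r ts (just c) (gridFlow β cs D)
      exits : proj₁ out ≡ nothing
      exits = isNothing-sound _ (proj₂ (∧-split (rowFits r ts (just c) (gridFlow β cs D)) ok′))

    occ-self : occ (just b) ≡ 1
    occ-self with b FinP.≟ b
    ... | yes _ = refl
    ... | no b≢b = contradiction refl b≢b

    occs-lookup : ∀ {k} (vs : Vec Edge k) i → Vec.lookup vs i ≡ just b → 1 ≤ occs vs
    occs-lookup (v ∷ vs) zero refl rewrite occ-self = s≤s z≤n
    occs-lookup (v ∷ vs) (suc i) eq = ℕP.≤-trans (occs-lookup vs i eq) (ℕP.m≤n+m _ (occ v))

    occs-twice : ∀ {k} (vs : Vec Edge k) i j → i ≢ j → Vec.lookup vs i ≡ just b → Vec.lookup vs j ≡ just b → 2 ≤ occs vs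
    occs-twice (v ∷ vs) zero zero i≢j _ _ = contradiction refl i≢j
    occs-twice (v ∷ vs) zero (suc j) _ refl eq rewrite occ-self = s≤s (occs-lookup vs j eq)
    occs-twice (v ∷ vs) (suc i) zero _ eq refl rewrite occ-self = s≤s (occs-lookup vs i eq)
    occs-twice (v ∷ vs) (suc i) (suc j) i≢j eq eq′ =
      ℕP.≤-trans (occs-twice vs i j (i≢j ∘ cong suc) eq eq′) (ℕP.m≤n+m _ (occ v))

    occs-found : ∀ {k} (cs : Vec (Fin n) k) → 1 ≤ occs (Vec.map just cs) → ∃ λ i → Vec.lookup cs i ≡ b
    occs-found (c ∷ cs) pos with c FinP.≟ b
    ... | yes eq = zero , eq
    ... | no _ with occs-found cs pos
    ...   | i , eq = suc i , eq

    occs-injective : ∀ {k} (cs : Vec (Fin n) k) → (∀ {i j} → Vec.lookup cs i ≡ Vec.lookup cs j → i ≡ j) →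
                     occs (Vec.map just cs) ≤ 1
    occs-injective [] _ = z≤n
    occs-injective (c ∷ cs) inj with c FinP.≟ b
    ... | no _ = occs-injective cs (FinP.suc-injective ∘ inj)
    ... | yes refl with occs (Vec.map just cs) in eq
    ...   | zero = s≤s z≤n
    ...   | suc _ with occs-found cs (subst (1 ≤_) (sym eq) (s≤s z≤n))
    ...     | i , eq′ with () ← inj {zero} {suc i} (sym eq′)

  -- A colour b in a column outside `ds` would be a second occurrence of b, next to the one in
  -- column b itself; but the entering colours are distinct.
  gridFlow-word : ∀ {m} (β : Vec RowType m) cs (D : Grid m n) ds → gridFits β cs D ≡ true →
    (∀ {i j} → Vec.lookup cs i ≡ Vec.lookup cs j → i ≡ j) →
    (∀ i → Vec.lookup cs i ∈ ds) → (∀ {j} → j ∈ ds → Vec.lookup (gridFlow β cs D) j ≡ just j) →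
    word ds ≡ gridFlow β cs D
  gridFlow-word β cs D ds ok inj cs⊆ds hits = lookup-ext same
    where
    same : ∀ j → Vec.lookup (word ds) j ≡ Vec.lookup (gridFlow β cs D) j
    same j with j ∈? ds
    ... | yes j∈ds = trans (lookup-word-∈ ds j∈ds) (sym (hits j∈ds))
    ... | no j∉ds = trans (lookup-word-∉ ds j∉ds) (sym empty)
      where
      empty : Vec.lookup (gridFlow β cs D) j ≡ nothing
      empty with Vec.lookup (gridFlow β cs D) j in at-j
      ... | nothing = refl
      ... | just b with occs-found b cs (subst (1 ≤_) (grid-occ b β cs D ok) (occs-lookup b (gridFlow β cs D) j at-j))
      ...   | i , refl = contradiction
                (ℕP.≤-trans (subst (2 ≤_) (grid-occ b β cs D ok)
                   (occs-twice b (gridFlow β cs D) j b (λ { refl → j∉ds (cs⊆ds i) }) at-j (hits (cs⊆ds i))))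
                   (occs-injective b cs inj)) (ℕP.<⇒≱ (s≤s (s≤s z≤n)))

-- The counterclockwise numbering of the pipes

private
  filter-cong-map : ∀ {I J : Set} (p : J → Bool) (q : I → Bool) (f : I → J) → (∀ i → p (f i) ≡ q i) → ∀ xs →
    filter (λ y → p y Bool.≟ true) (map f xs) ≡ map f (filter (λ x → q x Bool.≟ true) xs)
  filter-cong-map p q f eq [] = refl
  filter-cong-map p q f eq (x ∷ xs) rewrite eq x with q x
  ... | true = cong (f x ∷_) (filter-cong-map p q f eq xs)
  ... | false = filter-cong-map p q f eq xs

  rowsOf : ∀ {m} → (RowType → Bool) → Vec RowType m → List (Fin m)
  rowsOf p β = filter (λ r → p (Vec.lookup β r) Bool.≟ true) (allFin _)

  rowsOf-∷ : ∀ {m} p r (β : Vec RowType m) → rowsOf p (r ∷ β) ≡ (if p r then zero ∷ map suc (rowsOf p β) else map suc (rowsOf p β))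
  rowsOf-∷ {m} p r β = by-cases
    where
    later : filter (λ s → p (Vec.lookup (r ∷ β) s) Bool.≟ true) (List.tabulate suc) ≡ map suc (rowsOf p β)
    later = trans (cong (filter _) (sym (ListP.map-tabulate id suc)))
                  (filter-cong-map (p ∘ Vec.lookup (r ∷ β)) (p ∘ Vec.lookup β) suc (λ _ → refl) (allFin m))
    by-cases : rowsOf p (r ∷ β) ≡ (if p r then zero ∷ map suc (rowsOf p β) else map suc (rowsOf p β))
    by-cases with p r
    ... | true = cong (zero ∷_) later
    ... | false = later

pipeRows-w : ∀ {m} (β : Vec RowType m) → pipeRows (w ∷ β) ≡ zero ∷ map suc (pipeRows β)
pipeRows-w β = trans (cong₂ (λ xs ys → xs ++ reverse ys) (rowsOf-∷ isW w β) (rowsOf-∷ isE w β))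
  (cong (zero ∷_) (trans (cong (map suc (rowsOf isW β) ++_) (sym (ListP.reverse-map suc (rowsOf isE β))))
    (sym (ListP.map-++ suc (rowsOf isW β) _))))

pipeRows-e : ∀ {m} (β : Vec RowType m) → pipeRows (e ∷ β) ≡ map suc (pipeRows β) ++ zero ∷ []
pipeRows-e β = trans (cong₂ (λ xs ys → xs ++ reverse ys) (rowsOf-∷ isW e β) (rowsOf-∷ isE e β))
  (trans (cong (map suc (rowsOf isW β) ++_) (trans (ListP.unfold-reverse zero (map suc (rowsOf isE β)))
            (cong (_++ zero ∷ []) (sym (ListP.reverse-map suc (rowsOf isE β))))))
  (trans (sym (ListP.++-assoc (map suc (rowsOf isW β)) _ _))
         (cong (_++ zero ∷ []) (sym (ListP.map-++ suc (rowsOf isW β) _)))))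

private
  zip-map : ∀ {I J K : Set} (f : J → K) (xs : List I) ys → zip xs (map f ys) ≡ map (λ (x , y) → x , f y) (zip xs ys)
  zip-map f [] ys = refl
  zip-map f (x ∷ xs) [] = refl
  zip-map f (x ∷ xs) (y ∷ ys) = cong ((x , f y) ∷_) (zip-map f xs ys)

  zip-∷ʳ : ∀ {I J : Set} (xs : List I) (ys : List J) {x y} → length xs ≡ length ys →
           zip (xs ++ x ∷ []) (ys ++ y ∷ []) ≡ zip xs ys ++ (x , y) ∷ []
  zip-∷ʳ [] [] eq = refl
  zip-∷ʳ (x ∷ xs) (y ∷ ys) eq = cong ((x , y) ∷_) (zip-∷ʳ xs ys (ℕP.suc-injective eq))

  length-pipeRows : ∀ {m} (β : Vec RowType m) → length (pipeRows β) ≡ m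
  length-pipeRows [] = refl
  length-pipeRows (w ∷ β) = trans (cong length (pipeRows-w β)) $ cong suc (trans (ListP.length-map suc (pipeRows β)) (length-pipeRows β))
  length-pipeRows (e ∷ β) = trans (cong length (pipeRows-e β)) $ trans (ListP.length-++ (map suc (pipeRows β)))
    (trans (ℕP.+-comm _ 1) (cong suc (trans (ListP.length-map suc (pipeRows β)) (length-pipeRows β))))

-- The top row takes the first remaining pipe if it is of type w and the last one if of type e.
-- Since `pipes` runs through the pipes and φ through the rows, the two lists agree only up to
-- permutation.
numbering : ∀ {P : Set} {m} (β : Vec RowType m) (ps : List P) → length ps ≡ m → ∃ λ (φ : Vec P m) →
  Numbering (Vec.toList β) ps (Vec.toList (Vec.zip β φ)) ×
  zip ps (pipeRows β) ↭ List.tabulate (λ r → Vec.lookup φ r , r)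
numbering [] [] eq = [] , [] , Perm.refl
numbering (w ∷ β) (p ∷ ps) eq with numbering β ps (ℕP.suc-injective eq)
... | φ , num , perm = p ∷ φ , w∷ num , ↭-trans (↭-reflexive unfolded) (prep (p , zero) (↭-trans (map⁺ _ perm) (↭-reflexive (ListP.map-tabulate _ _))))
  where
  unfolded : zip (p ∷ ps) (pipeRows (w ∷ β)) ≡ (p , zero) ∷ map (λ (x , y) → x , suc y) (zip ps (pipeRows β))
  unfolded = trans (cong (zip (p ∷ ps)) (pipeRows-w β)) $ cong ((p , zero) ∷_) (zip-map suc ps (pipeRows β))
numbering (e ∷ β) ps eq with initLast ps
numbering (e ∷ β) .(ps ++ p ∷ []) eq | ps ∷ʳ′ p with numbering β ps len
  where
  len : length ps ≡ _
  len = ℕP.suc-injective (trans (sym (trans (ListP.length-++ ps) (ℕP.+-comm (length ps) 1))) eq)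
... | φ , num , perm = p ∷ φ , e∷ num ,
  ↭-trans (↭-reflexive unfolded) (↭-trans (++-comm (map (λ (x , y) → x , suc y) (zip ps (pipeRows β))) _)
    (prep (p , zero) (↭-trans (map⁺ _ perm) (↭-reflexive (ListP.map-tabulate _ _)))))
  where
  len : length ps ≡ length (map suc (pipeRows β))
  len = trans (ℕP.suc-injective (trans (sym (trans (ListP.length-++ ps) (ℕP.+-comm (length ps) 1))) eq))
              (sym (trans (ListP.length-map suc (pipeRows β)) (length-pipeRows β)))
  unfolded : zip (ps ++ p ∷ []) (pipeRows (e ∷ β)) ≡ map (λ (x , y) → x , suc y) (zip ps (pipeRows β)) ++ (p , zero) ∷ []
  unfolded = trans (cong (zip (ps ++ p ∷ [])) (pipeRows-e β)) $ trans (zip-∷ʳ ps (map suc (pipeRows β)) len) (cong (_++ (p , zero) ∷ []) (zip-map suc ps (pipeRows β)))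

private
  zip-∈ˡ : ∀ {I J : Set} {xs : List I} {ys : List J} {x y} → (x , y) ∈ zip xs ys → x ∈ xs
  zip-∈ˡ {xs = _ ∷ _} {_ ∷ _} (here refl) = here refl
  zip-∈ˡ {xs = _ ∷ _} {_ ∷ _} (there p) = there (zip-∈ˡ p)

  zip-functional : ∀ {I J : Set} {xs : List I} {ys : List J} {x y y′} → Unique xs →
                   (x , y) ∈ zip xs ys → (x , y′) ∈ zip xs ys → y ≡ y′
  zip-functional {xs = _ ∷ _} {_ ∷ _} _ (here refl) (here refl) = refl
  zip-functional {xs = _ ∷ _} {_ ∷ _} (x∉ ∷ _) (here refl) (there q) = contradiction refl (All.lookup x∉ (zip-∈ˡ q))
  zip-functional {xs = _ ∷ _} {_ ∷ _} (x∉ ∷ _) (there p) (here refl) = contradiction refl (All.lookup x∉ (zip-∈ˡ p))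
  zip-functional {xs = _ ∷ _} {_ ∷ _} (_ ∷ u) (there p) (there q) = zip-functional u p q

  zip-∈ : ∀ {I J : Set} {xs : List I} {ys : List J} {x} → length xs ≡ length ys → x ∈ xs → ∃ λ y → (x , y) ∈ zip xs ys
  zip-∈ {xs = _ ∷ _} {y ∷ _} eq (here refl) = y , here refl
  zip-∈ {xs = _ ∷ _} {_ ∷ _} eq (there p) with zip-∈ (ℕP.suc-injective eq) p
  ... | y , q = y , there q

-- Pipe dreams as colourings with a prescribed northern word

module _ {m : ℕ} (β : Vec RowType m) {φ : Vec (Fin m) m} (perm : pipes β ↭ List.tabulate (λ r → Vec.lookup φ r , r)) where

  pipe-of-row : ∀ r → (Vec.lookup φ r , r) ∈ pipes β
  pipe-of-row r = ∈-resp-↭ (↭-sym perm) (∈-tabulate⁺ r)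

  row-of-pipe : ∀ {p r} → (p , r) ∈ pipes β → p ≡ Vec.lookup φ r
  row-of-pipe p∈ with ∈-tabulate⁻ (∈-resp-↭ perm p∈)
  ... | _ , refl = refl

  φ-injective : ∀ {r r′} → Vec.lookup φ r ≡ Vec.lookup φ r′ → r ≡ r′
  φ-injective {r} {r′} eq = zip-functional (allFin⁺ m) (pipe-of-row r)
    (subst (λ p → (p , r′) ∈ pipes β) (sym eq) (pipe-of-row r′))

  φ-surjective : ∀ p → ∃ λ r → Vec.lookup φ r ≡ p
  φ-surjective p with zip-∈ (trans (ListP.length-tabulate id) (sym (length-pipeRows β))) (∈-allFin p)
  ... | r , p∈ = r , sym (row-of-pipe p∈)

  module _ {n} (π : Fin m → Fin (suc n)) (π-inj : Injective _≡_ _≡_ π) where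
    open Colours (Fin (suc n))
    open Consistency (Fin (suc n))
    open ExitWords (suc n)
    open Occurrences (suc n) using (gridFlow-word)

    private
      ρ : Inj m (suc n)
      ρ = π , π-inj

    colours : Vec (Fin (suc n)) m
    colours = Vec.map π φ

    exits : List (Fin (suc n))
    exits = map π (allFin m)

    private
      lookup-colours : ∀ r → Vec.lookup colours r ≡ π (Vec.lookup φ r)
      lookup-colours r = VecP.lookup-map r π φ

    module _ (D : Grid m (suc n)) where
      private
        eqMaybe-sound : ∀ x k → eqMaybe x k ≡ true → x ≡ just k
        eqMaybe-sound (just a) k eq = cong just (does-sound (a ℕP.≟ k) eq)

        eqMaybe-refl : ∀ k → eqMaybe (just k) k ≡ true
        eqMaybe-refl k = dec-true (k ℕP.≟ k) refl

      Connected : Set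
      Connected = ∀ r → tracePipe β D r ≡ just (toℕ (π (Vec.lookup φ r)))

      connected : connectivityIs β ρ D ≡ true → Connected
      connected eq r = eqMaybe-sound _ _ (allB-sound _ (pipes β) eq (pipe-of-row r))

      connectivity : Connected → connectivityIs β ρ D ≡ true
      connectivity con = allB-complete _ (pipes β) λ {(p , r)} p∈ →
        subst (λ x → eqMaybe x (toℕ (π p)) ≡ true)
          (sym (trans (con r) (cong (λ q → just (toℕ (π q))) (sym (row-of-pipe p∈))))) (eqMaybe-refl (toℕ (π p)))

      private
        fuel : ∀ (r : Fin m) → toℕ r ℕ.* suc n ℕ.+ n < suc (4 ℕ.* m ℕ.* suc n)
        -- The measure of `follow` stays below the number of tiles, a quarter of the fuel provided.
        fuel r = s≤s (begin
          toℕ r ℕ.* suc n ℕ.+ n      ≤⟨ ℕP.+-monoʳ-≤ (toℕ r ℕ.* suc n) (ℕP.n≤1+n n) ⟩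
          toℕ r ℕ.* suc n ℕ.+ suc n  ≡⟨ ℕP.+-comm (toℕ r ℕ.* suc n) (suc n) ⟩
          suc (toℕ r) ℕ.* suc n      ≤⟨ ℕP.*-monoˡ-≤ (suc n) (FinP.toℕ<n r) ⟩
          m ℕ.* suc n                ≤⟨ ℕP.*-monoˡ-≤ (suc n) (ℕP.m≤m+n m _) ⟩
          4 ℕ.* m ℕ.* suc n          ∎)
          where open ℕP.≤-Reasoning

      module _ (ok : gridFits β colours D ≡ true) where
        open Tracing β colours D ok

        traced : ∀ r → ∃ λ c → vertical β colours D 0 c ≡ just (Vec.lookup colours r) × tracePipe β D r ≡ just c
        traced r with Vec.lookup β r in eq
        ... | w = follow (suc (4 ℕ.* m ℕ.* suc n)) (toℕ r) 0 n r-type (tileAt-lookup D r zero)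
                    (horizontally (horizontal-entry β colours D (toℕ r) r-type (nth-lookup colours r))) refl (fuel r)
          where r-type = trans (nth-lookup β r) (cong just eq)
        ... | e with <-tileAt D (FinP.toℕ<n r) (ℕP.n<1+n n)
        ...   | t , tᵣₙ = follow (suc (4 ℕ.* m ℕ.* suc n)) (toℕ r) n n r-type tᵣₙ
                    (horizontally (horizontal-entry β colours D (toℕ r) r-type (nth-lookup colours r))) refl (fuel r)
          where r-type = trans (nth-lookup β r) (cong just eq)

        private
          hit : ∀ {j a} → at (gridFlow β colours D) (toℕ j) ≡ just a → Vec.lookup (gridFlow β colours D) j ≡ just a
          hit {j} eq = trans (sym (at-lookup (gridFlow β colours D) j)) eq

        -- A traced pipe ends in a column showing its colour, and connectivity says that this column
        -- is the colour. So every exit column shows its own index, and conservation leaves the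
        -- others empty.
        connected⇒word : Connected → word exits ≡ gridFlow β colours D
        connected⇒word con = gridFlow-word β colours D exits ok
          (λ {i} {j} eq → φ-injective (π-inj (trans (sym (lookup-colours i)) (trans eq (lookup-colours j)))))
          (λ i → subst (_∈ exits) (sym (lookup-colours i)) (∈-map⁺ π (∈-allFin (Vec.lookup φ i))))
          hits
          where
          hits : ∀ {j} → j ∈ exits → Vec.lookup (gridFlow β colours D) j ≡ just j
          hits j∈ with ∈-map⁻ π j∈
          ... | p , _ , refl with φ-surjective p
          ...   | r , refl with traced r
          ...     | c , at-c , tr with trans (sym tr) (con r)
          ...       | refl = trans (hit at-c) (cong just (lookup-colours r))

        -- In a `word` a column can only show its own index, so a pipe arrives in the column named
        -- by its colour.
        word⇒connected : word exits ≡ gridFlow β colours D → Connected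
        word⇒connected eq r with traced r
        ... | c , at-c , tr with at-just (gridFlow β colours D) c at-c
        ...   | j , refl , at-j = trans tr (cong (λ x → just (toℕ x))
                  (trans (lookup-word-just {exits} (trans (cong (λ v → Vec.lookup v j) eq) at-j)) (lookup-colours r)))

      -- The local conditions amount to `gridFits` for any colours; choosing π∘φ turns the remaining
      -- connectivity into a test of the northern word, which can be used as a continuation.
      isPipeDream-flow : isPipeDream β ρ D ≡
        gridFits β colours D ∧ does (VecP.≡-dec _≟E_ (word exits) (gridFlow β colours D))
      isPipeDream-flow = bool-ext to from
        where
        to : isPipeDream β ρ D ≡ true → _
        to eq with ∧-split (tilesAllowed β D) eq
        ... | al , eq′ with ∧-split (consistent β D) eq′
        ...   | con , eq″ with proj₁ (locallyOK⇒gridFits β colours D (consistent⇒locallyOK β D al con))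
        ...     | ok = ∧-join ok (dec-true (VecP.≡-dec _≟E_ _ _) (connected⇒word ok (connected eq″)))
        from : _ → isPipeDream β ρ D ≡ true
        from eq with ∧-split (gridFits β colours D) eq
        ... | ok , eq′ = ∧-join (proj₁ lc) (∧-join (proj₂ lc)
              (connectivity (word⇒connected ok (does-sound (VecP.≡-dec _≟E_ (word exits) (gridFlow β colours D)) eq′))))
          where lc = locallyOK⇒consistent β D (gridFits⇒locallyOK β colours D ok)

-- Sums over fillings

module GridSums {ℓ₁ ℓ₂} (R : CommutativeRing ℓ₁ ℓ₂) (𝐀 𝐁 : CommutativeRing.Carrier R) (C : Set) where

  open CommutativeRing R renaming (refl to ≈-refl; sym to ≈-sym; trans to ≈-trans) hiding (zero)
  open import Relation.Binary.Reasoning.Setoid setoid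
  open import Algebra.Properties.CommutativeSemigroup +-commutativeSemigroup using () renaming (interchange to +-interchange)
  open Transfer R 𝐀 𝐁 C
  open Colours C hiding (Edge)
  open Linear

  ∑ : ∀ {I : Set} → List I → (I → Carrier) → Carrier
  ∑ [] f = 0#
  ∑ (i ∷ is) f = f i + ∑ is f

  ∑-cong : ∀ {I : Set} (is : List I) {f g} → (∀ i → f i ≈ g i) → ∑ is f ≈ ∑ is g
  ∑-cong [] eq = ≈-refl
  ∑-cong (i ∷ is) eq = +-cong (eq i) (∑-cong is eq)

  ∑-zero : ∀ {I : Set} (is : List I) → ∑ is (λ _ → 0#) ≈ 0#
  ∑-zero [] = ≈-refl
  ∑-zero (i ∷ is) = ≈-trans (+-identityˡ _) (∑-zero is)

  ∑-+ : ∀ {I : Set} (is : List I) f g → ∑ is (λ i → f i + g i) ≈ ∑ is f + ∑ is g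
  ∑-+ [] f g = ≈-sym (+-identityˡ 0#)
  ∑-+ (i ∷ is) f g = ≈-trans (+-congˡ (∑-+ is f g)) (+-interchange _ _ _ _)

  ∑-* : ∀ {I : Set} (is : List I) a f → ∑ is (λ i → a * f i) ≈ a * ∑ is f
  ∑-* [] a f = ≈-sym (zeroʳ a)
  ∑-* (i ∷ is) a f = ≈-trans (+-congˡ (∑-* is a f)) (≈-sym (distribˡ a _ _))

  ∑-++ : ∀ {I : Set} (is js : List I) f → ∑ (is ++ js) f ≈ ∑ is f + ∑ js f
  ∑-++ [] js f = ≈-sym (+-identityˡ _)
  ∑-++ (i ∷ is) js f = ≈-trans (+-congˡ (∑-++ is js f)) (≈-sym (+-assoc _ _ _))

  ∑-map : ∀ {I J : Set} (h : I → J) is f → ∑ (map h is) f ≈ ∑ is (λ i → f (h i))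
  ∑-map h [] f = ≈-refl
  ∑-map h (i ∷ is) f = +-congˡ (∑-map h is f)

  ∑-swap : ∀ {I J : Set} (is : List I) (js : List J) (f : I → J → Carrier) → ∑ is (λ i → ∑ js (f i)) ≈ ∑ js (λ j → ∑ is (λ i → f i j))
  ∑-swap [] js f = ≈-sym (∑-zero js)
  ∑-swap (i ∷ is) js f = ≈-trans (+-congˡ (∑-swap is js f)) (≈-sym (∑-+ js _ _))

  ∑-allVecs : ∀ {I : Set} (is : List I) k (f : Vec I (suc k) → Carrier) →
    ∑ (allVecs is (suc k)) f ≈ ∑ is (λ i → ∑ (allVecs is k) (λ v → f (i ∷ v)))
  ∑-allVecs is k f = go is
    where
    go : ∀ js → ∑ (concatMap (λ i → map (i ∷_) (allVecs is k)) js) f ≈ ∑ js (λ i → ∑ (allVecs is k) (λ v → f (i ∷ v)))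
    go [] = ≈-refl
    go (j ∷ js) = ≈-trans (∑-++ (map (j ∷_) (allVecs is k)) _ f) (+-cong (∑-map (j ∷_) (allVecs is k) f) (go js))

  when : Bool → Carrier → Carrier
  when b a = if b then a else 0#

  when-cong : ∀ b {x y} → x ≈ y → when b x ≈ when b y
  when-cong true eq = eq
  when-cong false eq = ≈-refl

  when-∧ : ∀ a b x → when (a ∧ b) x ≈ when a (when b x)
  when-∧ true b x = ≈-refl
  when-∧ false b x = ≈-refl

  when-* : ∀ b x y → when b (x * y) ≈ x * when b y
  when-* true x y = ≈-refl
  when-* false x y = ≈-sym (zeroʳ x)

  when-swap : ∀ a b x → when a (when b x) ≈ when b (when a x)
  when-swap true b x = ≈-refl
  when-swap false true x = ≈-refl
  when-swap false false x = ≈-refl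

  when-∑ : ∀ {I : Set} b (is : List I) f → when b (∑ is f) ≈ ∑ is (λ i → when b (f i))
  when-∑ true is f = ≈-refl
  when-∑ false is f = ≈-sym (∑-zero is)

  weightOf : RowType → Carrier → Carrier → Tile → Carrier
  weightOf r x y t = if isElbow t then 𝐂 else if isStraight t then straight r x y else empty-weight r x y

  private
    skip : ∀ {a b} → a ≈ b → a ≈ 0# + b
    skip eq = ≈-trans eq (≈-sym (+-identityˡ _))

    last : ∀ {a b} → 0# ≈ b → a ≈ a + b
    last eq = ≈-trans (≈-sym (+-identityʳ _)) (+-congˡ eq)

  -- The incoming colours leave one fitting tile if both edges are empty and two otherwise, a
  -- straight one and an elbow. Each `skip` discards a misfit, in the order of `allTiles`.
  tile-∑ : ∀ r x y h v k → tile r x y h v k ≈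
    ∑ allTiles (λ t → when (fits r t h v) (weightOf r x y t * k (proj₁ (flow t h v)) (proj₂ (flow t h v))))
  tile-∑ w x y nothing nothing k = last (skip (skip (skip (skip (skip (skip (skip (skip (skip ≈-refl)))))))))
  tile-∑ w x y (just _) nothing k = skip (+-congˡ (skip (skip (last (skip (skip (skip (skip (skip ≈-refl)))))))))
  tile-∑ w x y nothing (just _) k = skip (skip (+-congˡ (skip (skip (last (skip (skip (skip (skip ≈-refl)))))))))
  tile-∑ w x y (just _) (just _) k = skip (skip (skip (+-congˡ (skip (skip (last (skip (skip (skip ≈-refl)))))))))
  tile-∑ e x y nothing nothing k = last (skip (skip (skip (skip (skip (skip (skip (skip (skip ≈-refl)))))))))
  tile-∑ e x y (just _) nothing k = skip (+-congˡ (skip (skip (skip (skip (skip (last (skip (skip ≈-refl)))))))))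
  tile-∑ e x y nothing (just _) k = skip (skip (+-congˡ (skip (skip (skip (skip (skip (last (skip ≈-refl)))))))))
  tile-∑ e x y (just _) (just _) k = skip (skip (skip (+-congˡ (skip (skip (skip (skip (skip (last ≈-refl)))))))))

  rowWeight : ∀ {n} → RowType → Carrier → Vec Carrier n → Vec Tile n → Carrier
  rowWeight r x [] [] = 1#
  rowWeight r x (y ∷ ys) (t ∷ ts) = weightOf r x y t * rowWeight r x ys ts

  -- The list of tiles is abstract here, which keeps the sums from unfolding.
  row-∑-over : (Ts : List Tile) →
    (∀ r x y h v k → tile r x y h v k ≈
      ∑ Ts (λ t → when (fits r t h v) (weightOf r x y t * k (proj₁ (flow t h v)) (proj₂ (flow t h v))))) →
    ∀ {n} r x (ys : Vec Carrier n) h vs k → row r x ys h vs k ≈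
    ∑ (allVecs Ts n) (λ ts → when (rowFits r ts h vs) (rowWeight r x ys ts * k (proj₁ (rowFlow r ts h vs)) (proj₂ (rowFlow r ts h vs))))
  row-∑-over Ts expand = go
    where
    go : ∀ {n} r x (ys : Vec Carrier n) h vs k → row r x ys h vs k ≈
      ∑ (allVecs Ts n) (λ ts → when (rowFits r ts h vs) (rowWeight r x ys ts * k (proj₁ (rowFlow r ts h vs)) (proj₂ (rowFlow r ts h vs))))
    go r x [] h [] k = ≈-sym (≈-trans (+-identityʳ _) (*-identityˡ _))
    go {suc n} w x (y ∷ ys) h (v ∷ vs) k = begin
      tile w x y h v (λ h v → row w x ys h vs (λ h vs → k h (v ∷ vs)))
        ≈⟨ vertex-cong h v (λ h v → go w x ys h vs (λ h vs → k h (v ∷ vs))) ⟩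
      tile w x y h v (λ h v → ∑ Vs (inner h v))
        ≈⟨ expand w x y h v (λ h v → ∑ Vs (inner h v)) ⟩
      ∑ Ts (λ t → when (fits w t h v) (weightOf w x y t * ∑ Vs (inner (h₁ t) (v₁ t))))
        ≈⟨ ∑-cong Ts (λ t → ≈-trans (when-cong (fits w t h v) (≈-sym (∑-* Vs (weightOf w x y t) (inner (h₁ t) (v₁ t)))))
             (when-∑ (fits w t h v) Vs (λ ts → weightOf w x y t * inner (h₁ t) (v₁ t) ts))) ⟩
      ∑ Ts (λ t → ∑ Vs (λ ts → when (fits w t h v) (weightOf w x y t * inner (h₁ t) (v₁ t) ts)))
        ≈⟨ ∑-cong Ts (λ t → ∑-cong Vs (λ ts → merge (fits w t h v) (rowFits w ts (h₁ t) vs) _ _ _)) ⟩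
      ∑ Ts (λ t → ∑ Vs (λ ts → total (t ∷ ts)))
        ≈⟨ ≈-sym (∑-allVecs Ts n total) ⟩
      ∑ (allVecs Ts (suc n)) total ∎
      where
      Vs = allVecs Ts n
      h₁ v₁ : Tile → Edge
      h₁ t = proj₁ (flow t h v)
      v₁ t = proj₂ (flow t h v)
      inner : Edge → Edge → Vec Tile n → Carrier
      inner h v ts = when (rowFits w ts h vs) (rowWeight w x ys ts * k (proj₁ (rowFlow w ts h vs)) (v ∷ proj₂ (rowFlow w ts h vs)))
      total : Vec Tile (suc n) → Carrier
      total ts = when (rowFits w ts h (v ∷ vs)) (rowWeight w x (y ∷ ys) ts * k (proj₁ (rowFlow w ts h (v ∷ vs))) (proj₂ (rowFlow w ts h (v ∷ vs))))
      merge : ∀ a b p q z → when a (p * when b (q * z)) ≈ when (a ∧ b) (p * q * z)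
      merge a b p q z = ≈-trans (when-cong a (≈-trans (≈-sym (when-* b p (q * z))) (when-cong b (≈-sym (*-assoc p q z))))) (≈-sym (when-∧ a b _))
    go {suc n} e x (y ∷ ys) h (v ∷ vs) k = begin
      row e x ys h vs (λ h vs → tile e x y h v (λ h v → k h (v ∷ vs)))
        ≈⟨ resp (row-linear e x ys h vs) (λ h vs → expand e x y h v (λ h v → k h (v ∷ vs))) ⟩
      row e x ys h vs (λ h vs → ∑ Ts (inner h vs))
        ≈⟨ go e x ys h vs (λ h vs → ∑ Ts (inner h vs)) ⟩
      ∑ Vs (λ ts → when (rowFits e ts h vs) (rowWeight e x ys ts * ∑ Ts (inner (h₁ ts) (vs₁ ts))))
        ≈⟨ ∑-cong Vs (λ ts → ≈-trans (when-cong (rowFits e ts h vs) (≈-sym (∑-* Ts (rowWeight e x ys ts) (inner (h₁ ts) (vs₁ ts)))))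
             (when-∑ (rowFits e ts h vs) Ts (λ t → rowWeight e x ys ts * inner (h₁ ts) (vs₁ ts) t))) ⟩
      ∑ Vs (λ ts → ∑ Ts (λ t → when (rowFits e ts h vs) (rowWeight e x ys ts * inner (h₁ ts) (vs₁ ts) t)))
        ≈⟨ ∑-cong Vs (λ ts → ∑-cong Ts (λ t → merge (fits e t (h₁ ts) v) (rowFits e ts h vs) _ _ _)) ⟩
      ∑ Vs (λ ts → ∑ Ts (λ t → total (t ∷ ts)))
        -- An e row sums over its eastern columns first, whereas `allVecs` has the first column
        -- outermost.
        ≈⟨ ∑-swap Vs Ts (λ ts t → total (t ∷ ts)) ⟩
      ∑ Ts (λ t → ∑ Vs (λ ts → total (t ∷ ts)))
        ≈⟨ ≈-sym (∑-allVecs Ts n total) ⟩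
      ∑ (allVecs Ts (suc n)) total ∎
      where
      Vs = allVecs Ts n
      h₁ : Vec Tile n → Edge
      h₁ ts = proj₁ (rowFlow e ts h vs)
      vs₁ : Vec Tile n → Vec Edge n
      vs₁ ts = proj₂ (rowFlow e ts h vs)
      inner : Edge → Vec Edge n → Tile → Carrier
      inner h vs t = when (fits e t h v) (weightOf e x y t * k (proj₁ (flow t h v)) (proj₂ (flow t h v) ∷ vs))
      total : Vec Tile (suc n) → Carrier
      total ts = when (rowFits e ts h (v ∷ vs)) (rowWeight e x (y ∷ ys) ts * k (proj₁ (rowFlow e ts h (v ∷ vs))) (proj₂ (rowFlow e ts h (v ∷ vs))))
      merge : ∀ a b p q z → when b (q * when a (p * z)) ≈ when (a ∧ b) (p * q * z)
      merge a b p q z = ≈-trans (when-cong b (≈-trans (≈-sym (when-* a q (p * z)))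
          (when-cong a (≈-trans (≈-sym (*-assoc q p z)) (*-congʳ (*-comm q p))))))
        (≈-trans (when-swap b a _) (≈-sym (when-∧ a b _)))

  row-∑ : ∀ {n} r x (ys : Vec Carrier n) h vs k → row r x ys h vs k ≈
    ∑ (allVecs allTiles n) (λ ts → when (rowFits r ts h vs) (rowWeight r x ys ts * k (proj₁ (rowFlow r ts h vs)) (proj₂ (rowFlow r ts h vs))))
  row-∑ = row-∑-over allTiles tile-∑

  rowList : ∀ {m} → Vec RowType m → Vec Carrier m → Vec C m → List Row
  rowList [] [] [] = []
  rowList (r ∷ β) (x ∷ xs) (c ∷ cs) = (r , x , c) ∷ rowList β xs cs

  gridWeight : ∀ {m n} → Vec RowType m → Vec Carrier m → Vec Carrier n → Grid m n → Carrier
  gridWeight [] [] ys [] = 1#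
  gridWeight (r ∷ β) (x ∷ xs) ys (ts ∷ D) = rowWeight r x ys ts * gridWeight β xs ys D

  Z-∑ : ∀ {m n} (β : Vec RowType m) xs cs (ys : Vec Carrier n) k → Z ys (rowList β xs cs) k ≈
    ∑ (allGrids m n) (λ D → when (gridFits β cs D) (gridWeight β xs ys D * k (gridFlow β cs D)))
  Z-∑ [] [] [] ys k = ≈-sym (≈-trans (+-identityʳ _) (*-identityˡ _))
  Z-∑ {suc m} {n} (r ∷ β) (x ∷ xs) (c ∷ cs) ys k = begin
    Z ys (rowList β xs cs) (λ vs → row r x ys (just c) vs (close k))
      ≈⟨ Z-∑ β xs cs ys (λ vs → row r x ys (just c) vs (close k)) ⟩
    ∑ Ds (λ D → when (gridFits β cs D) (gridWeight β xs ys D * row r x ys (just c) (below D) (close k)))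
      ≈⟨ ∑-cong Ds (λ D → when-cong (gridFits β cs D) (*-congˡ (row-∑ r x ys (just c) (below D) (close k)))) ⟩
    ∑ Ds (λ D → when (gridFits β cs D) (gridWeight β xs ys D * ∑ Rs (inner (below D))))
      ≈⟨ ∑-cong Ds (λ D → ≈-trans (when-cong (gridFits β cs D) (≈-sym (∑-* Rs (gridWeight β xs ys D) (inner (below D)))))
           (when-∑ (gridFits β cs D) Rs (λ ts → gridWeight β xs ys D * inner (below D) ts))) ⟩
    ∑ Ds (λ D → ∑ Rs (λ ts → when (gridFits β cs D) (gridWeight β xs ys D * inner (below D) ts)))
      ≈⟨ ∑-cong Ds (λ D → ∑-cong Rs (λ ts → merge (gridFits β cs D) (rowFits r ts (just c) (below D)) _ _
           (proj₁ (rowFlow r ts (just c) (below D))) (proj₂ (rowFlow r ts (just c) (below D))))) ⟩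
    ∑ Ds (λ D → ∑ Rs (λ ts → total (ts ∷ D)))
      -- The operators act from the South, whereas `allGrids` has the northmost row outermost.
      ≈⟨ ∑-swap Ds Rs (λ D ts → total (ts ∷ D)) ⟩
    ∑ Rs (λ ts → ∑ Ds (λ D → total (ts ∷ D)))
      ≈⟨ ≈-sym (∑-allVecs Rs m total) ⟩
    ∑ (allGrids (suc m) n) total ∎
    where
    Ds = allGrids m n
    Rs = allVecs allTiles n
    below : Grid m n → Vec Edge n
    below D = gridFlow β cs D
    inner : Vec Edge n → Vec Tile n → Carrier
    inner vs ts = when (rowFits r ts (just c) vs) (rowWeight r x ys ts * close k (proj₁ (rowFlow r ts (just c) vs)) (proj₂ (rowFlow r ts (just c) vs)))
    total : Grid (suc m) n → Carrier
    total D = when (gridFits (r ∷ β) (c ∷ cs) D) (gridWeight (r ∷ β) (x ∷ xs) ys D * k (gridFlow (r ∷ β) (c ∷ cs) D))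
    close-when : ∀ h vs → close k h vs ≈ when (isNothing h) (k vs)
    close-when nothing vs = ≈-refl
    close-when (just _) vs = ≈-refl
    merge : ∀ a b p q h vs → when a (p * when b (q * close k h vs)) ≈ when (a ∧ b ∧ isNothing h) (q * p * k vs)
    merge a b p q h vs = begin
      when a (p * when b (q * close k h vs))
        ≈⟨ when-cong a (*-congˡ (when-cong b (≈-trans (*-congˡ (close-when h vs)) (≈-sym (when-* (isNothing h) q (k vs)))))) ⟩
      when a (p * when b (when (isNothing h) (q * k vs)))
        ≈⟨ when-cong a (*-congˡ (≈-sym (when-∧ b (isNothing h) _))) ⟩
      when a (p * when (b ∧ isNothing h) (q * k vs))
        ≈⟨ when-cong a (≈-trans (≈-sym (when-* (b ∧ isNothing h) p _)) (when-cong (b ∧ isNothing h)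
             (≈-trans (≈-sym (*-assoc p q _)) (*-congʳ (*-comm p q))))) ⟩
      when a (when (b ∧ isNothing h) (q * p * k vs))
        ≈⟨ ≈-sym (when-∧ a _ _) ⟩
      when (a ∧ b ∧ isNothing h) (q * p * k vs) ∎

-- The recursion and its uniqueness

-- The prefix and suffix are chosen before g, so the three lists of rows in the exchange relation
-- share them.
tabulate-adjacent : ∀ {ℓ} {I : Set ℓ} {m} (f : Fin m → I) (i j : Fin m) → toℕ j ≡ suc (toℕ i) →
  ∃₂ λ pre post → ∀ g → (∀ k → k ≢ i → k ≢ j → g k ≡ f k) → List.tabulate g ≡ pre ++ g i ∷ g j ∷ post
tabulate-adjacent f zero (suc zero) refl = [] , List.tabulate (λ k → f (suc (suc k))) , λ g off →
  cong (λ l → g zero ∷ g (suc zero) ∷ l) (ListP.tabulate-cong (λ k → off (suc (suc k)) (λ ()) (λ ())))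
tabulate-adjacent f (suc i) (suc j) eq with tabulate-adjacent (f ∘ suc) i j (ℕP.suc-injective eq)
... | pre , post , split = f zero ∷ pre , post , λ g off →
  cong₂ _∷_ (off zero (λ ()) (λ ()))
            (split (g ∘ suc) (λ k k≢i k≢j → off (suc k) (k≢i ∘ FinP.suc-injective) (k≢j ∘ FinP.suc-injective)))

module _ {ℓ₁ ℓ₂} (R : CommutativeRing ℓ₁ ℓ₂) where
  open CommutativeRing R renaming (refl to ≈-refl; sym to ≈-sym; trans to ≈-trans) hiding (zero)
  open import Relation.Binary.Reasoning.Setoid setoid
  open import Algebra.Properties.Group +-group using (x≈z//y)
  open import Algebra.Properties.AbelianGroup +-abelianGroup using (⁻¹-anti-homo‿-)

  -- Brings the exchange relation of two w rows into the shape of (b): z is G_π, z′ is G_π' and s is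
  -- r_i G_π'.
  solve-exchange : ∀ c p q s z z′ → (c - (q - p)) * s ≈ (q - p) * z + c * z′ →
                   (p - q) * z ≈ c * z′ - (c + p - q) * s
  solve-exchange c p q s z z′ exchange = x≈z//y _ _ _ (begin
    (p - q) * z + (c + p - q) * s               ≈⟨ +-congˡ (≈-trans (*-congʳ (≈-sym scalar)) exchange) ⟩
    (p - q) * z + ((q - p) * z + c * z′)        ≈⟨ ≈-sym (+-assoc _ _ _) ⟩
    (p - q) * z + (q - p) * z + c * z′          ≈⟨ +-congʳ (≈-sym (distribʳ z (p - q) (q - p))) ⟩
    ((p - q) + (q - p)) * z + c * z′            ≈⟨ +-congʳ (*-congʳ (≈-trans (+-congˡ (≈-sym (⁻¹-anti-homo‿- p q))) (-‿inverseʳ (p - q)))) ⟩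
    0# * z + c * z′                             ≈⟨ ≈-trans (+-congʳ (zeroˡ z)) (+-identityˡ _) ⟩
    c * z′ ∎)
    where
    scalar : c - (q - p) ≈ c + p - q
    scalar = ≈-trans (+-congˡ (⁻¹-anti-homo‿- q p)) (≈-sym (+-assoc c p (- q)))

-- Rules (a) and (b) for G

module Assembly (m n : ℕ) where

  open PolynomialRing {m} {suc n}
  open CommutativeRing polyRing renaming (refl to ≈-refl; sym to ≈-sym; trans to ≈-trans) hiding (zero)
  open import Relation.Binary.Reasoning.Setoid setoid
  open import Algebra.Properties.CommutativeSemigroup *-commutativeSemigroup using () renaming (x∙yz≈y∙xz to *-leftSwap)
  open Transfer polyRing A B (Fin (suc n))
  open GridSums polyRing A B (Fin (suc n))
  open Colours (Fin (suc n)) using (gridFlow; gridFits)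
  open ExitWords (suc n)
  open Words polyRing A B (suc n)

  private
    P : Set
    P = Poly m (suc n)

    ys : Vec P (suc n)
    ys = Vec.tabulate Y

  sumP-filter : ∀ {I : Set} (p : I → Bool) (f : I → P) is →
    sumP (map f (filter (λ i → p i Bool.≟ true) is)) ≈ ∑ is (λ i → when (p i) (f i))
  sumP-filter p f [] = ≈-refl
  sumP-filter p f (i ∷ is) with p i
  ... | true = +-congˡ {f i} (sumP-filter p f is)
  ... | false = ≈-trans (sumP-filter p f is) (≈-sym (+-identityˡ _))

  prodP-↭ : ∀ {I : Set} (f : I → P) {is js} → is ↭ js → prodP (map f is) ≈ prodP (map f js)
  prodP-↭ f Perm.refl = ≈-refl
  prodP-↭ f (Perm.prep i p) = *-congˡ {f i} (prodP-↭ f p)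
  prodP-↭ f (Perm.swap i j p) = ≈-trans (*-leftSwap (f i) (f j) _) (*-congˡ {f j} (*-congˡ {f i} (prodP-↭ f p)))
  prodP-↭ f (Perm.trans p q) = ≈-trans (prodP-↭ f p) (prodP-↭ f q)

  tileWeight-weightOf : ∀ r (p : Fin m) (j : Fin (suc n)) t → tileWeight r p j t ≡ weightOf r (X p) (Y j) t
  tileWeight-weightOf r p j t with isElbow t | isStraight t
  ... | true | _ = refl
  tileWeight-weightOf w p j t | false | true = refl
  tileWeight-weightOf e p j t | false | true = refl
  tileWeight-weightOf w p j t | false | false = refl
  tileWeight-weightOf e p j t | false | false = refl

  prodP-rowWeight : ∀ r x {k} (y h : Fin k → P) (ts : Vec Tile k) → (∀ j → h j ≡ weightOf r x (y j) (Vec.lookup ts j)) →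
    prodP (List.tabulate h) ≈ rowWeight r x (Vec.tabulate y) ts
  prodP-rowWeight r x y h [] eq = ≈-refl
  prodP-rowWeight r x y h (t ∷ ts) eq = *-cong (reflexive (eq zero)) (prodP-rowWeight r x (y ∘ suc) (h ∘ suc) ts (eq ∘ suc))

  prodP-gridWeight : ∀ {k} (β : Vec RowType k) (φ : Vec (Fin m) k) (D : Grid k (suc n)) (g : Fin k → P) →
    (∀ r → g r ≈ rowWeight (Vec.lookup β r) (X (Vec.lookup φ r)) ys (Vec.lookup D r)) →
    prodP (List.tabulate g) ≈ gridWeight β (Vec.map X φ) ys D
  prodP-gridWeight [] [] [] g eq = ≈-refl
  prodP-gridWeight (r ∷ β) (p ∷ φ) (ts ∷ D) g eq = *-cong (eq zero) (prodP-gridWeight β φ D (g ∘ suc) (eq ∘ suc))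

  weight-gridWeight : ∀ (β : Vec RowType m) {φ} → pipes β ↭ List.tabulate (λ r → Vec.lookup φ r , r) →
    ∀ D → weight β D ≈ gridWeight β (Vec.map X φ) ys D
  weight-gridWeight β {φ} perm D = begin
    weight β D                                    ≈⟨ reflexive (cong prodP (ListP.map-cong (λ { (p , r) → refl }) (pipes β))) ⟩
    prodP (map rowProduct (pipes β))              ≈⟨ prodP-↭ rowProduct perm ⟩
    prodP (map rowProduct (List.tabulate pipe))   ≈⟨ reflexive (cong prodP (ListP.map-tabulate pipe rowProduct)) ⟩
    prodP (List.tabulate (rowProduct ∘ pipe))     ≈⟨ prodP-gridWeight β φ D (rowProduct ∘ pipe) rowProduct-rowWeight ⟩
    gridWeight β (Vec.map X φ) ys D ∎
    where
    pipe : Fin m → Fin m × Fin m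
    pipe r = Vec.lookup φ r , r
    entry : Fin m → Fin m → Fin (suc n) → P
    entry p r j = tileWeight (Vec.lookup β r) p j (Vec.lookup (Vec.lookup D r) j)
    rowProduct : Fin m × Fin m → P
    rowProduct (p , r) = prodP (map (entry p r) (allFin (suc n)))
    rowProduct-rowWeight : ∀ r → rowProduct (pipe r) ≈ rowWeight (Vec.lookup β r) (X (Vec.lookup φ r)) ys (Vec.lookup D r)
    rowProduct-rowWeight r = ≈-trans
      (reflexive (cong prodP (ListP.map-tabulate id (entry (Vec.lookup φ r) r))))
      (prodP-rowWeight (Vec.lookup β r) (X (Vec.lookup φ r)) Y (entry (Vec.lookup φ r) r) (Vec.lookup D r)
        (λ j → tileWeight-weightOf (Vec.lookup β r) (Vec.lookup φ r) j (Vec.lookup (Vec.lookup D r) j)))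

  standardRow : (Fin m → P) → (Fin m → Fin (suc n)) → Fin m → Row
  standardRow x π p = w , x p , π p

  exitWord : (Fin m → Fin (suc n)) → Vec Edge (suc n)
  exitWord π = word (map π (allFin m))

  rowList-zip : ∀ {k} (β : Vec RowType k) (φ : Vec (Fin m) k) (π : Fin m → Fin (suc n)) →
    rowList β (Vec.map X φ) (Vec.map π φ) ≡ map (λ (r , p) → r , X p , π p) (Vec.toList (Vec.zip β φ))
  rowList-zip [] [] π = refl
  rowList-zip (r ∷ β) (p ∷ φ) π = cong (_ ∷_) (rowList-zip β φ π)

  -- The right side no longer mentions β: pipe p sits in row p of a grid of w rows. Both rules are
  -- proved from this form.
  G-standard : ∀ (β : Vec RowType m) (ρ : Inj m (suc n)) →
    G β ρ ≈ Z ys (List.tabulate (standardRow X (proj₁ ρ))) (target (exitWord (proj₁ ρ)))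
  G-standard β ρ@(π , π-inj) with numbering β (allFin m) (ListP.length-tabulate id)
  ... | φ , num , perm = begin
    G β ρ
      ≈⟨ sumP-filter (isPipeDream β ρ) (weight β) (allGrids m (suc n)) ⟩
    ∑ (allGrids m (suc n)) (λ D → when (isPipeDream β ρ D) (weight β D))
      ≈⟨ ∑-cong (allGrids m (suc n)) term ⟩
    ∑ (allGrids m (suc n)) (λ D → when (gridFits β cs D) (gridWeight β (Vec.map X φ) ys D * target (exitWord π) (gridFlow β cs D)))
      ≈⟨ ≈-sym (Z-∑ β (Vec.map X φ) cs ys (target (exitWord π))) ⟩
    Z ys (rowList β (Vec.map X φ) cs) (target (exitWord π))
      ≈⟨ reflexive (cong (λ L → Z ys L (target (exitWord π))) (rowList-zip β φ π)) ⟩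
    Z ys (map (toRow ys X π A+B+X-X-cancel) (Vec.toList (Vec.zip β φ))) (target (exitWord π))
      ≈⟨ Z-hybrid ys X π A+B+X-X-cancel num (target (exitWord π)) ⟩
    Z ys (map (toRow ys X π A+B+X-X-cancel) (map (w ,_) (allFin m))) (target (exitWord π))
      ≈⟨ reflexive (cong (λ L → Z ys L (target (exitWord π)))
           (trans (sym (ListP.map-∘ (allFin m))) (ListP.map-tabulate id (standardRow X π)))) ⟩
    Z ys (List.tabulate (standardRow X π)) (target (exitWord π)) ∎
    where
    cs = Vec.map π φ
    when-target : ∀ a b {x y} → x ≈ y → when (a ∧ b) x ≈ when a (y * (if b then 1# else 0#))
    when-target true true {y = y} eq = ≈-trans eq (≈-sym (*-identityʳ y))
    when-target true false {y = y} eq = ≈-sym (zeroʳ y)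
    when-target false b eq = ≈-refl
    term : ∀ D → when (isPipeDream β ρ D) (weight β D)
               ≈ when (gridFits β cs D) (gridWeight β (Vec.map X φ) ys D * target (exitWord π) (gridFlow β cs D))
    term D = ≈-trans (reflexive (cong (λ b → when b (weight β D)) (isPipeDream-flow β perm π π-inj D)))
      (when-target (gridFits β cs D) _ (weight-gridWeight β perm D))

  private
    prodP-filter : ∀ {k ℓ} {Q : Pred (Fin k) ℓ} (Q? : Decidable Q) (f : Fin k → P) {l} (g : Fin l → Fin k) →
      prodP (map f (filter Q? (List.tabulate g))) ≈ prodIf (λ j → does (Q? (g j))) (f ∘ g)
    prodP-filter Q? f {zero} g = ≈-refl
    prodP-filter Q? f {suc l} g with does (Q? (g zero))
    ... | true = *-congˡ {f (g zero)} (prodP-filter Q? f (g ∘ suc))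
    ... | false = ≈-trans (prodP-filter Q? f (g ∘ suc)) (≈-sym (*-identityˡ _))

  pathProduct-formula : ∀ {k} (x : Fin k → P) (c : Fin k → Fin (suc n)) (f : Fin k → P) →
    (∀ i → f i ≈ pathWeight (x i) ys (c i)) →
    pathProduct ys (List.tabulate (λ i → x i , c i)) ≈ prodP (List.tabulate f)
  pathProduct-formula {zero} x c f eq = ≈-refl
  pathProduct-formula {suc k} x c f eq = *-cong (≈-sym (eq zero)) (pathProduct-formula (x ∘ suc) (c ∘ suc) (f ∘ suc) (eq ∘ suc))

  decreasingRule : ∀ β → DecreasingRule m (suc n) (G β)
  decreasingRule β ρ@(π , _) decr = coeffwise (begin
    G β ρ
      ≈⟨ G-standard β ρ ⟩
    Z ys (List.tabulate (standardRow X π)) (target (exitWord π))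
      ≈⟨ reflexive (cong₂ (λ L cs → Z ys L (target (word cs))) (sym (ListP.map-tabulate xc (w ,_)))
           (trans (ListP.map-tabulate id π) (sym (ListP.map-tabulate xc proj₂)))) ⟩
    Z ys (map (w ,_) (List.tabulate xc)) (target (word (map proj₂ (List.tabulate xc))))
      ≈⟨ Z-decreasing ys (List.tabulate xc) (AllPairsP.tabulate⁺-< (λ {i} {j} i<j → decr i j i<j)) ⟩
    pathProduct ys (List.tabulate xc)
      ≈⟨ pathProduct-formula X π factor (λ i → ≈-sym (≈-trans (pathWeight-prodIf (X i) Y (π i))
           (*-cong (*-congˡ {A + B} (≈-sym (prodP-filter (Fin._<? π i) (up i) id))) (≈-sym (prodP-filter (π i Fin.<?_) (down i) id))))) ⟩
    prodP (List.tabulate factor)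
      ≈⟨ reflexive (cong prodP (sym (ListP.map-tabulate id factor))) ⟩
    decreasingFormula ρ ∎)
    where
    xc : Fin m → P × Fin (suc n)
    xc i = X i , π i
    up down : Fin m → Fin (suc n) → P
    up i j = A + X i - Y j
    down i j = B - X i + Y j
    factor : Fin m → P
    factor i = (A + B) * prodP (map (up i) (filter (Fin._<? π i) (allFin (suc n))))
                       * prodP (map (down i) (filter (π i Fin.<?_) (allFin (suc n))))

  -- Rows North of the pair only change the continuation, and rows South of it act linearly, so
  -- `insert-ww` extends to any context.
  Z-exchange : ∀ pre post p α q β k →
    (𝐂 - (p - q)) * Z ys (pre ++ (w , p , α) ∷ (w , q , β) ∷ post) k
    ≈ (p - q) * Z ys (pre ++ (w , q , β) ∷ (w , p , α) ∷ post) k + 𝐂 * Z ys (pre ++ (w , q , α) ∷ (w , p , β) ∷ post) k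
  Z-exchange (ρ ∷ pre) post p α q β k = Z-exchange pre post p α q β _
  Z-exchange [] post p α q β k = begin
    _ ≈⟨ ≈-sym (Z-scale ys post (𝐂 - (p - q)) _) ⟩
    _ ≈⟨ Z-cong ys post (λ vs → insert-ww ys p α q β vs k) ⟩
    _ ≈⟨ Z-+ ys post _ _ ⟩
    _ ≈⟨ +-cong (Z-scale ys post (p - q) _) (Z-scale ys post 𝐂 _) ⟩
    _ ∎

  -- Rows i and j carry (x_i, π i), (x_j, π j) in `Zπ`, and (x_i, π j), (x_j, π i) in `Zπ′`.
  -- Exchanging the variables in the latter gives `Zσ` with (x_j, π j), (x_i, π i), the rows of `Zπ`
  -- in opposite order. These are the three terms of `Z-exchange`.
  dividedDifference : ∀ β → DividedDifference m (suc n) (G β)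
  dividedDifference β ρ@(π , _) i j j≡1+i = coeffwise (begin
    (X i - X j) * G β ρ
      ≈⟨ *-congˡ {X i - X j} {G β ρ} {Zπ} (G-standard β ρ) ⟩
    (X i - X j) * Zπ
      ≈⟨ solve-exchange polyRing (A + B) (X i) (X j) Zσ Zπ Zπ′ exchange ⟩
    (A + B) * Zπ′ - (A + B + X i - X j) * Zσ
      ≈⟨ +-cong (*-congˡ {A + B} {Zπ′} {G β ρ′} (≈-sym G-π′)) (-‿cong (*-congˡ {A + B + X i - X j} {Zσ} {swapX i j (G β ρ′)} (≈-sym G-σ))) ⟩
    (A + B) * G β ρ′ - (A + B + X i - X j) * swapX i j (G β ρ′) ∎)
    where
    ρ′ = ρ ∘r⟨ i , j ⟩
    π′ = proj₁ ρ′
    k = target (exitWord π)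
    f f′ f″ : Fin m → Row
    f = standardRow X π
    f′ = standardRow X π′
    f″ = standardRow (λ p → X (transpose i j p)) π′
    Zπ = Z ys (List.tabulate f) k
    Zπ′ = Z ys (List.tabulate f′) k
    Zσ = Z ys (List.tabulate f″) k

    sameWord : exitWord π′ ≡ exitWord π
    sameWord = word-cong forth back
      where
      forth : ∀ {c} → c ∈ map π′ (allFin m) → c ∈ map π (allFin m)
      forth c∈ with ∈-map⁻ π′ c∈
      ... | p , _ , refl = ∈-map⁺ π (∈-allFin (transpose i j p))
      back : ∀ {c} → c ∈ map π (allFin m) → c ∈ map π′ (allFin m)
      back c∈ with ∈-map⁻ π c∈
      ... | p , _ , refl = subst (λ q → π q ∈ map π′ (allFin m)) (transpose-involutive i j p)
                               (∈-map⁺ π′ (∈-allFin (transpose i j p)))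

    G-π′ : G β ρ′ ≈ Zπ′
    G-π′ = ≈-trans (G-standard β ρ′) (reflexive (cong (λ W → Z ys (List.tabulate f′) (target W)) sameWord))

    open SwapVariables {m} {suc n} i j
    open TransferHom polyRing A B (Fin (suc n)) (swapX i j) using (Z-hom; mapRow)

    G-σ : swapX i j (G β ρ′) ≈ Zσ
    G-σ = begin
      swapX i j (G β ρ′)  ≈⟨ swapX-cong G-π′ ⟩
      swapX i j Zπ′
        ≈⟨ Z-hom swapX-cong swapX-+ swapX-* swapX-neg ≈-refl (reflexive swapX-A) (reflexive swapX-B)
             (VecAllP.tabulate⁺ (λ c → reflexive (swapX-Y c))) (List.tabulate f′) k ⟩
      Z ys (map mapRow (List.tabulate f′)) (λ vs → swapX i j (k vs))
        -- The target takes only the values 0 and 1, which the substitution fixes.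
        ≈⟨ Z-cong ys (map mapRow (List.tabulate f′)) (λ vs → indicator-fixed (does (VecP.≡-dec _≟E_ (exitWord π) vs))) ⟩
      Z ys (map mapRow (List.tabulate f′)) k
        ≈⟨ reflexive (cong (λ L → Z ys L k) (trans (ListP.map-tabulate f′ _)
             (ListP.tabulate-cong (λ p → cong (λ x → w , x , π′ p) (swapX-X p))))) ⟩
      Zσ ∎
      where
      indicator-fixed : ∀ b → swapX i j (if b then 1# else 0#) ≈ (if b then 1# else 0#)
      indicator-fixed true = reflexive swapX-1
      indicator-fixed false = ≈-refl

    off : ∀ p → p ≢ i → p ≢ j → transpose i j p ≡ p
    off p = transpose-mismatch i j

    exchange : (A + B - (X j - X i)) * Zσ ≈ (X j - X i) * Zπ + (A + B) * Zπ′
    exchange with tabulate-adjacent f i j j≡1+i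
    ... | pre , post , split
      rewrite split f (λ _ _ _ → refl)
            | split f′ (λ p p≢i p≢j → cong (λ q → w , X p , π q) (off p p≢i p≢j))
            | split f″ (λ p p≢i p≢j → cong₂ (λ q q′ → w , X q , π q′) (off p p≢i p≢j) (off p p≢i p≢j))
            | transpose-matchˡ i j | transpose-matchʳ i j = Z-exchange pre post (X j) (π j) (X i) (π i) k

-- A potential on injections, and uniqueness

module _ where
  open import Data.Nat using (_+_; _*_)

  -- The offset b keeps the weights of the later entries unchanged when recursing into the tail.
  weightedSum : ∀ {m} → ℕ → (Fin m → ℕ) → ℕ
  weightedSum {zero} b f = 0
  weightedSum {suc m} b f = b * f zero + weightedSum (suc b) (f ∘ suc)

  weightedSum-cong : ∀ {m} b {f g : Fin m → ℕ} → (∀ k → f k ≡ g k) → weightedSum b f ≡ weightedSum b g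
  weightedSum-cong {zero} b eq = refl
  weightedSum-cong {suc m} b eq = cong₂ _+_ (cong (b *_) (eq zero)) (weightedSum-cong (suc b) (eq ∘ suc))

  transpose-suc : ∀ {m} (i j k : Fin m) → transpose (suc i) (suc j) (suc k) ≡ suc (transpose i j k)
  transpose-suc i j k with k FinP.≟ i
  ... | yes _ = refl
  ... | no _ with k FinP.≟ j
  ...   | yes _ = refl
  ...   | no _ = refl

  -- Adjacent weights differ by 1, so the sum drops by f j - f i.
  weightedSum-transpose : ∀ {m} b (f : Fin m → ℕ) i j → toℕ j ≡ suc (toℕ i) → f i < f j →
                          weightedSum b (f ∘ transpose i j) < weightedSum b f
  weightedSum-transpose b f zero (suc zero) refl lt = begin-strict
    b * y + (y′ + r)               ≡⟨ sym (ℕP.+-assoc (b * y) y′ r) ⟩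
    b * y + (x + b * x) + r        ≡⟨ cong (_+ r) (x∙yz≈z∙yx (b * y) x (b * x)) ⟩
    b * x + (x + b * y) + r        <⟨ ℕP.+-monoˡ-< r (ℕP.+-monoʳ-< (b * x) (ℕP.+-monoˡ-< (b * y) lt)) ⟩
    b * x + (y + b * y) + r        ≡⟨ ℕP.+-assoc (b * x) (y + b * y) r ⟩
    b * x + (y + b * y + r)        ∎
    where
    open ℕP.≤-Reasoning
    open import Algebra.Properties.CommutativeSemigroup ℕP.+-commutativeSemigroup using (x∙yz≈z∙yx)
    x = f zero
    y = f (suc zero)
    y′ = x + b * x
    r = weightedSum (suc (suc b)) (λ k → f (suc (suc k)))
  weightedSum-transpose b f (suc i) (suc j) eq lt = ℕP.+-monoʳ-< (b * f zero)
    (subst (_< weightedSum (suc b) (f ∘ suc))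
      (weightedSum-cong (suc b) (λ k → cong f (sym (transpose-suc i j k))))
      (weightedSum-transpose (suc b) (f ∘ suc) i j (ℕP.suc-injective eq) lt))

  decreasing-or-ascent : ∀ {m} (f : Fin m → ℕ) → (∀ {i j} → f i ≡ f j → i ≡ j) →
    (∀ i j → i Fin.< j → f j < f i) ⊎ (∃₂ λ i j → toℕ j ≡ suc (toℕ i) × f i < f j)
  decreasing-or-ascent {zero} f inj = inj₁ λ ()
  decreasing-or-ascent {suc zero} f inj = inj₁ λ { zero zero () }
  decreasing-or-ascent {suc (suc m)} f inj =
    extend (ℕP.<-cmp (f zero) (f (suc zero))) (decreasing-or-ascent (f ∘ suc) (FinP.suc-injective ∘ inj))
    where
    extend : Tri (f zero < f (suc zero)) (f zero ≡ f (suc zero)) (f (suc zero) < f zero) → _ → _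
    extend (tri< lt _ _) _ = inj₂ (zero , suc zero , refl , lt)
    extend (tri≈ _ eq _) _ with () ← inj eq
    extend (tri> _ _ gt) (inj₂ (i , j , eq , lt)) = inj₂ (suc i , suc j , cong suc eq , lt)
    extend (tri> _ _ gt) (inj₁ decr) = inj₁ λ
      { zero (suc zero) _ → gt
      ; zero (suc (suc j)) _ → ℕP.<-trans (decr zero (suc j) (s≤s z≤n)) gt
      ; (suc i) (suc j) (s≤s lt) → decr i j lt }

-- Exchanging the values at an adjacent ascent lowers Σ k π(k), so every injection is reached from
-- decreasing ones; X i − X j is not a zero divisor.
module Uniqueness {m n : ℕ} (F F′ : Inj m n → Poly m n)
  (decr : DecreasingRule m n F) (decr′ : DecreasingRule m n F′)
  (exch : DividedDifference m n F) (exch′ : DividedDifference m n F′) where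

  open PolynomialRing {m} {n}
  open CommutativeRing polyRing renaming (refl to ≈-refl; sym to ≈-sym; trans to ≈-trans) hiding (zero; _+_; _*_)

  private
    exchanged : (Inj m n → Poly m n) → Inj m n → Fin m → Fin m → Poly m n
    exchanged H ρ i j = (A +P B) *P H (ρ ∘r⟨ i , j ⟩) -P (A +P B +P X i -P X j) *P swapX i j (H (ρ ∘r⟨ i , j ⟩))

    rule : ∀ {H} → DecreasingRule m n H → ∀ ρ → Decreasing ρ → H ρ ≋ decreasingFormula ρ
    rule d ρ decreasing = mk (d ρ decreasing)

    exchange : ∀ {H} → DividedDifference m n H → ∀ ρ i j → toℕ j ≡ suc (toℕ i) → (X i -P X j) *P H ρ ≋ exchanged H ρ i j
    exchange d ρ i j eq = mk (d ρ i j eq)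

  -- The bound b on the potential makes the recursion structural.
  unique : ∀ b π → weightedSum 0 (toℕ ∘ proj₁ π) < b → F π ≋ F′ π
  unique (suc b) ρ@(π , inj) (s≤s bound) with decreasing-or-ascent (toℕ ∘ π) (inj ∘ FinP.toℕ-injective)
  ... | inj₁ d = ≈-trans (rule {F} decr ρ d) (≈-sym (rule {F′} decr′ ρ d))
  ... | inj₂ (i , j , eq , lt) = X-X-cancel i j i≢j (F ρ) (F′ ρ)
        (≈-trans (exchange {F} exch ρ i j eq) (≈-trans same (≈-sym (exchange {F′} exch′ ρ i j eq))))
    where
    i≢j : i ≢ j
    i≢j refl = ℕP.1+n≢n (sym eq)
    ρ′ = ρ ∘r⟨ i , j ⟩
    step : F ρ′ ≋ F′ ρ′
    step = unique b ρ′ (ℕP.<-≤-trans (weightedSum-transpose 0 (toℕ ∘ π) i j eq lt) bound)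
    same : exchanged F ρ i j ≋ exchanged F′ ρ i j
    same = +-cong (*-congˡ {A +P B} {F ρ′} {F′ ρ′} step)
      (-‿cong (*-congˡ {A +P B +P X i -P X j} {swapX i j (F ρ′)} {swapX i j (F′ ρ′)} (SwapVariables.swapX-cong i j step)))

theorem3p7 : (m n : ℕ) → 1 ≤ m → m ≤ n → (β : Vec RowType m) →
    DecreasingRule m n (G β) × DividedDifference m n (G β) ×
    ((F : Inj m n → Poly m n) → DecreasingRule m n F → DividedDifference m n F →
    (π : Inj m n) → F π ≈P G β π)
-- From 1 ≤ m ≤ n the width is positive, as the correspondence with colourings requires.
theorem3p7 (suc m) (suc n) _ _ β =
  decreasingRule β , dividedDifference β , λ F decr exch π →
    PolynomialRing.coeffwise (Uniqueness.unique F (G β) decr (decreasingRule β) exch (dividedDifference β) _ π (ℕP.n<1+n _))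
  where open Assembly (suc m) n
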